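{- Writing $\mathbb{Z}_5=\mathbb{Z}/5\mathbb{Z}$, we have $\mathfrak{s}(\mathbb{Z}_5^3)=37$, $\mathfrak{s}(\mathbb{Z}_5^4)\leq 157$, $\mathfrak{s}(\mathbb{Z}_5^5)\leq 690$, and $\mathfrak{s}(\mathbb{Z}_5^6)\leq 3091$.
   Context: For a finite abelian group $G$ and a positive integer $n$, a zero-sum subsequence of length $n$ of a sequence $g_1,\dots,g_k$ in $G$ is a choice of $n$ distinct indices $i_1<\dots<i_n$ with $g_{i_1}+\dots+g_{i_n}=0$. $\mathfrak{s}_{=n}(G)$ is the least integer $k$ such that every sequence of length $k$ in $G$ contains a zero-sum subsequence of length exactly $n$, and $\mathfrak{s}(G)=\mathfrak{s}_{=\exp(G)}(G)$, where $\exp(G)$ is the exponent of $G$. -}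

module Defs where

open import Data.Nat using (ℕ; zero; suc; _≤_)
open import Data.Nat.DivMod using (_mod_)
open import Data.Fin using (Fin; toℕ; _<_) renaming (zero to fzero; suc to fsuc)
open import Data.Vec using (Vec; zipWith; replicate)
open import Data.Product using (Σ; _×_; ∃-syntax)
open import Relation.Binary.PropositionalEquality using (_≡_)

_+₅_ : Fin 5 → Fin 5 → Fin 5
a +₅ b = (toℕ a Data.Nat.+ toℕ b) mod 5

Z5^ : ℕ → Set
Z5^ d = Vec (Fin 5) d

_⊕_ : ∀ {d} → Z5^ d → Z5^ d → Z5^ d
_⊕_ = zipWith _+₅_

𝟘 : ∀ {d} → Z5^ d
𝟘 = replicate _ fzero

Σᴳ : ∀ {d} (n : ℕ) → (Fin n → Z5^ d) → Z5^ d
Σᴳ zero    f = 𝟘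
Σᴳ (suc n) f = f fzero ⊕ Σᴳ n (λ i → f (fsuc i))

StrictlyIncreasing : ∀ {n k} → (Fin n → Fin k) → Set
StrictlyIncreasing ι = ∀ i j → i < j → ι i < ι j

HasZeroSumSubseq : ∀ {d k} (n : ℕ) → (Fin k → Z5^ d) → Set
HasZeroSumSubseq {d} {k} n g =
  Σ (Fin n → Fin k) λ ι → StrictlyIncreasing ι × (Σᴳ n (λ j → g (ι j)) ≡ 𝟘)

Forces : (d n k : ℕ) → Set
Forces d n k = (g : Fin k → Z5^ d) → HasZeroSumSubseq n g

Is-s₌ : (d n m : ℕ) → Set
Is-s₌ d n m = Forces d n m × (∀ k → Forces d n k → m ≤ k)

-- m is 𝔰(ℤ₅^d) = 𝔰₌exp(ℤ₅^d); exp(ℤ₅^d) = 5 for d ≥ 1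
Is-s : (d m : ℕ) → Set
Is-s d m = Is-s₌ d 5 m

{-# OPTIONS --safe #-}

-- Suppose L is a list of n vectors in 𝔽₅^d without five elements of sum zero. A 5-subset of L has sum
-- s ≠ 0, and s is annihilated by exactly 5^(d-1) of the 5^d functionals. Double counting yields a functional
-- w ≠ 0 for which (5^d - 1) Z ≤ (5^(d-1) - 1) C(n, 5), where Z is the number of 5-subsets with w-sum zero;
-- Z depends only on the sizes of the five classes of L modulo the kernel of w.
--
-- Each class lies in a hyperplane and has at most h = s(d-1) - 1 elements. If n is close to 5h, the class
-- sizes are nearly equal, and then Z is too close to C(n, 5) / 5. This gives 37 → 157 → 690 → 3091.
--
-- For d = 3 and n = 37 the classes have at most 16 elements, and Z is small enough only for 283 profiles of
-- class sizes up to affine substitutions; all of them have two large classes. After an affine normalisation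
-- of L (three points in a large class, one point in another class) a finite search, guided by the
-- profiles, shows that none of them occurs. The same search in a plane gives s(𝔽₅²) ≤ 17.
module Submission where

open import Defs
open import Data.Nat using (_≤_)
open import Data.Product using (_×_; ∃-syntax)
open import Data.Bool using (Bool; true; false; if_then_else_; T; _∧_; _∨_)
open import Data.Empty using (⊥; ⊥-elim)
open import Data.Fin using (Fin) renaming (zero to fzero; suc to fsuc)
import Data.Fin as Fin
import Data.Fin.Properties as Fin
open import Data.List using (List; []; _∷_; _++_; map; length; tabulate; filter; replicate; take; foldr)
open import Data.List.Membership.Propositional using (_∈_)
open import Data.List.Membership.Propositional.Properties using (∈-filter⁻)
open import Data.List.Properties using (length-map; length-tabulate; length-take; length-++; length-replicate; map-∘; map-cong; ++-assoc)
open import Data.List.Relation.Binary.Permutation.Propositional using (_↭_; ↭-sym; ↭-trans; ↭-reflexive; prep; swap) renaming (refl to ↭refl; trans to ↭trans)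
open import Data.List.Relation.Binary.Permutation.Propositional.Properties using (shift; shifts; map⁺; ++⁺; ++⁺ˡ)
open import Data.List.Relation.Unary.All using (All; []; _∷_)
import Data.List.Relation.Unary.All as All
open import Data.List.Relation.Unary.All.Properties using (all-filter)
open import Data.List.Relation.Unary.Any using (here; there)
open import Data.Nat using (ℕ; zero; suc; _+_; _*_; _∸_; _^_; _<_; z≤n; s≤s; _<ᵇ_; _≡ᵇ_)
open import Data.Nat.Combinatorics using (_C_; nCk+nC[k+1]≡[n+1]C[k+1]; nCn≡1)
open import Data.Nat.Properties hiding (_≟_)
import Data.Nat.Properties as ℕ
open import Data.Nat.Tactic.RingSolver using (solve-∀)
open import Data.Product using (Σ; _,_; proj₁; proj₂; ∃)
open import Data.Sum using (_⊎_; inj₁; inj₂; [_,_]′)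
open import Data.Unit using (⊤; tt)
open import Data.Vec using (Vec; []; _∷_; zipWith)
import Data.Vec as Vec
import Data.Vec.Properties as Vec
open import Function using (_∘_)
open import Relation.Binary using (DecidableEquality)
open import Relation.Binary.PropositionalEquality
open import Relation.Nullary using (¬_; Dec; yes; no; does)
open import Relation.Nullary.Decidable using (map′; from-yes; ¬?; _×-dec_; _→-dec_)

-- The field with five elements

-- Why equal classes keep `Z` close to C(n, 5) / 5: let χ be a nontrivial character of 𝔽₅. For a
-- list with h elements in every class, the generating polynomial of its sublists by length,
-- weighted by χ of the sum, is (1 + y^5)^h. So sublists of length one to four are equidistributed
-- over all sums, and length five slightly favours sum zero. A missing element x divides by 1 + χ(x)
-- y, whose inverse has coefficients of modulus one; hence b missing elements disturb the counts by
-- at most binomial amounts in b. In the formal proof a recursion on one removed element takes the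
-- place of the characters, so that everything stays in ℕ. This argument does not lead from the
-- plane to dimension three: there h = 16, so 5h - 37 = 43 elements are missing, and the error term
-- C(47, 5) exceeds C(37, 5) itself. Hence the enumeration of profiles and the search.

data 𝔽 : Set where
  #0 #1 #2 #3 #4 : 𝔽

toFin : 𝔽 → Fin 5
toFin #0 = fzero
toFin #1 = fsuc fzero
toFin #2 = fsuc (fsuc fzero)
toFin #3 = fsuc (fsuc (fsuc fzero))
toFin #4 = fsuc (fsuc (fsuc (fsuc fzero)))

fromFin : Fin 5 → 𝔽
fromFin fzero = #0
fromFin (fsuc fzero) = #1
fromFin (fsuc (fsuc fzero)) = #2
fromFin (fsuc (fsuc (fsuc fzero))) = #3
fromFin (fsuc (fsuc (fsuc (fsuc fzero)))) = #4

infix 4 _≟_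
_≟_ : DecidableEquality 𝔽
#0 ≟ #0 = yes refl
#0 ≟ #1 = no λ ()
#0 ≟ #2 = no λ ()
#0 ≟ #3 = no λ ()
#0 ≟ #4 = no λ ()
#1 ≟ #0 = no λ ()
#1 ≟ #1 = yes refl
#1 ≟ #2 = no λ ()
#1 ≟ #3 = no λ ()
#1 ≟ #4 = no λ ()
#2 ≟ #0 = no λ ()
#2 ≟ #1 = no λ ()
#2 ≟ #2 = yes refl
#2 ≟ #3 = no λ ()
#2 ≟ #4 = no λ ()
#3 ≟ #0 = no λ ()
#3 ≟ #1 = no λ ()
#3 ≟ #2 = no λ ()
#3 ≟ #3 = yes refl
#3 ≟ #4 = no λ ()
#4 ≟ #0 = no λ ()
#4 ≟ #1 = no λ ()
#4 ≟ #2 = no λ ()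
#4 ≟ #3 = no λ ()
#4 ≟ #4 = yes refl

-- Turns identities over the field into finite checks, which `from-yes` evaluates.
∀? : {P : 𝔽 → Set} → (∀ a → Dec (P a)) → Dec (∀ a → P a)
∀? {P} P? = map′ to (λ f → f #0 , f #1 , f #2 , f #3 , f #4)
    (P? #0 ×-dec P? #1 ×-dec P? #2 ×-dec P? #3 ×-dec P? #4)
  where
  to : P #0 × P #1 × P #2 × P #3 × P #4 → ∀ a → P a
  to (p , _) #0 = p
  to (_ , p , _) #1 = p
  to (_ , _ , p , _) #2 = p
  to (_ , _ , _ , p , _) #3 = p
  to (_ , _ , _ , _ , p) #4 = p

succ : 𝔽 → 𝔽
succ #0 = #1
succ #1 = #2
succ #2 = #3
succ #3 = #4
succ #4 = #0

infixl 6 _⊹_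
_⊹_ : 𝔽 → 𝔽 → 𝔽
#0 ⊹ b = b
#1 ⊹ b = succ b
#2 ⊹ b = succ (succ b)
#3 ⊹ b = succ (succ (succ b))
#4 ⊹ b = succ (succ (succ (succ b)))

neg : 𝔽 → 𝔽
neg #0 = #0
neg #1 = #4
neg #2 = #3
neg #3 = #2
neg #4 = #1

infixl 7 _·_
_·_ : 𝔽 → 𝔽 → 𝔽
#0 · b = #0
#1 · b = b
#2 · b = b ⊹ b
#3 · b = b ⊹ (b ⊹ b)
#4 · b = neg b

⊹-comm : ∀ a b → a ⊹ b ≡ b ⊹ a
⊹-comm = from-yes (∀? λ a → ∀? λ b → a ⊹ b ≟ b ⊹ a)

⊹-assoc : ∀ a b c → (a ⊹ b) ⊹ c ≡ a ⊹ (b ⊹ c)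
⊹-assoc = from-yes (∀? λ a → ∀? λ b → ∀? λ c → (a ⊹ b) ⊹ c ≟ a ⊹ (b ⊹ c))

⊹-identityʳ : ∀ a → a ⊹ #0 ≡ a
⊹-identityʳ = from-yes (∀? λ a → a ⊹ #0 ≟ a)

·-zeroʳ : ∀ a → a · #0 ≡ #0
·-zeroʳ = from-yes (∀? λ a → a · #0 ≟ #0)

·-distribˡ : ∀ a b c → a · (b ⊹ c) ≡ a · b ⊹ a · c
·-distribˡ = from-yes (∀? λ a → ∀? λ b → ∀? λ c → a · (b ⊹ c) ≟ a · b ⊹ a · c)

⊹-interchange : ∀ a b c d → (a ⊹ b) ⊹ (c ⊹ d) ≡ (a ⊹ c) ⊹ (b ⊹ d)
⊹-interchange = from-yes (∀? λ a → ∀? λ b → ∀? λ c → ∀? λ d → (a ⊹ b) ⊹ (c ⊹ d) ≟ (a ⊹ c) ⊹ (b ⊹ d))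

neg-⊹ : ∀ a b → neg (a ⊹ b) ≡ neg a ⊹ neg b
neg-⊹ = from-yes (∀? λ a → ∀? λ b → neg (a ⊹ b) ≟ neg a ⊹ neg b)

-- Vectors

W : ℕ → Set
W = Vec 𝔽

infixl 6 _⊞_
_⊞_ : ∀ {d} → W d → W d → W d
_⊞_ = zipWith _⊹_

𝟎 : ∀ {d} → W d
𝟎 = Vec.replicate _ #0

_≟ᵂ_ : ∀ {d} → DecidableEquality (W d)
_≟ᵂ_ = Vec.≡-dec _≟_

⊞-comm : ∀ {d} (u v : W d) → u ⊞ v ≡ v ⊞ u
⊞-comm = Vec.zipWith-comm ⊹-comm

⊞-assoc : ∀ {d} (u v w : W d) → (u ⊞ v) ⊞ w ≡ u ⊞ (v ⊞ w)
⊞-assoc = Vec.zipWith-assoc ⊹-assoc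

⊞-identityˡ : ∀ {d} (u : W d) → 𝟎 ⊞ u ≡ u
⊞-identityˡ = Vec.zipWith-identityˡ (λ _ → refl)

⊞-identityʳ : ∀ {d} (u : W d) → u ⊞ 𝟎 ≡ u
⊞-identityʳ = Vec.zipWith-identityʳ ⊹-identityʳ

⊞-swap : ∀ {d} (a u v : W d) → (a ⊞ u) ⊞ v ≡ (a ⊞ v) ⊞ u
⊞-swap a u v = trans (⊞-assoc a u v) (trans (cong (a ⊞_) (⊞-comm u v)) (sym (⊞-assoc a v u)))

dot : ∀ {d} → W d → W d → 𝔽
dot [] [] = #0
dot (a ∷ u) (b ∷ v) = a · b ⊹ dot u v

dot-⊞ : ∀ {d} (w u v : W d) → dot w (u ⊞ v) ≡ dot w u ⊹ dot w v
dot-⊞ [] [] [] = refl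
dot-⊞ (a ∷ w) (b ∷ u) (c ∷ v) = trans (cong₂ _⊹_ (·-distribˡ a b c) (dot-⊞ w u v)) (⊹-interchange (a · b) (a · c) (dot w u) (dot w v))

dot-𝟎ʳ : ∀ {d} (w : W d) → dot w 𝟎 ≡ #0
dot-𝟎ʳ [] = refl
dot-𝟎ʳ (a ∷ w) = trans (cong (_⊹ dot w 𝟎) (·-zeroʳ a)) (dot-𝟎ʳ w)

-- Counting sublists

module Count {A : Set} (_∙_ : A → A → A) where

  -- Sum of P over all acc ∙ x₁ ∙ … ∙ xₖ, where x₁, …, xₖ is a sublist of xs.
  cnt : (A → ℕ) → ℕ → List A → A → ℕ
  cnt P zero xs acc = P acc
  cnt P (suc k) [] acc = 0
  cnt P (suc k) (x ∷ xs) acc = cnt P k xs (acc ∙ x) + cnt P (suc k) xs acc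

  cnt-mono : ∀ {P Q} → (∀ s → P s ≤ Q s) → ∀ k xs acc → cnt P k xs acc ≤ cnt Q k xs acc
  cnt-mono P≤Q zero xs acc = P≤Q acc
  cnt-mono P≤Q (suc k) [] acc = z≤n
  cnt-mono P≤Q (suc k) (x ∷ xs) acc = +-mono-≤ (cnt-mono P≤Q k xs (acc ∙ x)) (cnt-mono P≤Q (suc k) xs acc)

  cnt-+ : ∀ P Q k xs acc → cnt (λ s → P s + Q s) k xs acc ≡ cnt P k xs acc + cnt Q k xs acc
  cnt-+ P Q zero xs acc = refl
  cnt-+ P Q (suc k) [] acc = refl
  cnt-+ P Q (suc k) (x ∷ xs) acc rewrite cnt-+ P Q k xs (acc ∙ x) | cnt-+ P Q (suc k) xs acc =
    rearrange (cnt P k xs (acc ∙ x)) (cnt Q k xs (acc ∙ x)) (cnt P (suc k) xs acc) (cnt Q (suc k) xs acc)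
    where
    rearrange : ∀ a b c d → (a + b) + (c + d) ≡ (a + c) + (b + d)
    rearrange = solve-∀

  cnt-* : ∀ c P k xs acc → cnt (λ s → c * P s) k xs acc ≡ c * cnt P k xs acc
  cnt-* c P zero xs acc = refl
  cnt-* c P (suc k) [] acc = sym (*-zeroʳ c)
  cnt-* c P (suc k) (x ∷ xs) acc rewrite cnt-* c P k xs (acc ∙ x) | cnt-* c P (suc k) xs acc =
    sym (*-distribˡ-+ c (cnt P k xs (acc ∙ x)) (cnt P (suc k) xs acc))

  cnt-1 : ∀ k xs acc → cnt (λ _ → 1) k xs acc ≡ length xs C k
  cnt-1 zero xs acc = refl
  cnt-1 (suc k) [] acc = refl
  cnt-1 (suc k) (x ∷ xs) acc = trans (cong₂ _+_ (cnt-1 k xs (acc ∙ x)) (cnt-1 (suc k) xs acc)) (nCk+nC[k+1]≡[n+1]C[k+1] (length xs) k)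

  cnt-take : ∀ n P k xs acc → cnt P k (take n xs) acc ≤ cnt P k xs acc
  cnt-take n P zero xs acc = ≤-refl
  cnt-take zero P (suc k) xs acc = z≤n
  cnt-take (suc n) P (suc k) [] acc = z≤n
  cnt-take (suc n) P (suc k) (x ∷ xs) acc = +-mono-≤ (cnt-take n P k xs (acc ∙ x)) (cnt-take n P (suc k) xs acc)

  cnt-filter : ∀ {Q : A → Set} (Q? : ∀ a → Dec (Q a)) P k xs acc → cnt P k (filter Q? xs) acc ≤ cnt P k xs acc
  cnt-filter Q? P zero xs acc = ≤-refl
  cnt-filter Q? P (suc k) [] acc = z≤n
  cnt-filter Q? P (suc k) (x ∷ xs) acc with does (Q? x)
  ... | true = +-mono-≤ (cnt-filter Q? P k xs (acc ∙ x)) (cnt-filter Q? P (suc k) xs acc)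
  ... | false = ≤-trans (cnt-filter Q? P (suc k) xs acc) (m≤n+m _ _)

  module _ (∙-swap : ∀ a x y → (a ∙ x) ∙ y ≡ (a ∙ y) ∙ x) where

    cnt-↭ : ∀ P k {xs ys} → xs ↭ ys → ∀ acc → cnt P k xs acc ≡ cnt P k ys acc
    cnt-↭ P zero p acc = refl
    cnt-↭ P (suc k) ↭refl acc = refl
    cnt-↭ P (suc k) (prep x p) acc = cong₂ _+_ (cnt-↭ P k p (acc ∙ x)) (cnt-↭ P (suc k) p acc)
    -- With only one element left to take, no sublist contains both `x` and `y`; for longer ones
    -- these sublists are matched by `∙-swap`.
    cnt-↭ P (suc zero) (swap {xs} {ys} x y p) acc rewrite cnt-↭ P 1 p acc =
      trans (sym (+-assoc (P (acc ∙ x)) _ _)) (trans (cong (_+ cnt P 1 ys acc) (+-comm (P (acc ∙ x)) _)) (+-assoc (P (acc ∙ y)) _ _))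
    cnt-↭ P (suc (suc k)) (swap {xs} {ys} x y p) acc
      rewrite ∙-swap acc x y | cnt-↭ P k p ((acc ∙ y) ∙ x) | cnt-↭ P (suc k) p (acc ∙ x) | cnt-↭ P (suc k) p (acc ∙ y) | cnt-↭ P (suc (suc k)) p acc =
      rearrange (cnt P k ys ((acc ∙ y) ∙ x)) (cnt P (suc k) ys (acc ∙ x)) (cnt P (suc k) ys (acc ∙ y)) (cnt P (suc (suc k)) ys acc)
      where
      rearrange : ∀ a b c d → (a + b) + (c + d) ≡ (a + c) + (b + d)
      rearrange = solve-∀
    cnt-↭ P (suc k) (↭trans p q) acc = trans (cnt-↭ P (suc k) p acc) (cnt-↭ P (suc k) q acc)

open Count

-- Comparison of counts along a map that is compatible with the partial sums.
cnt-map : ∀ {A B : Set} (_∙_ : A → A → A) (_∘′_ : B → B → B) (P : A → ℕ) (Q : B → ℕ) (f : A → B)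
  (R : ℕ → B → A → Set) {xs : List A} (X : A → Set) → All X xs →
  (∀ {k b a x} → X x → R (suc k) b a → R k (b ∘′ f x) (a ∙ x)) →
  (∀ {b a} → R 0 b a → Q b ≤ P a) →
  ∀ k {b a} → R k b a → cnt _∘′_ Q k (map f xs) b ≤ cnt _∙_ P k xs a
cnt-map _∙_ _∘′_ P Q f R X all step end zero r = end r
cnt-map _∙_ _∘′_ P Q f R X [] step end (suc k) r = z≤n
cnt-map _∙_ _∘′_ P Q f R X (x ∷ all) step end (suc k) r =
  +-mono-≤ (cnt-map _∙_ _∘′_ P Q f R X all step end k (step x r)) (cnt-map _∙_ _∘′_ P Q f R X all step end (suc k) r)

⟦_⟧ : ∀ {A : Set} → Dec A → ℕ
⟦ a? ⟧ = if does a? then 1 else 0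

⟦⟧-yes : ∀ {A : Set} (a? : Dec A) → A → ⟦ a? ⟧ ≡ 1
⟦⟧-yes (yes _) _ = refl
⟦⟧-yes (no ¬a) a = ⊥-elim (¬a a)

⟦⟧-no : ∀ {A : Set} (a? : Dec A) → ¬ A → ⟦ a? ⟧ ≡ 0
⟦⟧-no (yes a) ¬a = ⊥-elim (¬a a)
⟦⟧-no (no _) _ = refl

⟦⟧-mono : ∀ {A B : Set} (a? : Dec A) (b? : Dec B) → (A → B) → ⟦ a? ⟧ ≤ ⟦ b? ⟧
⟦⟧-mono (no _) _ _ = z≤n
⟦⟧-mono (yes a) b? f = ≤-reflexive (sym (⟦⟧-yes b? (f a)))

-- Lists without five elements of sum zero

zero? : ∀ {d} → W d → ℕ
zero? v = ⟦ v ≟ᵂ 𝟎 ⟧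

zs : ∀ {d} → List (W d) → ℕ
zs L = cnt _⊞_ zero? 5 L 𝟎

Good : ∀ {d} → List (W d) → Set
Good L = zs L ≡ 0

Bounds : ℕ → ℕ → Set
Bounds d k = ∀ (L : List (W d)) → length L ≡ k → ¬ Good L

Bounds-≤ : ∀ {d k} → Bounds d k → ∀ (L : List (W d)) → k ≤ length L → ¬ Good L
Bounds-≤ {k = k} b L k≤ good = b (take k L) (trans (length-take k L) (m≤n⇒m⊓n≡m k≤))
  (n≤0⇒n≡0 (≤-trans (cnt-take _⊞_ k zero? 5 L 𝟎) (≤-reflexive good)))

zs-↭ : ∀ {d} {L M : List (W d)} → L ↭ M → Good L → Good M
zs-↭ p g = trans (sym (cnt-↭ _⊞_ ⊞-swap zero? 5 p 𝟎)) g

≤-Good : ∀ {d e} {L : List (W d)} {M : List (W e)} → zs L ≤ zs M → Good M → Good L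
≤-Good le g = n≤0⇒n≡0 (≤-trans le (≤-reflexive g))

-- Sequences indexed by Fin and lists

toW : ∀ {d} → Z5^ d → W d
toW = Vec.map fromFin

fromFin-injective : ∀ a b → fromFin a ≡ fromFin b → a ≡ b
fromFin-injective a b e = trans (sym (toFin-fromFin a)) (trans (cong toFin e) (toFin-fromFin b))
  where
  toFin-fromFin : ∀ a → toFin (fromFin a) ≡ a
  toFin-fromFin = from-yes (Fin.all? λ a → toFin (fromFin a) Fin.≟ a)

fromFin-+ : ∀ a b → fromFin (a +₅ b) ≡ fromFin a ⊹ fromFin b
fromFin-+ = from-yes (Fin.all? λ a → Fin.all? λ b → fromFin (a +₅ b) ≟ fromFin a ⊹ fromFin b)

toW-⊕ : ∀ {d} (u v : Z5^ d) → toW (u ⊕ v) ≡ toW u ⊞ toW v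
toW-⊕ [] [] = refl
toW-⊕ (a ∷ u) (b ∷ v) = cong₂ _∷_ (fromFin-+ a b) (toW-⊕ u v)

toW-𝟘 : ∀ {d} → toW {d} 𝟘 ≡ 𝟎
toW-𝟘 {zero} = refl
toW-𝟘 {suc d} = cong (#0 ∷_) toW-𝟘

toW-injective : ∀ {d} (u v : Z5^ d) → toW u ≡ toW v → u ≡ v
toW-injective [] [] _ = refl
toW-injective (a ∷ u) (b ∷ v) e = cong₂ _∷_ (fromFin-injective a b (Vec.∷-injectiveˡ e)) (toW-injective u v (Vec.∷-injectiveʳ e))

seq : ∀ {d k} → (Fin k → Z5^ d) → List (W d)
seq g = tabulate (toW ∘ g)

Σᴳ-cong : ∀ {d} k {f h : Fin k → Z5^ d} → (∀ i → f i ≡ h i) → Σᴳ k f ≡ Σᴳ k h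
Σᴳ-cong zero e = refl
Σᴳ-cong (suc k) e = cong₂ _⊕_ (e fzero) (Σᴳ-cong k (e ∘ fsuc))

lower : ∀ {n} (j : Fin (suc n)) → 0 < Fin.toℕ j → Σ (Fin n) λ i → j ≡ fsuc i
lower (fsuc j) _ = j , refl

module _ {d : ℕ} (P : W d → ℕ) where

  -- A nonzero sum has a nonzero summand; following the recursion of `cnt` to it records which
  -- indices are taken.
  extract : ∀ k {n} (g : Fin n → Z5^ d) acc → cnt _⊞_ P k (seq g) acc ≢ 0 →
    Σ (Fin k → Fin n) λ ι → StrictlyIncreasing ι × P (acc ⊞ toW (Σᴳ k (g ∘ ι))) ≢ 0
  extract zero g acc ne = (λ ()) , (λ ()) , λ e → ne (trans (cong P (sym (trans (cong (acc ⊞_) toW-𝟘) (⊞-identityʳ acc)))) e)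
  extract (suc k) {zero} g acc ne = ⊥-elim (ne refl)
  extract (suc k) {suc n} g acc ne with cnt _⊞_ P k (seq (g ∘ fsuc)) (acc ⊞ toW (g fzero)) ℕ.≟ 0
  ... | yes e with extract (suc k) (g ∘ fsuc) acc (λ e′ → ne (cong₂ _+_ e e′))
  ...   | ι , inc , p = fsuc ∘ ι , (λ i j lt → s≤s (inc i j lt)) , p
  extract (suc k) {suc n} g acc ne | no ne′ with extract k (g ∘ fsuc) (acc ⊞ toW (g fzero)) ne′
  ... | ι , inc , p = ι′ , inc′ , λ e → p (trans (cong P (trans (⊞-assoc acc _ _) (cong (acc ⊞_) (sym (toW-⊕ _ _))))) e)
    where
    ι′ : Fin (suc k) → Fin (suc n)
    ι′ fzero = fzero
    ι′ (fsuc i) = fsuc (ι i)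
    inc′ : StrictlyIncreasing ι′
    inc′ fzero (fsuc j) _ = s≤s z≤n
    inc′ (fsuc i) (fsuc j) (s≤s lt) = s≤s (inc i j lt)

  -- The value ι 0 decides whether the head of the sequence is taken. All later values are larger,
  -- hence successors, and the remaining choice lives in the tail.
  include : ∀ k {n} (g : Fin n → Z5^ d) acc (ι : Fin k → Fin n) → StrictlyIncreasing ι →
    P (acc ⊞ toW (Σᴳ k (g ∘ ι))) ≤ cnt _⊞_ P k (seq g) acc
  include zero g acc ι inc = ≤-reflexive (cong P (trans (cong (acc ⊞_) toW-𝟘) (⊞-identityʳ acc)))
  include (suc k) {zero} g acc ι inc with ι fzero
  ... | ()
  include (suc k) {suc n} g acc ι inc with ι fzero in eq
  ... | fzero = ≤-trans (≤-reflexive (cong P (trans (cong (acc ⊞_) (trans (toW-⊕ _ _) (cong (λ s → toW (g fzero) ⊞ toW s) (Σᴳ-cong k λ i → cong g (proj₂ (tail i)))))) (sym (⊞-assoc acc _ _)))))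
        (≤-trans (include k (g ∘ fsuc) (acc ⊞ toW (g fzero)) (λ i → proj₁ (tail i)) inc′) (m≤m+n _ _))
    where
    tail : ∀ i → Σ (Fin n) λ j → ι (fsuc i) ≡ fsuc j
    tail i = lower (ι (fsuc i)) (subst (λ j → Fin.toℕ j < Fin.toℕ (ι (fsuc i))) eq (inc fzero (fsuc i) (s≤s z≤n)))
    inc′ : StrictlyIncreasing (λ i → proj₁ (tail i))
    inc′ i j lt = ≤-pred (subst₂ Fin._<_ (proj₂ (tail i)) (proj₂ (tail j)) (inc (fsuc i) (fsuc j) (s≤s lt)))
  ... | fsuc m = ≤-trans (≤-reflexive (cong (λ s → P (acc ⊞ toW s)) (cong₂ _⊕_ (cong g (sym eq)) refl)))
        (≤-trans (≤-reflexive (cong (λ s → P (acc ⊞ toW s)) (Σᴳ-cong (suc k) λ i → cong g (proj₂ (all i)))))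
        (≤-trans (include (suc k) (g ∘ fsuc) acc (λ i → proj₁ (all i)) inc′) (m≤n+m _ _)))
    where
    positive : ∀ i → 0 < Fin.toℕ (ι i)
    positive fzero = subst (λ j → 0 < Fin.toℕ j) (sym eq) (s≤s z≤n)
    positive (fsuc i) = <-trans (positive fzero) (inc fzero (fsuc i) (s≤s z≤n))
    all : ∀ i → Σ (Fin n) λ j → ι i ≡ fsuc j
    all i = lower (ι i) (positive i)
    inc′ : StrictlyIncreasing (λ i → proj₁ (all i))
    inc′ i j lt = ≤-pred (subst₂ Fin._<_ (proj₂ (all i)) (proj₂ (all j)) (inc i j lt))

zero?≢0 : ∀ {d} (v : W d) → zero? v ≢ 0 → v ≡ 𝟎
zero?≢0 v ne with v ≟ᵂ 𝟎
... | yes e = e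
... | no _ = ⊥-elim (ne refl)

¬Good⇒zeroSum : ∀ {d k} (g : Fin k → Z5^ d) → ¬ Good (seq g) → HasZeroSumSubseq 5 g
¬Good⇒zeroSum g ¬good with extract zero? 5 g 𝟎 ¬good
... | ι , inc , p = ι , inc , toW-injective _ _ (trans (trans (sym (⊞-identityˡ _)) (zero?≢0 _ p)) (sym toW-𝟘))

zeroSum⇒¬Good : ∀ {d k} (g : Fin k → Z5^ d) → HasZeroSumSubseq 5 g → ¬ Good (seq g)
zeroSum⇒¬Good g (ι , inc , e) good =
  contra (trans (cong (λ s → 𝟎 ⊞ toW s) e) (trans (⊞-identityˡ _) toW-𝟘)) (≤-trans (include zero? 5 g 𝟎 ι inc) (≤-reflexive good))
  where
  contra : ∀ {d} {v : W d} → v ≡ 𝟎 → ¬ (zero? v ≤ 0)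
  contra {v = v} v≡𝟎 le rewrite ⟦⟧-yes (v ≟ᵂ 𝟎) v≡𝟎 with le
  ... | ()

Bounds⇒Forces : ∀ {d k} → Bounds d k → Forces d 5 k
Bounds⇒Forces b g = ¬Good⇒zeroSum g (b (seq g) (length-tabulate (toW ∘ g)))

-- Summation over 𝔽 and over W d

Σ𝔽 : (𝔽 → ℕ) → ℕ
Σ𝔽 f = f #0 + (f #1 + (f #2 + (f #3 + f #4)))

Σ𝔽-mono : ∀ {f g} → (∀ a → f a ≤ g a) → Σ𝔽 f ≤ Σ𝔽 g
Σ𝔽-mono h = +-mono-≤ (h #0) (+-mono-≤ (h #1) (+-mono-≤ (h #2) (+-mono-≤ (h #3) (h #4))))

Σ𝔽-cong : ∀ {f g} → (∀ a → f a ≡ g a) → Σ𝔽 f ≡ Σ𝔽 g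
Σ𝔽-cong h = cong₂ _+_ (h #0) (cong₂ _+_ (h #1) (cong₂ _+_ (h #2) (cong₂ _+_ (h #3) (h #4))))

Σ𝔽-const : ∀ c → Σ𝔽 (λ _ → c) ≡ 5 * c
Σ𝔽-const = expand
  where
  expand : ∀ c → c + (c + (c + (c + c))) ≡ 5 * c
  expand = solve-∀

Σ𝔽-* : ∀ c f → Σ𝔽 (λ a → c * f a) ≡ c * Σ𝔽 f
Σ𝔽-* c f = expand c (f #0) (f #1) (f #2) (f #3) (f #4)
  where
  expand : ∀ c p q r s t → c * p + (c * q + (c * r + (c * s + c * t))) ≡ c * (p + (q + (r + (s + t))))
  expand = solve-∀

Σ𝔽-+ : ∀ f g → Σ𝔽 (λ a → f a + g a) ≡ Σ𝔽 f + Σ𝔽 g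
Σ𝔽-+ f g = expand (f #0) (f #1) (f #2) (f #3) (f #4) (g #0) (g #1) (g #2) (g #3) (g #4)
  where
  expand : ∀ p q r s t p′ q′ r′ s′ t′ →
    (p + p′) + ((q + q′) + ((r + r′) + ((s + s′) + (t + t′)))) ≡ (p + (q + (r + (s + t)))) + (p′ + (q′ + (r′ + (s′ + t′))))
  expand = solve-∀

Σᵂ : ∀ d → (W d → ℕ) → ℕ
Σᵂ zero f = f []
Σᵂ (suc d) f = Σ𝔽 λ a → Σᵂ d λ w → f (a ∷ w)

Σᵂ-mono : ∀ d {f g : W d → ℕ} → (∀ w → f w ≤ g w) → Σᵂ d f ≤ Σᵂ d g
Σᵂ-mono zero h = h []
Σᵂ-mono (suc d) h = Σ𝔽-mono λ a → Σᵂ-mono d λ w → h (a ∷ w)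

Σᵂ-cong : ∀ d {f g : W d → ℕ} → (∀ w → f w ≡ g w) → Σᵂ d f ≡ Σᵂ d g
Σᵂ-cong zero h = h []
Σᵂ-cong (suc d) h = Σ𝔽-cong λ a → Σᵂ-cong d λ w → h (a ∷ w)

Σᵂ-const : ∀ d c → Σᵂ d (λ _ → c) ≡ 5 ^ d * c
Σᵂ-const zero c = sym (*-identityˡ c)
Σᵂ-const (suc d) c = trans (cong (λ z → Σ𝔽 λ _ → z) (Σᵂ-const d c)) (trans (Σ𝔽-const (5 ^ d * c)) (sym (*-assoc 5 (5 ^ d) c)))

Σᵂ-+ : ∀ d (f g : W d → ℕ) → Σᵂ d (λ w → f w + g w) ≡ Σᵂ d f + Σᵂ d g
Σᵂ-+ zero f g = refl
Σᵂ-+ (suc d) f g = trans (Σ𝔽-cong λ a → Σᵂ-+ d (λ w → f (a ∷ w)) (λ w → g (a ∷ w)))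
  (Σ𝔽-+ (λ a → Σᵂ d λ w → f (a ∷ w)) (λ a → Σᵂ d λ w → g (a ∷ w)))

Σᵂ-* : ∀ d c (f : W d → ℕ) → Σᵂ d (λ w → c * f w) ≡ c * Σᵂ d f
Σᵂ-* zero c f = refl
Σᵂ-* (suc d) c f = trans (Σ𝔽-cong λ a → Σᵂ-* d c (λ w → f (a ∷ w))) (Σ𝔽-* c (λ a → Σᵂ d λ w → f (a ∷ w)))

cnt-Σᵂ : ∀ {A : Set} (_∙_ : A → A → A) d (P : W d → A → ℕ) k xs acc →
  cnt _∙_ (λ s → Σᵂ d λ w → P w s) k xs acc ≡ Σᵂ d λ w → cnt _∙_ (P w) k xs acc
cnt-Σᵂ _∙_ zero P k xs acc = refl
cnt-Σᵂ _∙_ (suc d) P k xs acc = trans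
    (trans (cnt-+ _∙_ (Q #0) _ k xs acc) (cong (cnt _∙_ (Q #0) k xs acc +_)
    (trans (cnt-+ _∙_ (Q #1) _ k xs acc) (cong (cnt _∙_ (Q #1) k xs acc +_)
    (trans (cnt-+ _∙_ (Q #2) _ k xs acc) (cong (cnt _∙_ (Q #2) k xs acc +_)
    (cnt-+ _∙_ (Q #3) (Q #4) k xs acc)))))))
    (Σ𝔽-cong λ a → cnt-Σᵂ _∙_ d (λ w → P (a ∷ w)) k xs acc)
  where
  Q : 𝔽 → _ → ℕ
  Q a s = Σᵂ d λ w → P (a ∷ w) s

Σᵂ-zero? : ∀ d → Σᵂ d zero? ≡ 1
Σᵂ-zero? zero = refl
Σᵂ-zero? (suc d) = begin
    Σᵂ d (λ w → zero? (#0 ∷ w)) + rest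
      ≡⟨ cong₂ _+_ (Σᵂ-cong d λ w → ⟦⟧-iff ((#0 ∷ w) ≟ᵂ 𝟎) (w ≟ᵂ 𝟎) Vec.∷-injectiveʳ (cong (#0 ∷_))) none ⟩
    Σᵂ d zero? + 0
      ≡⟨ trans (+-identityʳ _) (Σᵂ-zero? d) ⟩
    1 ∎
  where
  open ≡-Reasoning
  ⟦⟧-iff : ∀ {A B : Set} (a? : Dec A) (b? : Dec B) → (A → B) → (B → A) → ⟦ a? ⟧ ≡ ⟦ b? ⟧
  ⟦⟧-iff a? b? f g = ≤-antisym (⟦⟧-mono a? b? f) (⟦⟧-mono b? a? g)
  zeros : ∀ a → a ≢ #0 → Σᵂ d (λ w → zero? (a ∷ w)) ≡ 0
  zeros a a≢0 = trans (Σᵂ-cong d λ w → ⟦⟧-no ((a ∷ w) ≟ᵂ 𝟎) (a≢0 ∘ Vec.∷-injectiveˡ)) (trans (Σᵂ-const d 0) (*-zeroʳ (5 ^ d)))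
  rest = Σᵂ d (λ w → zero? (#1 ∷ w)) + (Σᵂ d (λ w → zero? (#2 ∷ w)) + (Σᵂ d (λ w → zero? (#3 ∷ w)) + Σᵂ d (λ w → zero? (#4 ∷ w))))
  none : rest ≡ 0
  none = cong₂ _+_ (zeros #1 λ ()) (cong₂ _+_ (zeros #2 λ ()) (cong₂ _+_ (zeros #3 λ ()) (zeros #4 λ ())))

-- Induction on the dimension. If the tail of `s` vanishes, its head is a unit and the first
-- coefficient of the functional alone determines the value. Otherwise each first coefficient leaves
-- an inhomogeneous equation on the tail, which is why the target `t` is arbitrary.
dot-equidistributed : ∀ d (s : W (suc d)) t → s ≢ 𝟎 → Σᵂ (suc d) (λ w → ⟦ dot w s ≟ t ⟧) ≡ 5 ^ d
dot-equidistributed d (x ∷ v) t s≢𝟎 with v ≟ᵂ 𝟎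
dot-equidistributed d (x ∷ v) t s≢𝟎 | yes refl = begin
    Σ𝔽 (λ a → Σᵂ d λ w → ⟦ a · x ⊹ dot w 𝟎 ≟ t ⟧)
      ≡⟨ Σ𝔽-cong (λ a → trans (Σᵂ-cong d λ w → cong (λ q → ⟦ q ≟ t ⟧) (trans (cong (a · x ⊹_) (dot-𝟎ʳ w)) (⊹-identityʳ (a · x)))) (Σᵂ-const d _)) ⟩
    Σ𝔽 (λ a → 5 ^ d * ⟦ a · x ≟ t ⟧)
      ≡⟨ Σ𝔽-* (5 ^ d) (λ a → ⟦ a · x ≟ t ⟧) ⟩
    5 ^ d * Σ𝔽 (λ a → ⟦ a · x ≟ t ⟧)
      ≡⟨ cong (5 ^ d *_) (unit x t λ x≡0 → s≢𝟎 (cong (_∷ 𝟎) x≡0)) ⟩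
    5 ^ d * 1
      ≡⟨ *-identityʳ (5 ^ d) ⟩
    5 ^ d ∎
  where
  open ≡-Reasoning
  unit : ∀ x t → x ≢ #0 → Σ𝔽 (λ a → ⟦ a · x ≟ t ⟧) ≡ 1
  unit = from-yes (∀? λ x → ∀? λ t → ¬? (x ≟ #0) →-dec (Σ𝔽 (λ a → ⟦ a · x ≟ t ⟧) ℕ.≟ 1))
dot-equidistributed zero (x ∷ []) t s≢𝟎 | no v≢𝟎 = ⊥-elim (v≢𝟎 refl)
dot-equidistributed (suc d) (x ∷ v) t s≢𝟎 | no v≢𝟎 = begin
    Σ𝔽 (λ a → Σᵂ (suc d) λ w → ⟦ a · x ⊹ dot w v ≟ t ⟧)
      ≡⟨ Σ𝔽-cong (λ a → trans (Σᵂ-cong (suc d) λ w → transpose (a · x) (dot w v) t) (dot-equidistributed d v (t ⊹ neg (a · x)) v≢𝟎)) ⟩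
    Σ𝔽 (λ _ → 5 ^ d)
      ≡⟨ Σ𝔽-const (5 ^ d) ⟩
    5 ^ suc d ∎
  where
  open ≡-Reasoning
  transpose : ∀ b q t → ⟦ b ⊹ q ≟ t ⟧ ≡ ⟦ q ≟ t ⊹ neg b ⟧
  transpose = from-yes (∀? λ b → ∀? λ q → ∀? λ t → ⟦ b ⊹ q ≟ t ⟧ ℕ.≟ ⟦ q ≟ t ⊹ neg b ⟧)

-- Counting by functionals and averaging

N : ℕ → 𝔽 → List 𝔽 → ℕ
N zero t xs = ⟦ t ≟ #0 ⟧
N (suc k) t [] = 0
N (suc k) t (x ∷ xs) = N k (t ⊹ neg x) xs + N (suc k) t xs

null : 𝔽 → ℕ
null s = ⟦ s ≟ #0 ⟧

-- `N` consumes a target where `cnt` accumulates a sum. The target form lets the counts for all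
-- targets be extended by one element through a rotation of tables; the accumulated form inherits
-- the general results on `cnt`.
N-cnt : ∀ k xs acc → N k (neg acc) xs ≡ cnt _⊹_ null k xs acc
N-cnt zero xs acc = from-yes (∀? λ a → ⟦ neg a ≟ #0 ⟧ ℕ.≟ null a) acc
N-cnt (suc k) [] acc = refl
N-cnt (suc k) (x ∷ xs) acc = cong₂ _+_ (trans (cong (λ s → N k s xs) (sym (neg-⊹ acc x))) (N-cnt k xs (acc ⊹ x))) (N-cnt (suc k) xs acc)

⊹-swap : ∀ a x y → (a ⊹ x) ⊹ y ≡ (a ⊹ y) ⊹ x
⊹-swap = from-yes (∀? λ a → ∀? λ x → ∀? λ y → (a ⊹ x) ⊹ y ≟ (a ⊹ y) ⊹ x)

N-↭ : ∀ k t {xs ys} → xs ↭ ys → N k t xs ≡ N k t ys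
N-↭ k t {xs} {ys} p = subst (λ s → N k s xs ≡ N k s ys) (neg-neg t)
    (trans (N-cnt k xs (neg t)) (trans (cnt-↭ _⊹_ ⊹-swap null k p (neg t)) (sym (N-cnt k ys (neg t)))))
  where
  neg-neg : ∀ t → neg (neg t) ≡ t
  neg-neg = from-yes (∀? λ t → neg (neg t) ≟ t)

Z : ∀ {d} → W d → List (W d) → ℕ
Z w L = N 5 #0 (map (dot w) L)

Z-cnt : ∀ {d} (w : W d) L → Z w L ≤ cnt _⊞_ (λ s → null (dot w s)) 5 L 𝟎
Z-cnt w L = ≤-trans (≤-reflexive (N-cnt 5 (map (dot w) L) #0))
  (cnt-map _⊞_ _⊹_ (λ s → null (dot w s)) null (dot w) (λ k b a → b ≡ dot w a) (λ _ → ℕ) (All.universal (λ _ → 0) L)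
    (λ {k} {b} {a} {x} _ e → trans (cong (_⊹ dot w x) e) (sym (dot-⊞ w a x)))
    (λ { refl → ≤-refl }) 5 (sym (dot-𝟎ʳ w)))

⟦⟧≤1 : ∀ {A : Set} (a? : Dec A) → ⟦ a? ⟧ ≤ 1
⟦⟧≤1 (yes _) = ≤-refl
⟦⟧≤1 (no _) = z≤n

ΣZ-≤ : ∀ {d} (L : List (W (suc d))) → Good L → Σᵂ (suc d) (λ w → Z w L) ≤ 5 ^ d * (length L C 5)
ΣZ-≤ {d} L good = begin
    Σᵂ (suc d) (λ w → Z w L)
      ≤⟨ Σᵂ-mono (suc d) (λ w → Z-cnt w L) ⟩
    Σᵂ (suc d) (λ w → cnt _⊞_ (λ s → null (dot w s)) 5 L 𝟎)
      ≡⟨ cnt-Σᵂ _⊞_ (suc d) (λ w s → null (dot w s)) 5 L 𝟎 ⟨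
    cnt _⊞_ (λ s → Σᵂ (suc d) λ w → null (dot w s)) 5 L 𝟎
      -- A zero sum is annihilated by all functionals instead of a fifth of them. The extra term
      -- pays for this, and its total is a multiple of `zs L`, which is zero.
      ≤⟨ cnt-mono _⊞_ pointwise 5 L 𝟎 ⟩
    cnt _⊞_ (λ s → 5 ^ d * 1 + 5 ^ suc d * zero? s) 5 L 𝟎
      ≡⟨ cnt-+ _⊞_ (λ _ → 5 ^ d * 1) (λ s → 5 ^ suc d * zero? s) 5 L 𝟎 ⟩
    cnt _⊞_ (λ _ → 5 ^ d * 1) 5 L 𝟎 + cnt _⊞_ (λ s → 5 ^ suc d * zero? s) 5 L 𝟎
      ≡⟨ cong₂ _+_ (trans (cnt-* _⊞_ (5 ^ d) (λ _ → 1) 5 L 𝟎) (cong (5 ^ d *_) (cnt-1 _⊞_ 5 L 𝟎)))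
           (trans (cnt-* _⊞_ (5 ^ suc d) zero? 5 L 𝟎) (trans (cong (5 ^ suc d *_) good) (*-zeroʳ (5 ^ suc d)))) ⟩
    5 ^ d * (length L C 5) + 0
      ≡⟨ +-identityʳ _ ⟩
    5 ^ d * (length L C 5) ∎
  where
  open ≤-Reasoning
  pointwise : ∀ s → Σᵂ (suc d) (λ w → null (dot w s)) ≤ 5 ^ d * 1 + 5 ^ suc d * zero? s
  pointwise s with s ≟ᵂ 𝟎
  ... | yes _ = ≤-trans (≤-trans (Σᵂ-mono (suc d) λ w → ⟦⟧≤1 (dot w s ≟ #0)) (≤-reflexive (Σᵂ-const (suc d) 1))) (m≤n+m _ (5 ^ d * 1))
  ... | no s≢𝟎 = ≤-trans (≤-reflexive (trans (dot-equidistributed d s #0 s≢𝟎) (sym (*-identityʳ (5 ^ d))))) (m≤m+n _ _)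

Z-𝟎 : ∀ {d} (L : List (W d)) → Z 𝟎 L ≡ length L C 5
Z-𝟎 {d} L = go 5 L
  where
  dot-𝟎ˡ : ∀ {d} (v : W d) → dot 𝟎 v ≡ #0
  dot-𝟎ˡ [] = refl
  dot-𝟎ˡ (x ∷ v) = dot-𝟎ˡ v
  go : ∀ k (L : List (W d)) → N k #0 (map (dot 𝟎) L) ≡ length L C k
  go zero L = refl
  go (suc k) [] = refl
  go (suc k) (v ∷ L) rewrite dot-𝟎ˡ v = trans (cong₂ _+_ (go k L) (go (suc k) L)) (nCk+nC[k+1]≡[n+1]C[k+1] (length L) k)

-- The sum runs over all functionals, including the zero functional, for which `Z` is the full
-- binomial coefficient. Its surplus over `lo` is kept as `e`, which avoids subtracting its
-- contribution from both sides.
averaging : ∀ {d} (L : List (W (suc d))) → Good L → ∀ a b lo e →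
  (∀ w → w ≢ 𝟎 → lo ≤ a * Z w L + b) → lo + e ≤ a * (length L C 5) + b →
  5 ^ suc d * lo + e ≤ a * (5 ^ d * (length L C 5)) + 5 ^ suc d * b
averaging {d} L good a b lo e each at𝟎 = begin
    5 ^ suc d * lo + e
      ≡⟨ cong₂ _+_ (Σᵂ-const (suc d) lo) (trans (Σᵂ-* (suc d) e zero?) (trans (cong (e *_) (Σᵂ-zero? (suc d))) (*-identityʳ e))) ⟨
    Σᵂ (suc d) (λ _ → lo) + Σᵂ (suc d) (λ w → e * zero? w)
      ≡⟨ Σᵂ-+ (suc d) (λ _ → lo) (λ w → e * zero? w) ⟨
    Σᵂ (suc d) (λ w → lo + e * zero? w)
      ≤⟨ Σᵂ-mono (suc d) pointwise ⟩
    Σᵂ (suc d) (λ w → a * Z w L + b)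
      ≡⟨ trans (Σᵂ-+ (suc d) (λ w → a * Z w L) (λ _ → b)) (cong₂ _+_ (Σᵂ-* (suc d) a (λ w → Z w L)) (Σᵂ-const (suc d) b)) ⟩
    a * Σᵂ (suc d) (λ w → Z w L) + 5 ^ suc d * b
      ≤⟨ +-monoˡ-≤ _ (*-monoʳ-≤ a (ΣZ-≤ L good)) ⟩
    a * (5 ^ d * (length L C 5)) + 5 ^ suc d * b ∎
  where
  open ≤-Reasoning
  pointwise : ∀ w → lo + e * zero? w ≤ a * Z w L + b
  pointwise w with w ≟ᵂ 𝟎
  ... | yes refl rewrite *-identityʳ e | Z-𝟎 L = at𝟎
  ... | no w≢𝟎 rewrite *-zeroʳ e | +-identityʳ lo = each w w≢𝟎

-- Multiplicities and permutations

module Occ {A : Set} (_≟ᴬ_ : DecidableEquality A) where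

  occ : A → List A → ℕ
  occ a [] = 0
  occ a (x ∷ xs) = ⟦ a ≟ᴬ x ⟧ + occ a xs

  occ-↭ : ∀ a {xs ys} → xs ↭ ys → occ a xs ≡ occ a ys
  occ-↭ a ↭refl = refl
  occ-↭ a (prep x p) = cong (⟦ a ≟ᴬ x ⟧ +_) (occ-↭ a p)
  occ-↭ a (swap x y p) rewrite occ-↭ a p = rearrange ⟦ a ≟ᴬ x ⟧ ⟦ a ≟ᴬ y ⟧ _
    where
    rearrange : ∀ p q r → p + (q + r) ≡ q + (p + r)
    rearrange = solve-∀
  occ-↭ a (↭trans p q) = trans (occ-↭ a p) (occ-↭ a q)

  find : ∀ a xs → 0 < occ a xs → ∃ λ ys → xs ↭ a ∷ ys
  find a (x ∷ xs) lt with a ≟ᴬ x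
  ... | yes refl = xs , ↭refl
  ... | no _ with find a xs lt
  ...   | ys , p = x ∷ ys , ↭-trans (prep x p) (swap x a ↭refl)

  occ⇒↭ : ∀ xs ys → (∀ a → occ a xs ≡ occ a ys) → xs ↭ ys
  occ⇒↭ [] [] e = ↭refl
  occ⇒↭ (x ∷ xs) [] e with e x
  ... | e′ rewrite ⟦⟧-yes (x ≟ᴬ x) refl with e′
  ...   | ()
  occ⇒↭ xs (y ∷ ys) e with find y xs (≤-trans (≤-trans (≤-reflexive (sym (⟦⟧-yes (y ≟ᴬ y) refl))) (m≤m+n _ _)) (≤-reflexive (sym (e y))))
  ... | zs , p = ↭-trans p (prep y (occ⇒↭ zs ys λ a → +-cancelˡ-≡ ⟦ a ≟ᴬ y ⟧ _ _ (trans (sym (occ-↭ a p)) (e a))))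

  occ-++ : ∀ a xs ys → occ a (xs ++ ys) ≡ occ a xs + occ a ys
  occ-++ a [] ys = refl
  occ-++ a (x ∷ xs) ys = trans (cong (⟦ a ≟ᴬ x ⟧ +_) (occ-++ a xs ys)) (sym (+-assoc ⟦ a ≟ᴬ x ⟧ _ _))

open Occ _≟_ using () renaming (occ to occ𝔽; occ-↭ to occ𝔽-↭; occ⇒↭ to occ𝔽⇒↭; occ-++ to occ𝔽-++)
open module Occᵂ {d} = Occ (_≟ᵂ_ {d}) using (occ; occ-↭; find; occ-++)

Σocc : ∀ xs → Σ𝔽 (λ c → occ𝔽 c xs) ≡ length xs
Σocc [] = refl
Σocc (x ∷ xs) = trans (Σ𝔽-+ (λ c → ⟦ c ≟ x ⟧) (λ c → occ𝔽 c xs))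
  (cong₂ _+_ (from-yes (∀? λ x → Σ𝔽 (λ c → ⟦ c ≟ x ⟧) ℕ.≟ 1) x) (Σocc xs))

-- Hyperplanes

-- Forgets a coordinate in which the functional w does not vanish.
forget : ∀ {d} → W (suc d) → W (suc d) → W d
forget {zero} w v = []
forget {suc d} (#0 ∷ w) (x ∷ v) = x ∷ forget w v
forget {suc d} (#1 ∷ w) (x ∷ v) = v
forget {suc d} (#2 ∷ w) (x ∷ v) = v
forget {suc d} (#3 ∷ w) (x ∷ v) = v
forget {suc d} (#4 ∷ w) (x ∷ v) = v

forget-⊞ : ∀ {d} (w u v : W (suc d)) → forget w (u ⊞ v) ≡ forget w u ⊞ forget w v
forget-⊞ {zero} w u v = refl
forget-⊞ {suc d} (#0 ∷ w) (x ∷ u) (y ∷ v) = cong (x ⊹ y ∷_) (forget-⊞ w u v)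
forget-⊞ {suc d} (#1 ∷ w) (x ∷ u) (y ∷ v) = refl
forget-⊞ {suc d} (#2 ∷ w) (x ∷ u) (y ∷ v) = refl
forget-⊞ {suc d} (#3 ∷ w) (x ∷ u) (y ∷ v) = refl
forget-⊞ {suc d} (#4 ∷ w) (x ∷ u) (y ∷ v) = refl

forget-𝟎 : ∀ {d} (w : W (suc d)) → forget w 𝟎 ≡ 𝟎
forget-𝟎 {zero} w = refl
forget-𝟎 {suc d} (#0 ∷ w) = cong (#0 ∷_) (forget-𝟎 w)
forget-𝟎 {suc d} (#1 ∷ w) = refl
forget-𝟎 {suc d} (#2 ∷ w) = refl
forget-𝟎 {suc d} (#3 ∷ w) = refl
forget-𝟎 {suc d} (#4 ∷ w) = refl

-- The forgotten coordinate has a nonzero coefficient in `w`, so the equation recovers it from the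
-- others. Thus `forget w` embeds the kernel of `w` in dimension `d`.
forget-kernel : ∀ {d} (w v : W (suc d)) → w ≢ 𝟎 → forget w v ≡ 𝟎 → dot w v ≡ #0 → v ≡ 𝟎
forget-kernel {d} (a ∷ w) (x ∷ v) w≢𝟎 e e′ = go d a w v w≢𝟎 e e′
  where
  cancel : ∀ a x → a ≢ #0 → a · x ≡ #0 → x ≡ #0
  cancel = from-yes (∀? λ a → ∀? λ x → ¬? (a ≟ #0) →-dec ((a · x ≟ #0) →-dec (x ≟ #0)))
  unit : ∀ {d} a (w : W d) → a ≢ #0 → a · x ⊹ dot w 𝟎 ≡ #0 → x ∷ 𝟎 ≡ 𝟎 {suc d}
  unit a w a≢0 e = cong (_∷ 𝟎) (cancel a x a≢0 (trans (sym (trans (cong (a · x ⊹_) (dot-𝟎ʳ w)) (⊹-identityʳ (a · x)))) e))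
  go : ∀ d a (w v : W d) → a ∷ w ≢ 𝟎 → forget (a ∷ w) (x ∷ v) ≡ 𝟎 → a · x ⊹ dot w v ≡ #0 → x ∷ v ≡ 𝟎
  go zero a [] [] w≢𝟎 e e′ = unit a [] (λ { refl → w≢𝟎 refl }) e′
  go (suc d) #0 w v w≢𝟎 e e′ = cong₂ _∷_ (Vec.∷-injectiveˡ e) (forget-kernel w v (w≢𝟎 ∘ cong (#0 ∷_)) (Vec.∷-injectiveʳ e) e′)
  go (suc d) #1 w v w≢𝟎 refl e′ = unit #1 w (λ ()) e′
  go (suc d) #2 w v w≢𝟎 refl e′ = unit #2 w (λ ()) e′
  go (suc d) #3 w v w≢𝟎 refl e′ = unit #3 w (λ ()) e′
  go (suc d) #4 w v w≢𝟎 refl e′ = unit #4 w (λ ()) e′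

times : ℕ → 𝔽 → 𝔽
times zero c = #0
times (suc k) c = c ⊹ times k c

-- The class `c` is a translate of the kernel of `w`, but no translation is performed: five of its
-- elements have `w`-sum 5c = 0 anyway, so a zero sum after `forget w` is a zero sum before it.
hyperplane : ∀ {d h} → Bounds d (suc h) → ∀ (w : W (suc d)) → w ≢ 𝟎 → ∀ L → Good L → ∀ c → occ𝔽 c (map (dot w) L) ≤ h
hyperplane {d} {h} bound w w≢𝟎 L good c = ≮⇒≥ λ h< →
    Bounds-≤ bound (map (forget w) K) (≤-trans h< (≤-reflexive (sym (trans (length-map (forget w) K) (length-K L)))))
      (≤-Good {L = map (forget w) K} {M = K} small (n≤0⇒n≡0 (≤-trans (cnt-filter _⊞_ on? zero? 5 L 𝟎) (≤-reflexive good))))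
  where
  on? : ∀ v → Dec (c ≡ dot w v)
  on? v = c ≟ dot w v
  K = filter on? L
  length-K : ∀ L → length (filter on? L) ≡ occ𝔽 c (map (dot w) L)
  length-K [] = refl
  length-K (v ∷ L) with does (c ≟ dot w v)
  ... | true = cong suc (length-K L)
  ... | false = length-K L
  small : zs (map (forget w) K) ≤ zs K
  -- In the relation, `k` elements are still to be added, each of `w`-value `c`. It holds at the
  -- start because 5c = 0, and at the end it says that the sum lies in the kernel of `w`.
  small = cnt-map _⊞_ _⊞_ zero? zero? (forget w) (λ k b a → b ≡ forget w a × dot w a ⊹ times k c ≡ #0) (λ v → c ≡ dot w v) (all-filter on? L)
    (λ { {k} {b} {a} {x} refl (e , e′) → trans (cong (_⊞ forget w x) e) (sym (forget-⊞ w a x)) ,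
        trans (cong (_⊹ times k (dot w x)) (dot-⊞ w a x)) (trans (⊹-assoc (dot w a) (dot w x) (times k (dot w x))) e′) })
    (λ { {b} {a} (refl , e′) → ⟦⟧-mono (forget w a ≟ᵂ 𝟎) (a ≟ᵂ 𝟎) λ z → forget-kernel w a w≢𝟎 z (trans (sym (⊹-identityʳ (dot w a))) e′) })
    5 (sym (forget-𝟎 w) , trans (cong (_⊹ times 5 c) (dot-𝟎ʳ w)) (from-yes (∀? λ c → times 5 c ≟ #0) c))

-- Nearly uniform lists over 𝔽

-- Number of multisets of size k from b elements
multi : ℕ → ℕ → ℕ
multi zero zero = 1
multi zero (suc k) = 0
multi (suc b) k = (b + k) C k

multi-suc : ∀ b k → multi (suc b) k + multi b (suc k) ≡ multi (suc b) (suc k)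
multi-suc zero k = trans (+-identityʳ _) (trans (nCn≡1 k) (sym (nCn≡1 (suc k))))
multi-suc (suc b) k rewrite +-suc b k = nCk+nC[k+1]≡[n+1]C[k+1] (suc (b + k)) k

-- For a list xs that is obtained from a uniform one by removing b elements: each removal
-- changes the numbers N k t by numbers N (k - 1) t′, hence the binomial bound.
record Near (b : ℕ) (xs : List 𝔽) : Set where
  field
    upto4 : ∀ k → k ≤ 4 → ∀ t s → N k t xs ≤ N k s xs + multi b k
    at5 : ∀ s → N 5 s xs ≤ N 5 #0 xs + multi b 5
open Near

compare : ∀ {a b c d x y} → a + b ≤ (c + d) + x → c ≤ a + y → b ≤ d + (y + x)
compare {a} {b} {c} {d} {x} {y} p q = +-cancelˡ-≤ a b (d + (y + x)) (begin
  a + b ≤⟨ p ⟩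
  (c + d) + x ≤⟨ +-monoˡ-≤ x (+-monoˡ-≤ d q) ⟩
  ((a + y) + d) + x ≡⟨ rearrange a y d x ⟩
  a + (d + (y + x)) ∎)
  where
  open ≤-Reasoning
  rearrange : ∀ a y d x → ((a + y) + d) + x ≡ a + (d + (y + x))
  rearrange = solve-∀

-- Split the counts for `x ∷ xs` by whether `x` is used: the error at length k + 1 for `xs` is at
-- most the old error at k + 1 plus the new error at k, and Pascal's rule adds them up. Length five
-- only refers back to length four, so `at5` can stay one-sided, with sum zero on the larger side.
remove : ∀ {b x xs} → Near b (x ∷ xs) → Near (suc b) xs
remove {b} {x} {xs} near = record { upto4 = sm ; at5 = λ s → ≤-trans (compare {N 4 (s ⊹ neg x) xs} {c = N 4 (#0 ⊹ neg x) xs} (at5 near s) (sm 4 ≤-refl (#0 ⊹ neg x) (s ⊹ neg x))) (≤-reflexive (cong (N 5 #0 xs +_) (multi-suc b 4))) }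
  where
  sm : ∀ k → k ≤ 4 → ∀ t s → N k t xs ≤ N k s xs + multi (suc b) k
  sm zero _ t s = ≤-trans (⟦⟧≤1 (t ≟ #0)) (m≤n+m 1 _)
  sm (suc k) k≤ t s = ≤-trans (compare {N k (t ⊹ neg x) xs} {c = N k (s ⊹ neg x) xs} (upto4 near (suc k) k≤ t s) (sm k (≤-trans (n≤1+n k) k≤) (s ⊹ neg x) (t ⊹ neg x)))
    (≤-reflexive (cong (N (suc k) s xs +_) (multi-suc b k)))

block : List 𝔽
block = #0 ∷ #1 ∷ #2 ∷ #3 ∷ #4 ∷ []

uniform : ℕ → List 𝔽
uniform zero = []
uniform (suc h) = block ++ uniform h

-- Symbolic evaluation of N k t (ys ++ xs) when N j s xs does not depend on s for 1 ≤ j ≤ 4: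
-- the coefficients of 1, N 1 #0 xs, …, N 4 #0 xs, N 5 t xs.
data Form : Set where
  form : (a b c d e f : ℕ) → Form

_⊕ᶠ_ : Form → Form → Form
form a b c d e f ⊕ᶠ form a′ b′ c′ d′ e′ f′ = form (a + a′) (b + b′) (c + c′) (d + d′) (e + e′) (f + f′)

symbolic : ℕ → 𝔽 → List 𝔽 → Form
symbolic zero t ys = form ⟦ t ≟ #0 ⟧ 0 0 0 0 0
symbolic 1 t [] = form 0 1 0 0 0 0
symbolic 2 t [] = form 0 0 1 0 0 0
symbolic 3 t [] = form 0 0 0 1 0 0
symbolic 4 t [] = form 0 0 0 0 1 0
symbolic (suc (suc (suc (suc (suc k))))) t [] = form 0 0 0 0 0 1
symbolic (suc k) t (y ∷ ys) = symbolic k (t ⊹ neg y) ys ⊕ᶠ symbolic (suc k) t ys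

module _ (xs : List 𝔽) (flat : ∀ k → 1 ≤ k → k ≤ 4 → ∀ t → N k t xs ≡ N k #0 xs) where

  value : ℕ → Form → ℕ
  value m (form a b c d e f) = a + b * N 1 #0 xs + c * N 2 #0 xs + d * N 3 #0 xs + e * N 4 #0 xs + f * m

  value-⊕ᶠ : ∀ m p q → value m (p ⊕ᶠ q) ≡ value m p + value m q
  value-⊕ᶠ m (form a b c d e f) (form a′ b′ c′ d′ e′ f′) = expand a b c d e f a′ b′ c′ d′ e′ f′ (N 1 #0 xs) (N 2 #0 xs) (N 3 #0 xs) (N 4 #0 xs) m
    where
    expand : ∀ a b c d e f a′ b′ c′ d′ e′ f′ n₁ n₂ n₃ n₄ n₅ →
      (a + a′) + (b + b′) * n₁ + (c + c′) * n₂ + (d + d′) * n₃ + (e + e′) * n₄ + (f + f′) * n₅ ≡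
      (a + b * n₁ + c * n₂ + d * n₃ + e * n₄ + f * n₅) + (a′ + b′ * n₁ + c′ * n₂ + d′ * n₃ + e′ * n₄ + f′ * n₅)
    expand = solve-∀

  symbolic-small : ∀ m k → k ≤ 4 → ∀ t ys → N k t (ys ++ xs) ≡ value m (symbolic k t ys)
  symbolic-small m zero _ t ys = expand ⟦ t ≟ #0 ⟧
    where
    expand : ∀ a → a ≡ a + 0 + 0 + 0 + 0 + 0
    expand = solve-∀
  symbolic-small m 1 k≤ t [] = trans (flat 1 ≤-refl k≤ t) (expand (N 1 #0 xs))
    where
    expand : ∀ a → a ≡ 0 + (a + 0) + 0 + 0 + 0 + 0
    expand = solve-∀
  symbolic-small m 2 k≤ t [] = trans (flat 2 (s≤s z≤n) k≤ t) (expand (N 2 #0 xs))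
    where
    expand : ∀ a → a ≡ 0 + 0 + (a + 0) + 0 + 0 + 0
    expand = solve-∀
  symbolic-small m 3 k≤ t [] = trans (flat 3 (s≤s z≤n) k≤ t) (expand (N 3 #0 xs))
    where
    expand : ∀ a → a ≡ 0 + 0 + 0 + (a + 0) + 0 + 0
    expand = solve-∀
  symbolic-small m 4 k≤ t [] = trans (flat 4 (s≤s z≤n) k≤ t) (expand (N 4 #0 xs))
    where
    expand : ∀ a → a ≡ 0 + 0 + 0 + 0 + (a + 0) + 0
    expand = solve-∀
  symbolic-small m (suc (suc (suc (suc (suc k))))) (s≤s (s≤s (s≤s (s≤s ())))) t []
  symbolic-small m 1 k≤ t (y ∷ ys) = trans (cong₂ _+_ (symbolic-small m 0 z≤n (t ⊹ neg y) ys) (symbolic-small m 1 k≤ t ys)) (sym (value-⊕ᶠ m (symbolic 0 (t ⊹ neg y) ys) (symbolic 1 t ys)))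
  symbolic-small m 2 k≤ t (y ∷ ys) = trans (cong₂ _+_ (symbolic-small m 1 (s≤s z≤n) (t ⊹ neg y) ys) (symbolic-small m 2 k≤ t ys)) (sym (value-⊕ᶠ m (symbolic 1 (t ⊹ neg y) ys) (symbolic 2 t ys)))
  symbolic-small m 3 k≤ t (y ∷ ys) = trans (cong₂ _+_ (symbolic-small m 2 (s≤s (s≤s z≤n)) (t ⊹ neg y) ys) (symbolic-small m 3 k≤ t ys)) (sym (value-⊕ᶠ m (symbolic 2 (t ⊹ neg y) ys) (symbolic 3 t ys)))
  symbolic-small m 4 k≤ t (y ∷ ys) = trans (cong₂ _+_ (symbolic-small m 3 (s≤s (s≤s (s≤s z≤n))) (t ⊹ neg y) ys) (symbolic-small m 4 k≤ t ys)) (sym (value-⊕ᶠ m (symbolic 3 (t ⊹ neg y) ys) (symbolic 4 t ys)))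
  symbolic-small m (suc (suc (suc (suc (suc k))))) (s≤s (s≤s (s≤s (s≤s ())))) t (y ∷ ys)

  symbolic-five : ∀ t ys → N 5 t (ys ++ xs) ≡ value (N 5 t xs) (symbolic 5 t ys)
  symbolic-five t [] = expand (N 5 t xs)
    where
    expand : ∀ a → a ≡ 0 + 0 + 0 + 0 + 0 + (a + 0)
    expand = solve-∀
  symbolic-five t (y ∷ ys) = trans (cong₂ _+_ (symbolic-small (N 5 t xs) 4 ≤-refl (t ⊹ neg y) ys) (symbolic-five t ys)) (sym (value-⊕ᶠ (N 5 t xs) (symbolic 4 (t ⊹ neg y) ys) (symbolic 5 t ys)))

-- One block contributes 1 + y^5 to the generating polynomial of every nontrivial character, so no
-- length from one to four can distinguish targets. Here this is a symbolic evaluation of one block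
-- on top of a flat list.
uniform-flat : ∀ h k → 1 ≤ k → k ≤ 4 → ∀ t → N k t (uniform h) ≡ N k #0 (uniform h)
uniform-flat zero (suc k) _ _ t = refl
uniform-flat (suc h) k 1≤k k≤4 t = trans (symbolic-small U flat 0 k k≤4 t block)
    (trans (cong (value U flat 0) (same k 1≤k k≤4 t)) (sym (symbolic-small U flat 0 k k≤4 #0 block)))
  where
  U = uniform h
  flat = uniform-flat h
  same : ∀ k → 1 ≤ k → k ≤ 4 → ∀ t → symbolic k t block ≡ symbolic k #0 block
  same 1 _ _ = λ { #0 → refl ; #1 → refl ; #2 → refl ; #3 → refl ; #4 → refl }
  same 2 _ _ = λ { #0 → refl ; #1 → refl ; #2 → refl ; #3 → refl ; #4 → refl }
  same 3 _ _ = λ { #0 → refl ; #1 → refl ; #2 → refl ; #3 → refl ; #4 → refl }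
  same 4 _ _ = λ { #0 → refl ; #1 → refl ; #2 → refl ; #3 → refl ; #4 → refl }
  same (suc (suc (suc (suc (suc _))))) _ (s≤s (s≤s (s≤s (s≤s ()))))

uniform-five : ∀ h s → N 5 s (uniform h) ≤ N 5 #0 (uniform h)
uniform-five zero s = z≤n
uniform-five (suc h) s = begin
    N 5 s (uniform (suc h)) ≡⟨ symbolic-five U flat s block ⟩
    value U flat (N 5 s U) (symbolic 5 s block) ≤⟨ bound s (uniform-five h s) ⟩
    value U flat (N 5 #0 U) (symbolic 5 #0 block) ≡⟨ symbolic-five U flat #0 block ⟨
    N 5 #0 (uniform (suc h)) ∎
  where
  open ≤-Reasoning
  U = uniform h
  flat = uniform-flat h
  -- 5, 10, 10, 5, 1 are the numbers of ways to take four, three, two, one or no elements from the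
  -- block. The constant term counts the whole block, which has sum zero; so only the target zero
  -- gains one.
  grow : ∀ {m m′ a} → a ≤ 1 → m ≤ m′ → value U flat m (form a 5 10 10 5 1) ≤ value U flat m′ (form 1 5 10 10 5 1)
  grow a≤1 m≤m′ = +-mono-≤ (+-monoˡ-≤ _ (+-monoˡ-≤ _ (+-monoˡ-≤ _ (+-monoˡ-≤ _ a≤1)))) (*-monoʳ-≤ 1 m≤m′)
  bound : ∀ s → N 5 s U ≤ N 5 #0 U → value U flat (N 5 s U) (symbolic 5 s block) ≤ value U flat (N 5 #0 U) (symbolic 5 #0 block)
  bound #0 = grow ≤-refl
  bound #1 = grow z≤n
  bound #2 = grow z≤n
  bound #3 = grow z≤n
  bound #4 = grow z≤n

uniform-near : ∀ h → Near 0 (uniform h)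
uniform-near h = record { upto4 = sm ; at5 = λ s → ≤-trans (uniform-five h s) (m≤m+n _ _) }
  where
  sm : ∀ k → k ≤ 4 → ∀ t s → N k t (uniform h) ≤ N k s (uniform h) + multi 0 k
  sm zero _ t s = ≤-trans (⟦⟧≤1 (t ≟ #0)) (m≤n+m 1 _)
  sm (suc k) k≤ t s = ≤-trans (≤-reflexive (trans (uniform-flat h (suc k) (s≤s z≤n) k≤ t) (sym (uniform-flat h (suc k) (s≤s z≤n) k≤ s)))) (m≤m+n _ _)

near-↭ : ∀ {b xs ys} → xs ↭ ys → Near b xs → Near b ys
near-↭ p near = record
  { upto4 = λ k k≤ t s → subst₂ (λ x y → x ≤ y + _) (N-↭ k t p) (N-↭ k s p) (upto4 near k k≤ t s)
  ; at5 = λ s → subst₂ (λ x y → x ≤ y + _) (N-↭ 5 s p) (N-↭ 5 #0 p) (at5 near s) }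

occ-uniform : ∀ h c → occ𝔽 c (uniform h) ≡ h
occ-uniform zero c = refl
occ-uniform (suc h) c = trans (occ𝔽-++ c block (uniform h)) (cong₂ _+_ (from-yes (∀? λ c → occ𝔽 c block ℕ.≟ 1) c) (occ-uniform h c))

Σ𝔽-full : ∀ h (f : 𝔽 → ℕ) → (∀ c → f c ≤ h) → Σ𝔽 f ≡ 5 * h → ∀ c → f c ≡ h
Σ𝔽-full h f f≤ e c = ≤-antisym (f≤ c) (≮⇒≥ λ lt → <-irrefl e (<-≤-trans (strict c lt) (≤-reflexive (Σ𝔽-const h))))
  where
  strict : ∀ c → f c < h → Σ𝔽 f < Σ𝔽 (λ _ → h)
  strict #0 lt = +-mono-<-≤ lt (+-mono-≤ (f≤ #1) (+-mono-≤ (f≤ #2) (+-mono-≤ (f≤ #3) (f≤ #4))))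
  strict #1 lt = +-mono-≤-< (f≤ #0) (+-mono-<-≤ lt (+-mono-≤ (f≤ #2) (+-mono-≤ (f≤ #3) (f≤ #4))))
  strict #2 lt = +-mono-≤-< (f≤ #0) (+-mono-≤-< (f≤ #1) (+-mono-<-≤ lt (+-mono-≤ (f≤ #3) (f≤ #4))))
  strict #3 lt = +-mono-≤-< (f≤ #0) (+-mono-≤-< (f≤ #1) (+-mono-≤-< (f≤ #2) (+-mono-<-≤ lt (f≤ #4))))
  strict #4 lt = +-mono-≤-< (f≤ #0) (+-mono-≤-< (f≤ #1) (+-mono-≤-< (f≤ #2) (+-mono-≤-< (f≤ #3) lt)))

Σ𝔽-slack : ∀ h (f : 𝔽 → ℕ) → Σ𝔽 f < 5 * h → ∃ λ c → f c < h
Σ𝔽-slack h f lt with f #0 <? h | f #1 <? h | f #2 <? h | f #3 <? h | f #4 <? h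
... | yes p | _ | _ | _ | _ = #0 , p
... | no _ | yes p | _ | _ | _ = #1 , p
... | no _ | no _ | yes p | _ | _ = #2 , p
... | no _ | no _ | no _ | yes p | _ = #3 , p
... | no _ | no _ | no _ | no _ | yes p = #4 , p
... | no a | no b | no c | no d | no e = ⊥-elim (<⇒≱ lt (≤-trans (≤-reflexive (sym (Σ𝔽-const h)))
  (+-mono-≤ (≮⇒≥ a) (+-mono-≤ (≮⇒≥ b) (+-mono-≤ (≮⇒≥ c) (+-mono-≤ (≮⇒≥ d) (≮⇒≥ e)))))))

-- As long as elements are missing, some class is not full. Adding an element there keeps the bound
-- `h`, and after `b` additions the list is a permutation of the uniform one; `remove` then takes
-- the additions back.
near : ∀ h b xs → (∀ c → occ𝔽 c xs ≤ h) → b + length xs ≡ 5 * h → Near b xs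
near h zero xs occ≤ e = near-↭ (↭-sym (occ𝔽⇒↭ xs (uniform h) λ c → trans (Σ𝔽-full h _ occ≤ (trans (Σocc xs) e) c) (sym (occ-uniform h c)))) (uniform-near h)
near h (suc b) xs occ≤ e with Σ𝔽-slack h (λ c → occ𝔽 c xs) (≤-trans (s≤s (≤-trans (≤-reflexive (Σocc xs)) (m≤n+m _ b))) (≤-reflexive e))
... | x , lt = remove (near h b (x ∷ xs) occ≤′ (trans (+-suc b (length xs)) e))
  where
  occ≤′ : ∀ c → occ𝔽 c (x ∷ xs) ≤ h
  occ≤′ c with c ≟ x
  ... | yes refl = lt
  ... | no _ = occ≤ c

ΣN : ∀ k xs → Σ𝔽 (λ t → N k t xs) ≡ length xs C k
ΣN zero xs = refl
ΣN (suc k) [] = refl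
ΣN (suc k) (x ∷ xs) = trans (Σ𝔽-+ (λ t → N k (t ⊹ neg x) xs) (λ t → N (suc k) t xs))
    (trans (cong₂ _+_ (trans (shifted (λ t → N k t xs) x) (ΣN k xs)) (ΣN (suc k) xs)) (nCk+nC[k+1]≡[n+1]C[k+1] (length xs) k))
  where
  shifted : ∀ f x → Σ𝔽 (λ t → f (t ⊹ neg x)) ≡ Σ𝔽 f
  shifted f #0 = refl
  shifted f #1 = rearrange (f #0) (f #1) (f #2) (f #3) (f #4)
    where
    rearrange : ∀ a b c d e → e + (a + (b + (c + d))) ≡ a + (b + (c + (d + e)))
    rearrange = solve-∀
  shifted f #2 = rearrange (f #0) (f #1) (f #2) (f #3) (f #4)
    where
    rearrange : ∀ a b c d e → d + (e + (a + (b + c))) ≡ a + (b + (c + (d + e)))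
    rearrange = solve-∀
  shifted f #3 = rearrange (f #0) (f #1) (f #2) (f #3) (f #4)
    where
    rearrange : ∀ a b c d e → c + (d + (e + (a + b))) ≡ a + (b + (c + (d + e)))
    rearrange = solve-∀
  shifted f #4 = rearrange (f #0) (f #1) (f #2) (f #3) (f #4)
    where
    rearrange : ∀ a b c d e → b + (c + (d + (e + a))) ≡ a + (b + (c + (d + e)))
    rearrange = solve-∀

-- For a nonzero functional every sum is attained at most m times more often than zero, so C(n, 5) ≤
-- 5 Z + 4 m. On averaging, the main terms cancel; what remains is the surplus 4 C(n, 5) of the zero
-- functional against the total error 4 m 5^(d+1).
ascend : ∀ {d h n} → Bounds d (suc h) → n ≤ 5 * h → 5 ^ suc d * multi (5 * h ∸ n) 5 < n C 5 → Bounds (suc d) n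
ascend {d} {h} {n} bound n≤ lt L refl good = <⇒≱ lt (*-cancelˡ-≤ 4 (+-cancelˡ-≤ (5 ^ suc d * c) _ _ (begin
    5 ^ suc d * c + 4 * c
      ≤⟨ averaging L good 5 (4 * m) c (4 * c) each at𝟎 ⟩
    5 * (5 ^ d * c) + 5 ^ suc d * (4 * m)
      ≡⟨ rearrange (5 ^ d) c m ⟩
    5 ^ suc d * c + 4 * (5 ^ suc d * m) ∎)))
  where
  open ≤-Reasoning
  c = length L C 5
  b = 5 * h ∸ length L
  m = multi b 5
  rearrange : ∀ p c m → 5 * (p * c) + 5 * p * (4 * m) ≡ 5 * p * c + 4 * (5 * p * m)
  rearrange = solve-∀
  at𝟎 : c + 4 * c ≤ 5 * c + 4 * m
  at𝟎 = m≤m+n (5 * c) (4 * m)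
  each : ∀ w → w ≢ 𝟎 → c ≤ 5 * Z w L + 4 * m
  each w w≢𝟎 = begin
      c ≡⟨ cong (_C 5) (length-map (dot w) L) ⟨
      length xs C 5 ≡⟨ ΣN 5 xs ⟨
      Σ𝔽 (λ t → N 5 t xs) ≤⟨ +-monoʳ-≤ (Z w L) (+-mono-≤ (n5 #1) (+-mono-≤ (n5 #2) (+-mono-≤ (n5 #3) (n5 #4)))) ⟩
      Z w L + ((Z w L + m) + ((Z w L + m) + ((Z w L + m) + (Z w L + m)))) ≡⟨ collect (Z w L) m ⟩
      5 * Z w L + 4 * m ∎
    where
    xs = map (dot w) L
    n5 = at5 (near h b xs (hyperplane bound w w≢𝟎 L good) (trans (cong (b +_) (length-map (dot w) L)) (m∸n+n≡m n≤)))
    collect : ∀ z m → z + ((z + m) + ((z + m) + ((z + m) + (z + m)))) ≡ 5 * z + 4 * m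
    collect = solve-∀

-- Tables indexed by 𝔽

data Five (A : Set) : Set where
  five : A → A → A → A → A → Five A

look : ∀ {A} → Five A → 𝔽 → A
look (five a b c d e) #0 = a
look (five a b c d e) #1 = b
look (five a b c d e) #2 = c
look (five a b c d e) #3 = d
look (five a b c d e) #4 = e

tab : ∀ {A : Set} → (𝔽 → A) → Five A
tab f = five (f #0) (f #1) (f #2) (f #3) (f #4)

look-tab : ∀ {A : Set} (f : 𝔽 → A) i → look (tab f) i ≡ f i
look-tab f #0 = refl
look-tab f #1 = refl
look-tab f #2 = refl
look-tab f #3 = refl
look-tab f #4 = refl

rot : ∀ {A} → 𝔽 → Five A → Five A
rot #0 t = t
rot #1 (five a b c d e) = five e a b c d
rot #2 (five a b c d e) = five d e a b c
rot #3 (five a b c d e) = five c d e a b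
rot #4 (five a b c d e) = five b c d e a

look-rot : ∀ {A : Set} k (t : Five A) i → look (rot k t) i ≡ look t (i ⊹ neg k)
look-rot #0 t i = cong (look t) (sym (⊹-identityʳ i))
look-rot #1 (five a b c d e) = λ { #0 → refl ; #1 → refl ; #2 → refl ; #3 → refl ; #4 → refl }
look-rot #2 (five a b c d e) = λ { #0 → refl ; #1 → refl ; #2 → refl ; #3 → refl ; #4 → refl }
look-rot #3 (five a b c d e) = λ { #0 → refl ; #1 → refl ; #2 → refl ; #3 → refl ; #4 → refl }
look-rot #4 (five a b c d e) = λ { #0 → refl ; #1 → refl ; #2 → refl ; #3 → refl ; #4 → refl }

zip5 : ∀ {A B C : Set} → (A → B → C) → Five A → Five B → Five C
zip5 f (five a b c d e) (five a′ b′ c′ d′ e′) = five (f a a′) (f b b′) (f c c′) (f d d′) (f e e′)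

look-zip5 : ∀ {A B C : Set} (f : A → B → C) s t i → look (zip5 f s t) i ≡ f (look s i) (look t i)
look-zip5 f (five a b c d e) (five a′ b′ c′ d′ e′) = λ { #0 → refl ; #1 → refl ; #2 → refl ; #3 → refl ; #4 → refl }

set : ∀ {A : Set} → 𝔽 → A → Five A → Five A
set #0 x (five a b c d e) = five x b c d e
set #1 x (five a b c d e) = five a x c d e
set #2 x (five a b c d e) = five a b x d e
set #3 x (five a b c d e) = five a b c x e
set #4 x (five a b c d e) = five a b c d x

look-set-≡ : ∀ {A : Set} i (x : A) t → look (set i x t) i ≡ x
look-set-≡ #0 x (five a b c d e) = refl
look-set-≡ #1 x (five a b c d e) = refl
look-set-≡ #2 x (five a b c d e) = refl
look-set-≡ #3 x (five a b c d e) = refl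
look-set-≡ #4 x (five a b c d e) = refl

look-set-≢ : ∀ {A : Set} i j (x : A) t → i ≢ j → look (set i x t) j ≡ look t j
look-set-≢ #0 = λ { #0 x (five a b c d e) i≢j → ⊥-elim (i≢j refl) ; #1 x (five a b c d e) _ → refl ; #2 x (five a b c d e) _ → refl ; #3 x (five a b c d e) _ → refl ; #4 x (five a b c d e) _ → refl }
look-set-≢ #1 = λ { #1 x (five a b c d e) i≢j → ⊥-elim (i≢j refl) ; #0 x (five a b c d e) _ → refl ; #2 x (five a b c d e) _ → refl ; #3 x (five a b c d e) _ → refl ; #4 x (five a b c d e) _ → refl }
look-set-≢ #2 = λ { #2 x (five a b c d e) i≢j → ⊥-elim (i≢j refl) ; #1 x (five a b c d e) _ → refl ; #0 x (five a b c d e) _ → refl ; #3 x (five a b c d e) _ → refl ; #4 x (five a b c d e) _ → refl }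
look-set-≢ #3 = λ { #3 x (five a b c d e) i≢j → ⊥-elim (i≢j refl) ; #1 x (five a b c d e) _ → refl ; #2 x (five a b c d e) _ → refl ; #0 x (five a b c d e) _ → refl ; #4 x (five a b c d e) _ → refl }
look-set-≢ #4 = λ { #4 x (five a b c d e) i≢j → ⊥-elim (i≢j refl) ; #1 x (five a b c d e) _ → refl ; #2 x (five a b c d e) _ → refl ; #3 x (five a b c d e) _ → refl ; #0 x (five a b c d e) _ → refl }

-- Sets of vectors and sums of sublists

Cube : Set
Cube = Five (Five (Five Bool))

at : Cube → 𝔽 → 𝔽 → 𝔽 → Bool
at t z x y = look (look (look t z) x) y

-- zip5 f s (rot k t), fused for speed
zipRot : ∀ {A B C : Set} → (A → B → C) → 𝔽 → Five A → Five B → Five C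
zipRot f #0 (five a b c d e) (five a′ b′ c′ d′ e′) = five (f a a′) (f b b′) (f c c′) (f d d′) (f e e′)
zipRot f #1 (five a b c d e) (five a′ b′ c′ d′ e′) = five (f a e′) (f b a′) (f c b′) (f d c′) (f e d′)
zipRot f #2 (five a b c d e) (five a′ b′ c′ d′ e′) = five (f a d′) (f b e′) (f c a′) (f d b′) (f e c′)
zipRot f #3 (five a b c d e) (five a′ b′ c′ d′ e′) = five (f a c′) (f b d′) (f c e′) (f d a′) (f e b′)
zipRot f #4 (five a b c d e) (five a′ b′ c′ d′ e′) = five (f a b′) (f b c′) (f c d′) (f d e′) (f e a′)

look-zipRot : ∀ {A B C : Set} (f : A → B → C) k s t i → look (zipRot f k s t) i ≡ f (look s i) (look t (i ⊹ neg k))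
look-zipRot f #0 (five a b c d e) (five a′ b′ c′ d′ e′) = λ { #0 → refl ; #1 → refl ; #2 → refl ; #3 → refl ; #4 → refl }
look-zipRot f #1 (five a b c d e) (five a′ b′ c′ d′ e′) = λ { #0 → refl ; #1 → refl ; #2 → refl ; #3 → refl ; #4 → refl }
look-zipRot f #2 (five a b c d e) (five a′ b′ c′ d′ e′) = λ { #0 → refl ; #1 → refl ; #2 → refl ; #3 → refl ; #4 → refl }
look-zipRot f #3 (five a b c d e) (five a′ b′ c′ d′ e′) = λ { #0 → refl ; #1 → refl ; #2 → refl ; #3 → refl ; #4 → refl }
look-zipRot f #4 (five a b c d e) (five a′ b′ c′ d′ e′) = λ { #0 → refl ; #1 → refl ; #2 → refl ; #3 → refl ; #4 → refl }

unionRow : 𝔽 → Five Bool → Five Bool → Five Bool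
unionRow = zipRot _∨_

unionPlane : 𝔽 → 𝔽 → Five (Five Bool) → Five (Five Bool) → Five (Five Bool)
unionPlane x y = zipRot (unionRow y) x

unionShift : 𝔽 → 𝔽 → 𝔽 → Cube → Cube → Cube
unionShift z x y = zipRot (unionPlane x y) z

at-unionShift : ∀ z x y a b z′ x′ y′ → at (unionShift z x y a b) z′ x′ y′ ≡ at a z′ x′ y′ ∨ at b (z′ ⊹ neg z) (x′ ⊹ neg x) (y′ ⊹ neg y)
at-unionShift z x y a b z′ x′ y′
  rewrite look-zipRot (unionPlane x y) z a b z′
        | look-zipRot (unionRow y) x (look a z′) (look b (z′ ⊹ neg z)) x′
        | look-zipRot _∨_ y (look (look a z′) x′) (look (look b (z′ ⊹ neg z)) (x′ ⊹ neg x)) y′ = refl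

∅ origin : Cube
∅ = tab λ _ → tab λ _ → tab λ _ → false
origin = tab λ z → tab λ x → tab λ y → does ((z ∷ x ∷ y ∷ []) ≟ᵂ 𝟎)

-- The sets of sums of one, two, three and four chosen elements. Length five is absent: such sums
-- are avoided by restricting the elements that may still be chosen.
data Sums : Set where
  sums : (a b c d : Cube) → Sums

add : 𝔽 → 𝔽 → 𝔽 → Sums → Sums
add z x y (sums a b c d) = sums (unionShift z x y a origin) (unionShift z x y b a) (unionShift z x y c b) (unionShift z x y d c)

total : ∀ {d} → List (W d) → W d
total = foldr _⊞_ 𝟎

Rep : ℕ → List (W 3) → W 3 → Set
Rep k L w = ∃ λ T → ∃ λ R → L ↭ T ++ R × length T ≡ k × total T ≡ w

Rep-skip : ∀ {k L w} v → Rep k L w → Rep k (v ∷ L) w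
Rep-skip v (T , R , p , e , e′) = T , v ∷ R , ↭-trans (prep v p) (↭-sym (shift v T R)) , e , e′

Rep-take : ∀ {k L w} v → Rep k L w → Rep (suc k) (v ∷ L) (v ⊞ w)
Rep-take v (T , R , p , e , e′) = v ∷ T , R , prep v p , cong suc e , cong (v ⊞_) e′

-- Only one direction is demanded: a marked vector must really be a sum. A missing mark could only
-- weaken the pruning.
SoundCube : ℕ → Cube → List (W 3) → Set
SoundCube k t L = ∀ z x y → at t z x y ≡ true → Rep k L (z ∷ x ∷ y ∷ [])

data Sound : Sums → List (W 3) → Set where
  sound : ∀ {a b c d L} → SoundCube 1 a L → SoundCube 2 b L → SoundCube 3 c L → SoundCube 4 d L → Sound (sums a b c d) L

∅-sound : ∀ k L → SoundCube k ∅ L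
∅-sound k L z x y e rewrite look-tab (λ _ → tab λ _ → tab λ _ → false) z | look-tab (λ _ → tab λ _ → false) x | look-tab (λ _ → false) y with e
... | ()

origin-sound : ∀ L → SoundCube 0 origin L
origin-sound L z x y e
  rewrite look-tab (λ z → tab λ x → tab λ y → does ((z ∷ x ∷ y ∷ []) ≟ᵂ 𝟎)) z | look-tab (λ x → tab λ y → does ((z ∷ x ∷ y ∷ []) ≟ᵂ 𝟎)) x | look-tab (λ y → does ((z ∷ x ∷ y ∷ []) ≟ᵂ 𝟎)) y = [] , L , ↭refl , refl , sym (holds ((z ∷ x ∷ y ∷ []) ≟ᵂ 𝟎) e)
  where
  holds : ∀ {A : Set} (a? : Dec A) → does a? ≡ true → A
  holds (yes a) _ = a

unionShift-sound : ∀ {k a b L} z x y → SoundCube (suc k) a L → SoundCube k b L →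
  SoundCube (suc k) (unionShift z x y a b) ((z ∷ x ∷ y ∷ []) ∷ L)
unionShift-sound {k} {a} {b} {L} z x y sa sb z′ x′ y′ e with at a z′ x′ y′ in ea | trans (sym (at-unionShift z x y a b z′ x′ y′)) e
... | true | _ = Rep-skip (z ∷ x ∷ y ∷ []) (sa z′ x′ y′ ea)
... | false | e′ = subst (Rep (suc k) ((z ∷ x ∷ y ∷ []) ∷ L)) (cong₂ _∷_ (back z z′) (cong₂ _∷_ (back x x′) (cong₂ _∷_ (back y y′) refl)))
    (Rep-take (z ∷ x ∷ y ∷ []) (sb _ _ _ e′))
  where
  back : ∀ a b → a ⊹ (b ⊹ neg a) ≡ b
  back = from-yes (∀? λ a → ∀? λ b → a ⊹ (b ⊹ neg a) ≟ b)

add-sound : ∀ {s L} z x y → Sound s L → Sound (add z x y s) ((z ∷ x ∷ y ∷ []) ∷ L)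
add-sound {sums a b c d} {L} z x y (sound s₁ s₂ s₃ s₄) = sound
  (unionShift-sound {0} {a} {origin} {L} z x y s₁ (origin-sound L)) (unionShift-sound {1} {b} {a} {L} z x y s₂ s₁)
  (unionShift-sound {2} {c} {b} {L} z x y s₃ s₂) (unionShift-sound {3} {d} {c} {L} z x y s₄ s₃)

cnt-prefix : ∀ {d} (P : W d → ℕ) T R acc → P (acc ⊞ total T) ≤ cnt _⊞_ P (length T) (T ++ R) acc
cnt-prefix P [] R acc = ≤-reflexive (cong P (⊞-identityʳ acc))
cnt-prefix P (v ∷ T) R acc = ≤-trans (≤-reflexive (cong P (sym (⊞-assoc acc v (total T))))) (≤-trans (cnt-prefix P T R (acc ⊞ v)) (m≤m+n _ _))

Good⇒≢𝟎 : ∀ {d} {L : List (W d)} → Good L → ∀ T R → L ↭ T ++ R → length T ≡ 5 → total T ≢ 𝟎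
Good⇒≢𝟎 good T R p len e = contra (≤-trans (cnt-prefix zero? T R 𝟎) (≤-reflexive (trans (cong (λ k → cnt _⊞_ zero? k (T ++ R) 𝟎) len) (zs-↭ p good))))
  where
  contra : ¬ (zero? (𝟎 ⊞ total T) ≤ 0)
  contra le rewrite ⟦⟧-yes ((𝟎 ⊞ total T) ≟ᵂ 𝟎) (trans (⊞-identityˡ _) e) with le
  ... | ()

occ-self : ∀ {d} (v : W d) L → 0 < occ v (v ∷ L)
occ-self v L = ≤-trans (≤-reflexive (sym (⟦⟧-yes (v ≟ᵂ v) refl))) (m≤m+n _ _)

copies : ∀ {d} j (v : W d) L → j ≤ occ v L → ∃ λ R → L ↭ replicate j v ++ R
copies zero v L _ = L , ↭refl
copies (suc j) v L j< with find v L (≤-trans (s≤s z≤n) j<)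
... | M , p with copies j v M (≤-pred (≤-trans j< (≤-reflexive (trans (occ-↭ v p) (cong (_+ occ v M) (⟦⟧-yes (v ≟ᵂ v) refl))))))
...   | R , q = R , ↭-trans p (prep v q)

total-++ : ∀ {d} (S T : List (W d)) → total (S ++ T) ≡ total S ⊞ total T
total-++ [] T = sym (⊞-identityˡ _)
total-++ (v ∷ S) T = trans (cong (v ⊞_) (total-++ S T)) (sym (⊞-assoc v (total S) (total T)))

-- The source of all pruning: `i` chosen elements of sum `w` and `j` copies of `v` from the rest
-- would be five elements of sum zero.
few : ∀ {c r w} i j v → Good (c ++ r) → Rep i c w → i + j ≡ 5 → w ⊞ total (replicate j v) ≡ 𝟎 → occ v r < j
few {c} {r} i j v good (T , R , p , refl , refl) len e = ≰⇒> λ j≤ → let (M , q) = copies j v r j≤ in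
  Good⇒≢𝟎 good (T ++ replicate j v) (R ++ M)
    (↭-trans (++⁺ p q) (↭-trans (↭-reflexive (++-assoc T R (replicate j v ++ M))) (↭-trans (++⁺ˡ T (shifts R (replicate j v))) (↭-reflexive (sym (++-assoc T (replicate j v) (R ++ M)))))))
    (trans (length-++ T) (trans (cong (length T +_) (length-replicate j)) len))
    (trans (total-++ T (replicate j v)) e)

-- Candidates

-- cand x y k: at most k further elements are equal to (z , x , y), for a fixed z.
data Cand : Set where
  cand : (x y : 𝔽) (k : ℕ) → Cand

min : ℕ → ℕ → ℕ
min a b = if a <ᵇ b then a else b

min-≤ˡ : ∀ a b → min a b ≤ a
min-≤ˡ a b with a <ᵇ b in eq
... | true = ≤-refl
... | false = ≮⇒≥ λ lt → subst T eq (<⇒<ᵇ lt)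

min-≤ʳ : ∀ a b → min a b ≤ b
min-≤ʳ a b with a <ᵇ b in eq
... | true = <⇒≤ (<ᵇ⇒< a b (subst T (sym eq) tt))
... | false = ≤-refl

dbl tri : 𝔽 → 𝔽
dbl #0 = #0
dbl #1 = #2
dbl #2 = #4
dbl #3 = #1
dbl #4 = #3
tri #0 = #0
tri #1 = #3
tri #2 = #1
tri #3 = #4
tri #4 = #2

-- naddₖ a b = - (k a + b)
nadd₁ nadd₂ nadd₃ : 𝔽 → 𝔽 → 𝔽
nadd₁ #0 #0 = #0
nadd₁ #0 #1 = #4
nadd₁ #0 #2 = #3
nadd₁ #0 #3 = #2
nadd₁ #0 #4 = #1
nadd₁ #1 #0 = #4
nadd₁ #1 #1 = #3
nadd₁ #1 #2 = #2
nadd₁ #1 #3 = #1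
nadd₁ #1 #4 = #0
nadd₁ #2 #0 = #3
nadd₁ #2 #1 = #2
nadd₁ #2 #2 = #1
nadd₁ #2 #3 = #0
nadd₁ #2 #4 = #4
nadd₁ #3 #0 = #2
nadd₁ #3 #1 = #1
nadd₁ #3 #2 = #0
nadd₁ #3 #3 = #4
nadd₁ #3 #4 = #3
nadd₁ #4 #0 = #1
nadd₁ #4 #1 = #0
nadd₁ #4 #2 = #4
nadd₁ #4 #3 = #3
nadd₁ #4 #4 = #2
nadd₂ #0 #0 = #0
nadd₂ #0 #1 = #4
nadd₂ #0 #2 = #3
nadd₂ #0 #3 = #2
nadd₂ #0 #4 = #1
nadd₂ #1 #0 = #3
nadd₂ #1 #1 = #2
nadd₂ #1 #2 = #1
nadd₂ #1 #3 = #0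
nadd₂ #1 #4 = #4
nadd₂ #2 #0 = #1
nadd₂ #2 #1 = #0
nadd₂ #2 #2 = #4
nadd₂ #2 #3 = #3
nadd₂ #2 #4 = #2
nadd₂ #3 #0 = #4
nadd₂ #3 #1 = #3
nadd₂ #3 #2 = #2
nadd₂ #3 #3 = #1
nadd₂ #3 #4 = #0
nadd₂ #4 #0 = #2
nadd₂ #4 #1 = #1
nadd₂ #4 #2 = #0
nadd₂ #4 #3 = #4
nadd₂ #4 #4 = #3
nadd₃ #0 #0 = #0
nadd₃ #0 #1 = #4
nadd₃ #0 #2 = #3
nadd₃ #0 #3 = #2
nadd₃ #0 #4 = #1
nadd₃ #1 #0 = #2
nadd₃ #1 #1 = #1
nadd₃ #1 #2 = #0
nadd₃ #1 #3 = #4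
nadd₃ #1 #4 = #3
nadd₃ #2 #0 = #4
nadd₃ #2 #1 = #3
nadd₃ #2 #2 = #2
nadd₃ #2 #3 = #1
nadd₃ #2 #4 = #0
nadd₃ #3 #0 = #1
nadd₃ #3 #1 = #0
nadd₃ #3 #2 = #4
nadd₃ #3 #3 = #3
nadd₃ #3 #4 = #2
nadd₃ #4 #0 = #3
nadd₃ #4 #1 = #2
nadd₃ #4 #2 = #1
nadd₃ #4 #3 = #0
nadd₃ #4 #4 = #4

Plane : Set
Plane = Five (Five Bool)

-- j copies of v are excluded if -jv = (5 - j)v is a sum of 5 - j chosen elements; for j = 1, 2, 3,
-- 4 this vector is -v, 3v, 2v, v. The tests stop as soon as `k` is already below the next j.
capᴾ : (p₁ p₂ p₃ p₄ : Plane) → 𝔽 → 𝔽 → ℕ → ℕ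
capᴾ p₁ p₂ p₃ p₄ x y k =
  if look (look p₄ (neg x)) (neg y) then 0 else if k <ᵇ 2 then k else
  if look (look p₃ (tri x)) (tri y) then 1 else if k <ᵇ 3 then k else
  if look (look p₂ (dbl x)) (dbl y) then 2 else if k <ᵇ 4 then k else
  if look (look p₁ x) y then 3 else k

cap : Sums → 𝔽 → 𝔽 → 𝔽 → ℕ → ℕ
cap (sums a b c d) z = capᴾ (look a z) (look b (dbl z)) (look c (tri z)) (look d (neg z))

if-≤ : ∀ b {m n p : ℕ} → (b ≡ true → m ≤ n) → m ≤ p → m ≤ (if b then n else p)
if-≤ true m≤n _ = m≤n refl
if-≤ false _ m≤p = m≤p

occ-≤-cap : ∀ {s c r} z x y k → Sound s c → Good (c ++ r) → occ (z ∷ x ∷ y ∷ []) r ≤ k → occ (z ∷ x ∷ y ∷ []) r ≤ cap s z x y k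
occ-≤-cap {sums a b c d} {C} {r} z x y k (sound s₁ s₂ s₃ s₄) good le =
    if-≤ (at d (neg z) (neg x) (neg y)) (λ e → ≤-pred (few {C} {r} 4 1 v good (s₄ (neg z) (neg x) (neg y) e) refl (vec four))) (if-≤ (k <ᵇ 2) (λ _ → le)
    (if-≤ (at c (tri z) (tri x) (tri y)) (λ e → ≤-pred (few {C} {r} 3 2 v good (s₃ (tri z) (tri x) (tri y) e) refl (vec three))) (if-≤ (k <ᵇ 3) (λ _ → le)
    (if-≤ (at b (dbl z) (dbl x) (dbl y)) (λ e → ≤-pred (few {C} {r} 2 3 v good (s₂ (dbl z) (dbl x) (dbl y) e) refl (vec two))) (if-≤ (k <ᵇ 4) (λ _ → le)
    (if-≤ (at a z x y) (λ e → ≤-pred (few {C} {r} 1 4 v good (s₁ z x y e) refl (vec one))) le))))))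
  where
  v = z ∷ x ∷ y ∷ []
  vec : ∀ {f : 𝔽 → 𝔽} → (∀ a → f a ≡ #0) → f z ∷ f x ∷ f y ∷ [] ≡ 𝟎
  vec h = cong₂ _∷_ (h z) (cong₂ _∷_ (h x) (cong₂ _∷_ (h y) refl))
  four : ∀ a → neg a ⊹ (a ⊹ #0) ≡ #0
  four = from-yes (∀? λ a → neg a ⊹ (a ⊹ #0) ≟ #0)
  three : ∀ a → tri a ⊹ (a ⊹ (a ⊹ #0)) ≡ #0
  three = from-yes (∀? λ a → tri a ⊹ (a ⊹ (a ⊹ #0)) ≟ #0)
  two : ∀ a → dbl a ⊹ (a ⊹ (a ⊹ (a ⊹ #0))) ≡ #0
  two = from-yes (∀? λ a → dbl a ⊹ (a ⊹ (a ⊹ (a ⊹ #0))) ≟ #0)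
  one : ∀ a → a ⊹ (a ⊹ (a ⊹ (a ⊹ (a ⊹ #0)))) ≡ #0
  one = from-yes (∀? λ a → a ⊹ (a ⊹ (a ⊹ (a ⊹ (a ⊹ #0)))) ≟ #0)

-- A point without entry is excluded altogether, so entries whose capacity drops to zero can be
-- discarded.
Bounded : 𝔽 → List Cand → List (W 3) → Set
Bounded z cs r = ∀ x y → 0 < occ (z ∷ x ∷ y ∷ []) r → ∃ λ k → cand x y k ∈ cs × occ (z ∷ x ∷ y ∷ []) r ≤ k

push : 𝔽 → 𝔽 → ℕ → List Cand → List Cand
push x y zero cs = cs
push x y (suc k) cs = cand x y (suc k) ∷ cs

refineᴾ : (p₁ p₂ p₃ p₄ : Plane) → List Cand → List Cand
refineᴾ p₁ p₂ p₃ p₄ [] = []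
refineᴾ p₁ p₂ p₃ p₄ (cand x y k ∷ cs) = push x y (capᴾ p₁ p₂ p₃ p₄ x y k) (refineᴾ p₁ p₂ p₃ p₄ cs)

refine : Sums → 𝔽 → List Cand → List Cand
refine (sums a b c d) z = refineᴾ (look a z) (look b (dbl z)) (look c (tri z)) (look d (neg z))

push-here : ∀ x y k cs → 0 < k → cand x y k ∈ push x y k cs
push-here x y (suc k) cs _ = here refl

push-there : ∀ {c} x y k cs → c ∈ cs → c ∈ push x y k cs
push-there x y zero cs c∈ = c∈
push-there x y (suc k) cs c∈ = there c∈

refineᴾ-∈ : ∀ p₁ p₂ p₃ p₄ {x y k} cs → 0 < capᴾ p₁ p₂ p₃ p₄ x y k → cand x y k ∈ cs → cand x y (capᴾ p₁ p₂ p₃ p₄ x y k) ∈ refineᴾ p₁ p₂ p₃ p₄ cs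
refineᴾ-∈ p₁ p₂ p₃ p₄ (cand x y k ∷ cs) pos (here refl) = push-here x y (capᴾ p₁ p₂ p₃ p₄ x y k) (refineᴾ p₁ p₂ p₃ p₄ cs) pos
refineᴾ-∈ p₁ p₂ p₃ p₄ (cand x y k ∷ cs) pos (there c∈) = push-there x y (capᴾ p₁ p₂ p₃ p₄ x y k) (refineᴾ p₁ p₂ p₃ p₄ cs) (refineᴾ-∈ p₁ p₂ p₃ p₄ cs pos c∈)

refine-∈ : ∀ s z {x y k} cs → 0 < cap s z x y k → cand x y k ∈ cs → cand x y (cap s z x y k) ∈ refine s z cs
refine-∈ (sums a b c d) z = refineᴾ-∈ (look a z) (look b (dbl z)) (look c (tri z)) (look d (neg z))

refine-bounded : ∀ {s c r} z cs → Sound s c → Good (c ++ r) → Bounded z cs r → Bounded z (refine s z cs) r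
refine-bounded {s} {c} {r} z cs snd good bnd x y pos with bnd x y pos
... | k , c∈ , le = let le′ = occ-≤-cap {s} {c} {r} z x y k snd good le in
  cap s z x y k , refine-∈ s z cs (≤-trans pos le′) c∈ , le′

-- The same with the sums of a list c, for the list u ∷ c: only sums involving u are new.
capᵘ : (p₁ p₂ p₃ : Plane) → 𝔽 → 𝔽 → 𝔽 → 𝔽 → ℕ → ℕ
capᵘ p₁ p₂ p₃ x′ y′ x y k =
  if look (look p₃ (nadd₁ x x′)) (nadd₁ y y′) then 0 else if k <ᵇ 2 then k else
  if look (look p₂ (nadd₂ x x′)) (nadd₂ y y′) then 1 else if k <ᵇ 3 then k else
  if look (look p₁ (nadd₃ x x′)) (nadd₃ y y′) then 2 else k

refineᵘ : (p₁ p₂ p₃ : Plane) → 𝔽 → 𝔽 → List Cand → List Cand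
refineᵘ p₁ p₂ p₃ x′ y′ [] = []
refineᵘ p₁ p₂ p₃ x′ y′ (cand x y k ∷ cs) = push x y (capᵘ p₁ p₂ p₃ x′ y′ x y k) (refineᵘ p₁ p₂ p₃ x′ y′ cs)

refineᵘ-∈ : ∀ p₁ p₂ p₃ x′ y′ {x y k} cs → 0 < capᵘ p₁ p₂ p₃ x′ y′ x y k → cand x y k ∈ cs →
  cand x y (capᵘ p₁ p₂ p₃ x′ y′ x y k) ∈ refineᵘ p₁ p₂ p₃ x′ y′ cs
refineᵘ-∈ p₁ p₂ p₃ x′ y′ (cand x y k ∷ cs) pos (here refl) = push-here x y (capᵘ p₁ p₂ p₃ x′ y′ x y k) (refineᵘ p₁ p₂ p₃ x′ y′ cs) pos
refineᵘ-∈ p₁ p₂ p₃ x′ y′ (cand x y k ∷ cs) pos (there c∈) =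
  push-there x y (capᵘ p₁ p₂ p₃ x′ y′ x y k) (refineᵘ p₁ p₂ p₃ x′ y′ cs) (refineᵘ-∈ p₁ p₂ p₃ x′ y′ cs pos c∈)

refineWith : Sums → 𝔽 → 𝔽 → 𝔽 → 𝔽 → List Cand → List Cand
refineWith (sums a b c d) z′ x′ y′ z = refineᵘ (look a (nadd₃ z z′)) (look b (nadd₂ z z′)) (look c (nadd₁ z z′)) x′ y′

refineWith-bounded : ∀ {s c r} z′ x′ y′ z cs → Sound s c → Good ((z′ ∷ x′ ∷ y′ ∷ []) ∷ c ++ r) → Bounded z cs r → Bounded z (refineWith s z′ x′ y′ z cs) r
refineWith-bounded {sums a b c d} {C} {r} z′ x′ y′ z cs (sound s₁ s₂ s₃ s₄) good bnd x y pos = go (bnd x y pos)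
  where
  u = z′ ∷ x′ ∷ y′ ∷ []
  v = z ∷ x ∷ y ∷ []
  p₁ = look a (nadd₃ z z′)
  p₂ = look b (nadd₂ z z′)
  p₃ = look c (nadd₁ z z′)
  three : ∀ a b → (b ⊹ nadd₁ a b) ⊹ (a ⊹ #0) ≡ #0
  three = from-yes (∀? λ a → ∀? λ b → (b ⊹ nadd₁ a b) ⊹ (a ⊹ #0) ≟ #0)
  two : ∀ a b → (b ⊹ nadd₂ a b) ⊹ (a ⊹ (a ⊹ #0)) ≡ #0
  two = from-yes (∀? λ a → ∀? λ b → (b ⊹ nadd₂ a b) ⊹ (a ⊹ (a ⊹ #0)) ≟ #0)
  one : ∀ a b → (b ⊹ nadd₃ a b) ⊹ (a ⊹ (a ⊹ (a ⊹ #0))) ≡ #0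
  one = from-yes (∀? λ a → ∀? λ b → (b ⊹ nadd₃ a b) ⊹ (a ⊹ (a ⊹ (a ⊹ #0))) ≟ #0)
  vec : ∀ {f : 𝔽 → 𝔽 → 𝔽} → (∀ a b → f a b ≡ #0) → f z z′ ∷ f x x′ ∷ f y y′ ∷ [] ≡ 𝟎
  vec h = cong₂ _∷_ (h z z′) (cong₂ _∷_ (h x x′) (cong₂ _∷_ (h y y′) refl))
  improve : ∀ k → occ v r ≤ k → occ v r ≤ capᵘ p₁ p₂ p₃ x′ y′ x y k
  improve k le =
    if-≤ (at c (nadd₁ z z′) (nadd₁ x x′) (nadd₁ y y′)) (λ e → ≤-pred (few {u ∷ C} {r} 4 1 v good (Rep-take u (s₃ (nadd₁ z z′) (nadd₁ x x′) (nadd₁ y y′) e)) refl (vec three))) (if-≤ (k <ᵇ 2) (λ _ → le)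
    (if-≤ (at b (nadd₂ z z′) (nadd₂ x x′) (nadd₂ y y′)) (λ e → ≤-pred (few {u ∷ C} {r} 3 2 v good (Rep-take u (s₂ (nadd₂ z z′) (nadd₂ x x′) (nadd₂ y y′) e)) refl (vec two))) (if-≤ (k <ᵇ 3) (λ _ → le)
    (if-≤ (at a (nadd₃ z z′) (nadd₃ x x′) (nadd₃ y y′)) (λ e → ≤-pred (few {u ∷ C} {r} 2 3 v good (Rep-take u (s₁ (nadd₃ z z′) (nadd₃ x x′) (nadd₃ y y′) e)) refl (vec one))) le))))
  go : (∃ λ k → cand x y k ∈ cs × occ v r ≤ k) → ∃ λ k → cand x y k ∈ refineᵘ p₁ p₂ p₃ x′ y′ cs × occ v r ≤ k
  go (k , c∈ , le) = capᵘ p₁ p₂ p₃ x′ y′ x y k , refineᵘ-∈ p₁ p₂ p₃ x′ y′ cs (≤-trans pos (improve k le)) c∈ , improve k le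

capacity : List Cand → ℕ
capacity [] = 0
capacity (cand x y k ∷ cs) = k + capacity cs

-- In the search the functional has become the first coordinate, so this is a class size.
cls : 𝔽 → List (W 3) → ℕ
cls z L = occ𝔽 z (map Vec.head L)

without : W 3 → List (W 3) → List (W 3)
without v [] = []
without v (u ∷ r) with v ≟ᵂ u
... | yes _ = without v r
... | no _ = u ∷ without v r

occ-without : ∀ v u r → u ≢ v → occ u (without v r) ≡ occ u r
occ-without v u [] _ = refl
occ-without v u (x ∷ r) u≢v with v ≟ᵂ x
... | yes refl = trans (occ-without v u r u≢v) (sym (cong (_+ occ u r) (⟦⟧-no (u ≟ᵂ v) u≢v)))
... | no _ = cong (⟦ u ≟ᵂ x ⟧ +_) (occ-without v u r u≢v)

occ-without-≡ : ∀ v r → occ v (without v r) ≡ 0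
occ-without-≡ v [] = refl
occ-without-≡ v (x ∷ r) with v ≟ᵂ x
... | yes _ = occ-without-≡ v r
... | no v≢x = trans (cong (_+ occ v (without v r)) (⟦⟧-no (v ≟ᵂ x) v≢x)) (occ-without-≡ v r)

cls-without : ∀ z v r → cls z r ≤ occ v r + cls z (without v r)
cls-without z v [] = z≤n
cls-without z v (x ∷ r) with v ≟ᵂ x
... | yes _ = +-mono-≤ (⟦⟧≤1 (z ≟ Vec.head x)) (cls-without z v r)
... | no _ = ≤-trans (+-monoʳ-≤ ⟦ z ≟ Vec.head x ⟧ (cls-without z v r)) (≤-reflexive (rearrange ⟦ z ≟ Vec.head x ⟧ (occ v r) _))
  where
  rearrange : ∀ a b c → a + (b + c) ≡ b + (a + c)
  rearrange = solve-∀

cls-empty : ∀ z r → Bounded z [] r → cls z r ≤ 0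
cls-empty z [] bnd = z≤n
cls-empty z ((z′ ∷ x ∷ y ∷ []) ∷ r) bnd = decide (z ≟ z′)
  where
  none : ∀ {x y n} → ¬ (∃ λ k → cand x y k ∈ [] × n ≤ k)
  none (_ , () , _)
  decide : Dec (z ≡ z′) → ⟦ z ≟ z′ ⟧ + cls z r ≤ 0
  decide (yes refl) = ⊥-elim (none (bnd x y (occ-self (z ∷ x ∷ y ∷ []) r)))
  decide (no z≢z′) = ≤-trans (≤-reflexive (cong (_+ cls z r) (⟦⟧-no (z ≟ z′) z≢z′)))
    (cls-empty z r λ x′ y′ pos → ⊥-elim (none (bnd x′ y′ (≤-trans pos (m≤n+m _ _)))))

cls-≤-capacity : ∀ z cs r → Bounded z cs r → cls z r ≤ capacity cs
cls-≤-capacity z [] r bnd = cls-empty z r bnd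
cls-≤-capacity z (cand x y k ∷ cs) r bnd with occ v r ≤? k
  where v = z ∷ x ∷ y ∷ []
... | yes le = ≤-trans (cls-without z v r) (+-mono-≤ le (cls-≤-capacity z cs (without v r) bnd′))
  where
  v = z ∷ x ∷ y ∷ []
  bnd′ : Bounded z cs (without v r)
  bnd′ x′ y′ pos with (z ∷ x′ ∷ y′ ∷ []) ≟ᵂ v
  ... | yes refl = ⊥-elim (<-irrefl refl (<-≤-trans pos (≤-reflexive (occ-without-≡ v r))))
  ... | no ≢v with bnd x′ y′ (≤-trans pos (≤-reflexive (occ-without v _ r ≢v)))
  ...   | _ , here refl , _ = ⊥-elim (≢v refl)
  ...   | k′ , there c∈ , le′ = k′ , c∈ , ≤-trans (≤-reflexive (occ-without v _ r ≢v)) le′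
-- `Bounded` asks for some entry of the point with a valid bound. An entry that is too small is not
-- that one and may be dropped.
... | no ≰ = ≤-trans (cls-≤-capacity z cs r bnd′) (m≤n+m _ k)
  where
  bnd′ : Bounded z cs r
  bnd′ x′ y′ pos with bnd x′ y′ pos
  ... | _ , here refl , le′ = ⊥-elim (≰ le′)
  ... | k′ , there c∈ , le′ = k′ , c∈ , le′

insert : Cand → List Cand → List Cand
insert c [] = c ∷ []
insert (cand x y k) (cand x′ y′ k′ ∷ cs) = if k <ᵇ k′ then cand x′ y′ k′ ∷ insert (cand x y k) cs else cand x y k ∷ cand x′ y′ k′ ∷ cs

-- Large capacities come first. Soundness uses only that no entry is lost.
sort : List Cand → List Cand
sort = foldr insert []

insert-here : ∀ c cs → c ∈ insert c cs
insert-here c [] = here refl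
insert-here (cand x y k) (cand x′ y′ k′ ∷ cs) with k <ᵇ k′
... | true = there (insert-here (cand x y k) cs)
... | false = here refl

insert-there : ∀ {b} c cs → b ∈ cs → b ∈ insert c cs
insert-there (cand x y k) (cand x′ y′ k′ ∷ cs) b∈ with k <ᵇ k′ | b∈
... | true | here refl = here refl
... | true | there b∈′ = there (insert-there (cand x y k) cs b∈′)
... | false | b∈′ = there b∈′

sort-∈ : ∀ {c} cs → c ∈ cs → c ∈ sort cs
sort-∈ (c ∷ cs) (here refl) = insert-here c (sort cs)
sort-∈ (c ∷ cs) (there c∈) = insert-there c (sort cs) (sort-∈ cs c∈)

sort-bounded : ∀ z cs r → Bounded z cs r → Bounded z (sort cs) r
sort-bounded z cs r bnd x y pos with bnd x y pos
... | k , c∈ , le = k , sort-∈ cs c∈ , le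

-- Class profiles

Profile : Set
Profile = Five ℕ

within : Profile → Profile → Profile → Bool
within (five l₀ l₁ l₂ l₃ l₄) (five h₀ h₁ h₂ h₃ h₄) (five a₀ a₁ a₂ a₃ a₄) =
  if a₀ <ᵇ l₀ then false else if h₀ <ᵇ a₀ then false else
  if a₁ <ᵇ l₁ then false else if h₁ <ᵇ a₁ then false else
  if a₄ <ᵇ l₄ then false else if h₄ <ᵇ a₄ then false else
  if a₂ <ᵇ l₂ then false else if h₂ <ᵇ a₂ then false else
  if a₃ <ᵇ l₃ then false else if h₃ <ᵇ a₃ then false else true

≤⇒≮ᵇ : ∀ {a b} → a ≤ b → (b <ᵇ a) ≡ false
≤⇒≮ᵇ {a} {b} a≤b with b <ᵇ a in eq
... | false = refl
... | true = ⊥-elim (<⇒≱ (<ᵇ⇒< b a (subst T (sym eq) tt)) a≤b)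

within-intro : ∀ l h a → (∀ i → look l i ≤ look a i) → (∀ i → look a i ≤ look h i) → within l h a ≡ true
within-intro (five l₀ l₁ l₂ l₃ l₄) (five h₀ h₁ h₂ h₃ h₄) (five a₀ a₁ a₂ a₃ a₄) l≤ ≤h
  rewrite ≤⇒≮ᵇ (l≤ #0) | ≤⇒≮ᵇ (≤h #0) | ≤⇒≮ᵇ (l≤ #1) | ≤⇒≮ᵇ (≤h #1) | ≤⇒≮ᵇ (l≤ #4) | ≤⇒≮ᵇ (≤h #4)
        | ≤⇒≮ᵇ (l≤ #2) | ≤⇒≮ᵇ (≤h #2) | ≤⇒≮ᵇ (l≤ #3) | ≤⇒≮ᵇ (≤h #3) = refl

select : Profile → Profile → List Profile → List Profile
select l h [] = []
select l h (a ∷ as) = if within l h a then a ∷ select l h as else select l h as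

select-∈ : ∀ l h {a} as → within l h a ≡ true → a ∈ as → a ∈ select l h as
select-∈ l h (a ∷ as) w (here refl) rewrite w = here refl
select-∈ l h (a ∷ as) w (there a∈) with within l h a
... | true = there (select-∈ l h as w a∈)
... | false = select-∈ l h as w a∈

least : Profile → List Profile → Profile
least m [] = m
least m (a ∷ as) = least (zip5 min m a) as

least-≤ : ∀ i m as → look (least m as) i ≤ look m i
least-≤ i m [] = ≤-refl
least-≤ i m (a ∷ as) = ≤-trans (least-≤ i (zip5 min m a) as) (≤-trans (≤-reflexive (look-zip5 min m a i)) (min-≤ˡ (look m i) (look a i)))

least-∈ : ∀ i m {a} as → a ∈ m ∷ as → look (least m as) i ≤ look a i
least-∈ i m as (here refl) = least-≤ i m as
least-∈ i m (a ∷ as) (there (here refl)) = ≤-trans (least-≤ i (zip5 min m a) as) (≤-trans (≤-reflexive (look-zip5 min m a i)) (min-≤ʳ (look m i) (look a i)))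
least-∈ i m (a ∷ as) (there (there a∈)) = least-∈ i (zip5 min m a) as (there a∈)

-- The search

Cands : Set
Cands = Five (List Cand)

refine5 : Sums → Cands → Cands
refine5 s (five a b c d e) = five (refine s #0 a) (refine s #1 b) (refine s #2 c) (refine s #3 d) (refine s #4 e)

refineWith5 : Sums → 𝔽 → 𝔽 → 𝔽 → Cands → Cands
refineWith5 s z x y (five a b c d e) =
  five (refineWith s z x y #0 a) (refineWith s z x y #1 b) (refineWith s z x y #2 c) (refineWith s z x y #3 d) (refineWith s z x y #4 e)

upper : Profile → Cands → Profile
upper = zip5 λ n cs → n + capacity cs

bump : 𝔽 → Profile → Profile
bump #0 (five a b c d e) = five (suc a) b c d e
bump #1 (five a b c d e) = five a (suc b) c d e
bump #2 (five a b c d e) = five a b (suc c) d e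
bump #3 (five a b c d e) = five a b c (suc d) e
bump #4 (five a b c d e) = five a b c d (suc e)

key : ℕ → ℕ → List Cand → ℕ
key lo n cs = if n <ᵇ lo then (10 * length cs + 200) ∸ 7 * (lo ∸ n) else 1000

pick : 𝔽 → ℕ → 𝔽 → ℕ → (𝔽 → ℕ → 𝔽) → 𝔽
pick i a j b k = if b <ᵇ a then k j b else k i a

nonempty : List Cand → Bool
nonempty [] = false
nonempty (_ ∷ _) = true

firstNonempty : Cands → 𝔽
firstNonempty (five a b c d e) =
  if nonempty a then #0 else if nonempty b then #1 else if nonempty c then #2 else if nonempty d then #3 else #4

-- The class on which to branch: a class in which further elements are needed but few are possible.
-- This choice affects the running time only.
choose : Profile → Profile → Cands → 𝔽
choose (five l₀ l₁ l₂ l₃ l₄) (five n₀ n₁ n₂ n₃ n₄) cs@(five a b c d e) =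
  if n₀ <ᵇ l₀ then #0 else
  pick #1 (key l₁ n₁ b) #2 (key l₂ n₂ c) λ i m →
  pick i m #3 (key l₃ n₃ d) λ i m →
  pick i m #4 (key l₄ n₄ e) λ i m →
  if m <ᵇ 1000 then i else firstNonempty cs

-- explore n s m cs ps ≡ true: no list without zero-sum 5-subsequence extends a list with class sizes m and
-- sums s by elements bounded by cs to a list with profile in ps. In search the last element (z , x , y)
-- is not yet included in s; thus the sums are computed only at the inner nodes of the search tree.
search : ℕ → Sums → 𝔽 → 𝔽 → 𝔽 → Profile → Cands → List Profile → Bool
resume : ℕ → Sums → Profile → Cands → List Profile → Bool
explore : ℕ → Sums → Profile → Cands → List Profile → Bool
select-class : ℕ → Sums → Profile → Cands → List Profile → Profile → 𝔽 → Bool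
branch : ℕ → Sums → Profile → Cands → List Profile → 𝔽 → ℕ → List Cand → Bool

search n s z x y m cs ps = resume n (add z x y s) m (refineWith5 s z x y cs) ps

-- Exhausted fuel counts as failure, so it can never certify anything.
resume zero s m cs ps = false
resume (suc n) s m cs ps = explore n s m cs (select m (upper m cs) ps)

explore n s m cs [] = true
explore n s m cs (p ∷ ps) = let lo = least p ps in select-class n s m cs (p ∷ ps) lo (choose lo m cs)

select-class n s m cs ps lo i = branch n s m cs ps i (look lo i ∸ look m i) (sort (look cs i))

-- All points of class `i` have been ruled out: a contradiction if elements are still needed there,
-- otherwise the class is closed.
branch n s m cs ps i need [] = if 0 <ᵇ need then true else resume n s m (set i [] cs) ps
branch n s m cs ps i need (cand x y k ∷ l) =
  if capacity (cand x y k ∷ l) <ᵇ need then true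
  -- Either the rest contains this point, and one copy is chosen, or it contains none. Points
  -- already passed do not occur in `l`, so each multiset is reached in one order only.
  else (search n s i x y (bump i m) (set i (cand x y (k ∸ 1) ∷ l) cs) ps ∧ branch n s m cs ps i need l)

-- A counterexample that a node of the search must exclude: `c` is the chosen part, `r` the unknown
-- rest, and `profile` the class sizes of both together.
record Valid (s : Sums) (m : Profile) (cs : Cands) (ps : List Profile) (c r : List (W 3)) : Set where
  field
    good : Good (c ++ r)
    snd : Sound s c
    sizes : ∀ i → look m i ≡ cls i c
    bnd : ∀ i → Bounded i (look cs i) r
    profile : Profile
    profile∈ : profile ∈ ps
    profile≡ : ∀ i → look profile i ≡ cls i c + cls i r
open Valid

refine5-bounded : ∀ {s c r} cs → Sound s c → Good (c ++ r) → (∀ i → Bounded i (look cs i) r) → ∀ i → Bounded i (look (refine5 s cs) i) r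
refine5-bounded {s} {c} {r} (five p q t u v) snd good bnd #0 = refine-bounded {s} {c} {r} #0 p snd good (bnd #0)
refine5-bounded {s} {c} {r} (five p q t u v) snd good bnd #1 = refine-bounded {s} {c} {r} #1 q snd good (bnd #1)
refine5-bounded {s} {c} {r} (five p q t u v) snd good bnd #2 = refine-bounded {s} {c} {r} #2 t snd good (bnd #2)
refine5-bounded {s} {c} {r} (five p q t u v) snd good bnd #3 = refine-bounded {s} {c} {r} #3 u snd good (bnd #3)
refine5-bounded {s} {c} {r} (five p q t u v) snd good bnd #4 = refine-bounded {s} {c} {r} #4 v snd good (bnd #4)

refineWith5-bounded : ∀ {s c r} z x y cs → Sound s c → Good ((z ∷ x ∷ y ∷ []) ∷ c ++ r) → (∀ i → Bounded i (look cs i) r) →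
  ∀ i → Bounded i (look (refineWith5 s z x y cs) i) r
refineWith5-bounded {s} {c} {r} z x y (five p q t u v) snd good bnd #0 = refineWith-bounded {s} {c} {r} z x y #0 p snd good (bnd #0)
refineWith5-bounded {s} {c} {r} z x y (five p q t u v) snd good bnd #1 = refineWith-bounded {s} {c} {r} z x y #1 q snd good (bnd #1)
refineWith5-bounded {s} {c} {r} z x y (five p q t u v) snd good bnd #2 = refineWith-bounded {s} {c} {r} z x y #2 t snd good (bnd #2)
refineWith5-bounded {s} {c} {r} z x y (five p q t u v) snd good bnd #3 = refineWith-bounded {s} {c} {r} z x y #3 u snd good (bnd #3)
refineWith5-bounded {s} {c} {r} z x y (five p q t u v) snd good bnd #4 = refineWith-bounded {s} {c} {r} z x y #4 v snd good (bnd #4)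

look-bump : ∀ i m j → look (bump i m) j ≡ ⟦ j ≟ i ⟧ + look m j
look-bump #0 (five a b c d e) = λ { #0 → refl ; #1 → refl ; #2 → refl ; #3 → refl ; #4 → refl }
look-bump #1 (five a b c d e) = λ { #0 → refl ; #1 → refl ; #2 → refl ; #3 → refl ; #4 → refl }
look-bump #2 (five a b c d e) = λ { #0 → refl ; #1 → refl ; #2 → refl ; #3 → refl ; #4 → refl }
look-bump #3 (five a b c d e) = λ { #0 → refl ; #1 → refl ; #2 → refl ; #3 → refl ; #4 → refl }
look-bump #4 (five a b c d e) = λ { #0 → refl ; #1 → refl ; #2 → refl ; #3 → refl ; #4 → refl }

set-bounded : ∀ i l cs r → Bounded i l r → (∀ j → Bounded j (look cs j) r) → ∀ j → Bounded j (look (set i l cs) j) r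
set-bounded i l cs r bl bcs j with i ≟ j
... | yes refl = subst (λ q → Bounded i q r) (sym (look-set-≡ i l cs)) bl
... | no i≢j = subst (λ q → Bounded j q r) (sym (look-set-≢ i j l cs i≢j)) (bcs j)

cls-↭ : ∀ i {L M} → L ↭ M → cls i L ≡ cls i M
cls-↭ i p = occ𝔽-↭ i (map⁺ Vec.head p)

include-valid : ∀ {s m cs ps c r} i x y k l → Valid s m cs ps c r → Bounded i (cand x y k ∷ l) r → 0 < occ (i ∷ x ∷ y ∷ []) r →
  ∃ λ r′ → Valid (add i x y s) (bump i m) (set i (cand x y (k ∸ 1) ∷ l) cs) ps ((i ∷ x ∷ y ∷ []) ∷ c) r′
include-valid {s} {m} {cs} {ps} {c} {r} i x y k l V bl pos with find (i ∷ x ∷ y ∷ []) r pos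
... | r′ , p = r′ , record
    { good = zs-↭ (↭-trans (++⁺ˡ c p) (shift v c r′)) (good V)
    ; snd = add-sound i x y (snd V)
    ; sizes = λ j → trans (look-bump i m j) (cong (⟦ j ≟ i ⟧ +_) (sizes V j))
    ; bnd = set-bounded i (cand x y (k ∸ 1) ∷ l) cs r′ bl′ λ j x′ y′ pos′ → let (k′ , c∈ , le) = bnd V j x′ y′ (≤-trans pos′ (fewer _)) in k′ , c∈ , ≤-trans (fewer _) le
    ; profile = profile V
    ; profile∈ = profile∈ V
    ; profile≡ = λ j → trans (profile≡ V j) (trans (cong (cls j c +_) (cls-↭ j p)) (rearrange (cls j c) ⟦ j ≟ i ⟧ (cls j r′)))
    }
  where
  v = i ∷ x ∷ y ∷ []
  rearrange : ∀ a b c → a + (b + c) ≡ (b + a) + c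
  rearrange = solve-∀
  fewer : ∀ u → occ u r′ ≤ occ u r
  fewer u = ≤-trans (m≤n+m _ ⟦ u ≟ᵂ v ⟧) (≤-reflexive (sym (occ-↭ u p)))
  fewer-v : suc (occ v r′) ≤ occ v r
  fewer-v = ≤-reflexive (sym (trans (occ-↭ v p) (cong (_+ occ v r′) (⟦⟧-yes (v ≟ᵂ v) refl))))
  bl′ : Bounded i (cand x y (k ∸ 1) ∷ l) r′
  bl′ x′ y′ pos′ with bl x′ y′ (≤-trans pos′ (fewer _))
  ... | .k , here refl , le = k ∸ 1 , here refl , ≤-trans (≤-reflexive refl) (∸-monoˡ-≤ 1 (≤-trans fewer-v le))
  ... | k′ , there c∈ , le = k′ , there c∈ , ≤-trans (fewer _) le

tail-bounded : ∀ i x y k l r → Bounded i (cand x y k ∷ l) r → ¬ (0 < occ (i ∷ x ∷ y ∷ []) r) → Bounded i l r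
tail-bounded i x y k l r bl none x′ y′ pos with bl x′ y′ pos
... | .k , here refl , _ = ⊥-elim (none pos)
... | k′ , there c∈ , le = k′ , c∈ , le

resume-sound : ∀ n s m cs ps → resume n s m cs ps ≡ true → ∀ {c r} → ¬ Valid s m cs ps c r
explore-sound : ∀ n s m cs ps → explore n s m cs ps ≡ true → ∀ {c r} → ¬ Valid s m cs ps c r
-- `l` carries its own bound: it shrinks as points are ruled out, while the entry of `cs` for this
-- class is replaced only when the next node is entered.
branch-sound : ∀ n s m cs ps i need l → branch n s m cs ps i need l ≡ true →
  ∀ {c r} → Bounded i l r → need ≤ cls i r → ¬ Valid s m cs ps c r

resume-sound (suc n) s m cs ps e {c} {r} V = explore-sound n s m cs (select m (upper m cs) ps) e record
    { good = good V ; snd = snd V ; sizes = sizes V ; bnd = bnd V ; profile = profile V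
    -- The true profile lies between the chosen class sizes and what the candidates still allow, so
    -- it survives the selection.
    ; profile∈ = select-∈ m (upper m cs) ps (within-intro m (upper m cs) (profile V) above below) (profile∈ V)
    ; profile≡ = profile≡ V }
  where
  above : ∀ i → look m i ≤ look (profile V) i
  above i = ≤-trans (≤-reflexive (sizes V i)) (≤-trans (m≤m+n _ _) (≤-reflexive (sym (profile≡ V i))))
  below : ∀ i → look (profile V) i ≤ look (upper m cs) i
  below i = ≤-trans (≤-reflexive (profile≡ V i)) (≤-trans (+-mono-≤ (≤-reflexive (sym (sizes V i))) (cls-≤-capacity i _ r (bnd V i)))
    (≤-reflexive (sym (look-zip5 (λ n cs → n + capacity cs) m cs i))))

explore-sound n s m cs [] e V with profile∈ V
... | ()
explore-sound n s m cs (p ∷ ps) e {c} {r} V =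
  branch-sound n s m cs (p ∷ ps) i (look lo i ∸ look m i) (sort (look cs i)) e (sort-bounded i (look cs i) r (bnd V i))
    (≤-trans (∸-monoˡ-≤ (look m i) (≤-trans (least-∈ i p ps (profile∈ V)) (≤-reflexive (trans (profile≡ V i) (cong (_+ cls i r) (sym (sizes V i)))))))
      (≤-reflexive (m+n∸m≡n (look m i) (cls i r)))) V
  where
  lo = least p ps
  i = choose lo m cs

branch-sound n s m cs ps i need [] e {c} {r} bl need≤ V with 0 <ᵇ need in eq
... | true = <⇒≱ (<ᵇ⇒< 0 need (subst T (sym eq) tt)) (≤-trans need≤ (cls-≤-capacity i [] r bl))
... | false = resume-sound n s m (set i [] cs) ps e record
  { good = good V ; snd = snd V ; sizes = sizes V ; bnd = set-bounded i [] cs r bl (bnd V) ; profile = profile V ; profile∈ = profile∈ V ; profile≡ = profile≡ V }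
branch-sound n s m cs ps i need (cand x y k ∷ l) e {c} {r} bl need≤ V with capacity (cand x y k ∷ l) <ᵇ need in eq
... | true = <⇒≱ (<ᵇ⇒< (capacity (cand x y k ∷ l)) need (subst T (sym eq) tt)) (≤-trans need≤ (cls-≤-capacity i (cand x y k ∷ l) r bl))
... | false with search n s i x y (bump i m) (set i (cand x y (k ∸ 1) ∷ l) cs) ps in eq₁ | branch n s m cs ps i need l in eq₂ | 0 <? occ (i ∷ x ∷ y ∷ []) r
...   | true | true | yes pos = let (r′ , V′) = include-valid i x y k l V bl pos in resume-sound n _ _ _ ps eq₁ record
  { good = good V′ ; snd = snd V′ ; sizes = sizes V′ ; bnd = refineWith5-bounded {s} {c} {r′} i x y (set i (cand x y (k ∸ 1) ∷ l) cs) (snd V) (good V′) (bnd V′)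
  ; profile = profile V′ ; profile∈ = profile∈ V′ ; profile≡ = profile≡ V′ }
...   | true | true | no none = branch-sound n s m cs ps i need l eq₂ (tail-bounded i x y k l r bl none) need≤ V

-- Exhaustive enumeration of class profiles

-- Row k holds the numbers `N k t` for all targets. A further element x adds to each row the
-- previous one rotated by x, as in a multiplication of the generating polynomial by 1 + y X^x.
data Table : Set where
  table : (r₁ r₂ r₃ r₄ r₅ : Five ℕ) → Table

extend : 𝔽 → Table → Table
extend x (table a b c d e) =
  table (zip5 _+_ (rot x (five 1 0 0 0 0)) a) (zip5 _+_ (rot x a) b) (zip5 _+_ (rot x b) c) (zip5 _+_ (rot x c) d) (zip5 _+_ (rot x d) e)

zeros : Five ℕ
zeros = five 0 0 0 0 0

data Correct : Table → List 𝔽 → Set where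
  correct : ∀ {a b c d e xs} → (∀ t → look a t ≡ N 1 t xs) → (∀ t → look b t ≡ N 2 t xs) → (∀ t → look c t ≡ N 3 t xs) →
    (∀ t → look d t ≡ N 4 t xs) → (∀ t → look e t ≡ N 5 t xs) → Correct (table a b c d e) xs

extend-row : ∀ {k} x {r r′ xs} → (∀ t → look r t ≡ N k t xs) → (∀ t → look r′ t ≡ N (suc k) t xs) →
  ∀ t → look (zip5 _+_ (rot x r) r′) t ≡ N (suc k) t (x ∷ xs)
extend-row {k} x {r} {r′} p q t = trans (look-zip5 _+_ (rot x r) r′ t) (cong₂ _+_ (trans (look-rot x r t) (p (t ⊹ neg x))) (q t))

extend-correct : ∀ {t xs} x → Correct t xs → Correct (extend x t) (x ∷ xs)
extend-correct {xs = xs} x (correct a b c d e) = correct (extend-row {0} x {xs = xs} row₀ a) (extend-row {1} x {xs = xs} a b) (extend-row {2} x {xs = xs} b c) (extend-row {3} x {xs = xs} c d) (extend-row {4} x {xs = xs} d e)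
  where
  row₀ : ∀ t → look (five 1 0 0 0 0) t ≡ N 0 t xs
  row₀ = from-yes (∀? λ t → look (five 1 0 0 0 0) t ℕ.≟ N 0 t [])

zeros-correct : Correct (table zeros zeros zeros zeros zeros) []
zeros-correct = correct row row row row row
  where
  row : ∀ t → look zeros t ≡ 0
  row = from-yes (∀? λ t → look zeros t ℕ.≟ 0)

extends : ℕ → 𝔽 → Table → Table
extends zero x t = t
extends (suc k) x t = extends k x (extend x t)

extends-correct : ∀ {t xs} k x → Correct t xs → Correct (extends k x t) (replicate k x ++ xs)
extends-correct zero x c = c
extends-correct {t} {xs} (suc k) x c = subst (Correct (extends k x (extend x t))) (snoc k) (extends-correct k x (extend-correct x c))
  where
  snoc : ∀ k → replicate k x ++ x ∷ xs ≡ x ∷ (replicate k x ++ xs)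
  snoc zero = refl
  snoc (suc k) = cong (x ∷_) (snoc k)

-- Written with a continuation so that the table of the first classes is shared by all profiles that
-- extend them.
loop : ℕ → ℕ → 𝔽 → Table → ℕ → (ℕ → ℕ → Table → Bool) → Bool
loop zero n x t a next = next n a t
loop (suc c) zero x t a next = next zero a t
loop (suc c) (suc n) x t a next = next (suc n) a t ∧ loop c n x (extend x t) (suc a) next

∧-both : ∀ {a b} → a ∧ b ≡ true → a ≡ true × b ≡ true
∧-both {true} {true} _ = refl , refl

loop-sound : ∀ c n x t a next → loop c n x t a next ≡ true → ∀ k → k ≤ c → k ≤ n → next (n ∸ k) (a + k) (extends k x t) ≡ true
loop-sound zero n x t a next e zero _ _ rewrite +-identityʳ a = e
loop-sound (suc c) zero x t a next e zero _ _ rewrite +-identityʳ a = e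
loop-sound (suc c) (suc n) x t a next e zero _ _ rewrite +-identityʳ a = proj₁ (∧-both e)
loop-sound (suc c) (suc n) x t a next e (suc k) (s≤s k≤c) (s≤s k≤n) rewrite +-suc a k = loop-sound c n x (extend x t) (suc a) next (proj₂ (∧-both e)) k k≤c k≤n

final : (Profile → ℕ → Bool) → ℕ → ℕ → ℕ → ℕ → ℕ → ℕ → Table → Bool
final test a₀ a₁ a₂ a₃ zero a₄ (table _ _ _ _ r) = test (five a₀ a₁ a₂ a₃ a₄) (look r #0)
-- Elements are left over after the last class, so this is not a profile of the required size.
final test a₀ a₁ a₂ a₃ (suc _) a₄ t = true

-- Applies the test to all profiles a₀, …, a₄ of size n with a₀ ≤ c and a₁, …, a₄ ≤ c′ a₀.
scan : ℕ → (ℕ → ℕ) → ℕ → (Profile → ℕ → Bool) → Bool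
scan c c′ n test =
  loop c n #0 (table zeros zeros zeros zeros zeros) 0 λ n a₀ t →
  loop (c′ a₀) n #1 t 0 λ n a₁ t →
  loop (c′ a₀) n #2 t 0 λ n a₂ t →
  loop (c′ a₀) n #3 t 0 λ n a₃ t →
  loop (c′ a₀) n #4 t 0 λ n a₄ t → final test a₀ a₁ a₂ a₃ n a₄ t

counts : List 𝔽 → Profile
counts xs = tab λ i → occ𝔽 i xs

blocks : Profile → List 𝔽
blocks (five a b c d e) = replicate e #4 ++ (replicate d #3 ++ (replicate c #2 ++ (replicate b #1 ++ (replicate a #0 ++ []))))

occ-replicate : ∀ c k x → occ𝔽 c (replicate k x) ≡ k * ⟦ c ≟ x ⟧
occ-replicate c zero x = refl
occ-replicate c (suc k) x = cong (⟦ c ≟ x ⟧ +_) (occ-replicate c k x)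

blocks-↭ : ∀ xs → xs ↭ blocks (counts xs)
blocks-↭ xs = occ𝔽⇒↭ xs (blocks (counts xs)) λ c → sym (trans (all c (occ𝔽 #0 xs) (occ𝔽 #1 xs) (occ𝔽 #2 xs) (occ𝔽 #3 xs) (occ𝔽 #4 xs)) (look-tab (λ i → occ𝔽 i xs) c))
  where
  p₀ : ∀ a b c d e → e * 0 + (d * 0 + (c * 0 + (b * 0 + (a * 1 + 0)))) ≡ a
  p₀ = solve-∀
  p₁ : ∀ a b c d e → e * 0 + (d * 0 + (c * 0 + (b * 1 + (a * 0 + 0)))) ≡ b
  p₁ = solve-∀
  p₂ : ∀ a b c d e → e * 0 + (d * 0 + (c * 1 + (b * 0 + (a * 0 + 0)))) ≡ c
  p₂ = solve-∀
  p₃ : ∀ a b c d e → e * 0 + (d * 1 + (c * 0 + (b * 0 + (a * 0 + 0)))) ≡ d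
  p₃ = solve-∀
  p₄ : ∀ a b c d e → e * 1 + (d * 0 + (c * 0 + (b * 0 + (a * 0 + 0)))) ≡ e
  p₄ = solve-∀
  unfold : ∀ i a b c d e → occ𝔽 i (blocks (five a b c d e)) ≡ e * ⟦ i ≟ #4 ⟧ + (d * ⟦ i ≟ #3 ⟧ + (c * ⟦ i ≟ #2 ⟧ + (b * ⟦ i ≟ #1 ⟧ + (a * ⟦ i ≟ #0 ⟧ + 0))))
  unfold i a b c d e
    rewrite occ𝔽-++ i (replicate e #4) (replicate d #3 ++ (replicate c #2 ++ (replicate b #1 ++ (replicate a #0 ++ []))))
          | occ𝔽-++ i (replicate d #3) (replicate c #2 ++ (replicate b #1 ++ (replicate a #0 ++ [])))
          | occ𝔽-++ i (replicate c #2) (replicate b #1 ++ (replicate a #0 ++ []))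
          | occ𝔽-++ i (replicate b #1) (replicate a #0 ++ [])
          | occ𝔽-++ i (replicate a #0) []
          | occ-replicate i e #4 | occ-replicate i d #3 | occ-replicate i c #2 | occ-replicate i b #1 | occ-replicate i a #0 = refl
  all : ∀ i a b c d e → occ𝔽 i (blocks (five a b c d e)) ≡ look (five a b c d e) i
  all #0 a b c d e = trans (unfold #0 a b c d e) (p₀ a b c d e)
  all #1 a b c d e = trans (unfold #1 a b c d e) (p₁ a b c d e)
  all #2 a b c d e = trans (unfold #2 a b c d e) (p₂ a b c d e)
  all #3 a b c d e = trans (unfold #3 a b c d e) (p₃ a b c d e)
  all #4 a b c d e = trans (unfold #4 a b c d e) (p₄ a b c d e)

-- The counts do not depend on the order of the list. Sorted into blocks, its table is exactly the
-- one that the loops build.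
scan-sound : ∀ c c′ n test → scan c c′ n test ≡ true → ∀ xs → length xs ≡ n → occ𝔽 #0 xs ≤ c → (∀ i → occ𝔽 i xs ≤ c′ (occ𝔽 #0 xs)) →
  test (counts xs) (N 5 #0 xs) ≡ true
scan-sound c c′ n test e xs len occ₀≤ occ≤ = subst (λ z → test (counts xs) z ≡ true) (sym (N-↭ 5 #0 (blocks-↭ xs)))
    (at-end (extends-correct a₄ #4 (extends-correct a₃ #3 (extends-correct a₂ #2 (extends-correct a₁ #1 (extends-correct a₀ #0 zeros-correct))))) rest e₄)
  where
  a₀ = occ𝔽 #0 xs
  a₁ = occ𝔽 #1 xs
  a₂ = occ𝔽 #2 xs
  a₃ = occ𝔽 #3 xs
  a₄ = occ𝔽 #4 xs
  total-n : a₀ + (a₁ + (a₂ + (a₃ + a₄))) ≡ n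
  total-n = trans (Σocc xs) len
  left : ∀ {a r m} → a + r ≡ m → m ∸ a ≡ r
  left {a} {r} refl = m+n∸m≡n a r
  fits : ∀ {a r m} → a + r ≡ m → a ≤ m
  fits {a} {r} refl = m≤m+n a r
  n₁ : n ∸ a₀ ≡ a₁ + (a₂ + (a₃ + a₄))
  n₁ = left {a₀} total-n
  n₂ : n ∸ a₀ ∸ a₁ ≡ a₂ + (a₃ + a₄)
  n₂ = left {a₁} (sym n₁)
  n₃ : n ∸ a₀ ∸ a₁ ∸ a₂ ≡ a₃ + a₄
  n₃ = left {a₂} (sym n₂)
  n₄ : n ∸ a₀ ∸ a₁ ∸ a₂ ∸ a₃ ≡ a₄
  n₄ = left {a₃} (sym n₃)
  rest : n ∸ a₀ ∸ a₁ ∸ a₂ ∸ a₃ ∸ a₄ ≡ 0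
  rest = trans (cong (_∸ a₄) n₄) (n∸n≡0 a₄)
  e₀ = loop-sound c n #0 _ 0 _ e a₀ occ₀≤ (fits {a₀} total-n)
  e₁ = loop-sound (c′ a₀) _ #1 _ 0 _ e₀ a₁ (occ≤ #1) (fits {a₁} (sym n₁))
  e₂ = loop-sound (c′ a₀) _ #2 _ 0 _ e₁ a₂ (occ≤ #2) (fits {a₂} (sym n₂))
  e₃ = loop-sound (c′ a₀) _ #3 _ 0 _ e₂ a₃ (occ≤ #3) (fits {a₃} (sym n₃))
  e₄ = loop-sound (c′ a₀) _ #4 _ 0 _ e₃ a₄ (occ≤ #4) (≤-reflexive (sym n₄))
  at-end : ∀ {t ys m} → Correct t ys → m ≡ 0 → final test a₀ a₁ a₂ a₃ m a₄ t ≡ true → test (counts xs) (N 5 #0 ys) ≡ true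
  at-end (correct _ _ _ _ r) refl e = subst (λ z → test (counts xs) z ≡ true) (r #0) e

-- The Erdős-Ginzburg-Ziv theorem for the group of order five, by evaluation over all profiles of
-- size nine.
bounds₁ : Bounds 1 9
bounds₁ L len good = absurd (≤-trans small (≤-reflexive good))
    (scan-sound 9 (λ _ → 9) 9 (λ _ z → 0 <ᵇ z) refl (map (dot w) L) len′ (bound #0) bound)
  where
  w : W 1
  w = #1 ∷ []
  len′ : length (map (dot w) L) ≡ 9
  len′ = trans (length-map (dot w) L) len
  occ-≤-length : ∀ i xs → occ𝔽 i xs ≤ length xs
  occ-≤-length i [] = z≤n
  occ-≤-length i (x ∷ xs) = +-mono-≤ (⟦⟧≤1 (i ≟ x)) (occ-≤-length i xs)
  bound : ∀ i → occ𝔽 i (map (dot w) L) ≤ 9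
  bound i = ≤-trans (occ-≤-length i (map (dot w) L)) (≤-reflexive len′)
  small : Z w L ≤ zs L
  small = ≤-trans (Z-cnt w L) (cnt-mono _⊞_ (λ { (x ∷ []) → ⟦⟧-mono (x ⊹ #0 ≟ #0) ((x ∷ []) ≟ᵂ 𝟎) λ e → cong (_∷ []) (trans (sym (⊹-identityʳ x)) e) }) 5 L 𝟎)
  absurd : ∀ {z} → z ≤ 0 → (0 <ᵇ z) ≢ true
  absurd z≤n ()

-- Affine maps

timesᵂ : ∀ {d} → ℕ → W d → W d
timesᵂ zero b = 𝟎
timesᵂ (suc k) b = b ⊞ timesᵂ k b

five-times : ∀ {d} (b : W d) → timesᵂ 5 b ≡ 𝟎
five-times [] = refl
five-times (x ∷ b) = cong₂ _∷_ (from-yes (∀? λ x → x ⊹ (x ⊹ (x ⊹ (x ⊹ (x ⊹ #0)))) ≟ #0) x) (five-times b)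

-- Five translations by `b` add up to zero, so only the linear part acts on sums of five elements,
-- and it has trivial kernel.
affine-good : ∀ {d} (A : W d → W d) (b : W d) → (∀ u v → A (u ⊞ v) ≡ A u ⊞ A v) → A 𝟎 ≡ 𝟎 → (∀ v → A v ≡ 𝟎 → v ≡ 𝟎) →
  ∀ L → Good L → Good (map (λ v → A v ⊞ b) L)
affine-good A b A-⊞ A-𝟎 kernel L = ≤-Good {L = map (λ v → A v ⊞ b) L} {M = L}
  (cnt-map _⊞_ _⊞_ zero? zero? (λ v → A v ⊞ b) (λ k s a → s ⊞ timesᵂ k b ≡ A a) (λ _ → ℕ) (All.universal (λ _ → 0) L)
    (λ {k} {s} {a} {x} _ e → trans (trans (⊞-assoc s (A x ⊞ b) (timesᵂ k b)) (trans (cong (s ⊞_) (⊞-assoc (A x) b (timesᵂ k b))) (trans (sym (⊞-assoc s (A x) _)) (⊞-swap s (A x) _)))) (trans (cong (_⊞ A x) e) (sym (A-⊞ a x))))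
    (λ {s} {a} e → ⟦⟧-mono (s ≟ᵂ 𝟎) (a ≟ᵂ 𝟎) λ { refl → kernel a (trans (sym e) (⊞-identityʳ 𝟎)) })
    5 (trans (⊞-identityˡ _) (trans (five-times b) (sym A-𝟎))))

-- Affine maps of the form (z , x , y) ↦ (z , p x + q y + r z + t , …)

Coeffs : Set
Coeffs = 𝔽 × 𝔽 × 𝔽 × 𝔽

linear : Coeffs → 𝔽 → 𝔽 → 𝔽 → 𝔽
linear (p , q , r , _) z x y = p · x ⊹ (q · y ⊹ r · z)

affine : Coeffs → Coeffs → W 3 → W 3
affine f g (z ∷ x ∷ y ∷ []) = z ∷ linear f z x y ⊹ proj₂ (proj₂ (proj₂ f)) ∷ linear g z x y ⊹ proj₂ (proj₂ (proj₂ g)) ∷ []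

linear-⊞ : ∀ f z x y z′ x′ y′ → linear f (z ⊹ z′) (x ⊹ x′) (y ⊹ y′) ≡ linear f z x y ⊹ linear f z′ x′ y′
linear-⊞ (p , q , r , _) z x y z′ x′ y′ =
  trans (cong₂ _⊹_ (·-distribˡ p x x′) (trans (cong₂ _⊹_ (·-distribˡ q y y′) (·-distribˡ r z z′)) (⊹-interchange (q · y) (q · y′) (r · z) (r · z′))))
    (⊹-interchange (p · x) (p · x′) (q · y ⊹ r · z) (q · y′ ⊹ r · z′))

linear-𝟎 : ∀ f → linear f #0 #0 #0 ≡ #0
linear-𝟎 (p , q , r , _) = cong₂ _⊹_ (·-zeroʳ p) (cong₂ _⊹_ (·-zeroʳ q) (·-zeroʳ r))

module Iso (f g f′ g′ : Coeffs) (inverse : ∀ z x y → affine f′ g′ (affine f g (z ∷ x ∷ y ∷ [])) ≡ z ∷ x ∷ y ∷ []) where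

  φ : W 3 → W 3
  φ = affine f g

  injective : ∀ u v → φ u ≡ φ v → u ≡ v
  injective (z ∷ x ∷ y ∷ []) (z′ ∷ x′ ∷ y′ ∷ []) e = trans (sym (inverse z x y)) (trans (cong (affine f′ g′) e) (inverse z′ x′ y′))

  φ-good : ∀ L → Good L → Good (map φ L)
  φ-good L good = subst Good (map-cong split L) (affine-good A b A-⊞ A-𝟎 kernel L good)
    where
    A : W 3 → W 3
    A (z ∷ x ∷ y ∷ []) = z ∷ linear f z x y ∷ linear g z x y ∷ []
    b : W 3
    b = #0 ∷ proj₂ (proj₂ (proj₂ f)) ∷ proj₂ (proj₂ (proj₂ g)) ∷ []
    split : ∀ v → A v ⊞ b ≡ φ v
    split (z ∷ x ∷ y ∷ []) = cong (λ c → c ∷ linear f z x y ⊹ proj₂ (proj₂ (proj₂ f)) ∷ linear g z x y ⊹ proj₂ (proj₂ (proj₂ g)) ∷ []) (⊹-identityʳ z)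
    A-⊞ : ∀ u v → A (u ⊞ v) ≡ A u ⊞ A v
    A-⊞ (z ∷ x ∷ y ∷ []) (z′ ∷ x′ ∷ y′ ∷ []) = cong (z ⊹ z′ ∷_) (cong₂ _∷_ (linear-⊞ f z x y z′ x′ y′) (cong (_∷ []) (linear-⊞ g z x y z′ x′ y′)))
    A-𝟎 : A 𝟎 ≡ 𝟎
    A-𝟎 = cong (#0 ∷_) (cong₂ _∷_ (linear-𝟎 f) (cong (_∷ []) (linear-𝟎 g)))
    kernel : ∀ v → A v ≡ 𝟎 → v ≡ 𝟎
    kernel v e = injective v 𝟎 (trans (sym (split v)) (trans (cong (_⊞ b) (trans e (sym A-𝟎))) (split 𝟎)))

  occ-φ : ∀ v L → occ (φ v) (map φ L) ≡ occ v L
  occ-φ v [] = refl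
  occ-φ v (u ∷ L) = cong₂ _+_ (≤-antisym (⟦⟧-mono (φ v ≟ᵂ φ u) (v ≟ᵂ u) (injective v u)) (⟦⟧-mono (v ≟ᵂ u) (φ v ≟ᵂ φ u) (cong φ))) (occ-φ v L)

  preimage : ∀ u L → 0 < occ u (map φ L) → ∃ λ v → u ≡ φ v
  preimage u (v ∷ L) pos with u ≟ᵂ φ v
  ... | yes e = v , e
  ... | no _ = preimage u L pos

  occ-≤ : ∀ u L m → (∀ v → u ≡ φ v → occ v L ≤ m) → occ u (map φ L) ≤ m
  occ-≤ u L m h with 0 <? occ u (map φ L)
  ... | no none = ≤-trans (≮⇒≥ none) z≤n
  ... | yes pos with preimage u L pos
  ...   | v , refl = ≤-trans (≤-reflexive (occ-φ v L)) (h v refl)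

  cls-φ : ∀ i L → cls i (map φ L) ≡ cls i L
  cls-φ i L = cong (occ𝔽 i) (trans (sym (map-∘ L)) (map-cong (λ { (z ∷ x ∷ y ∷ []) → refl }) L))

-- Frames

larger : ∀ (g : 𝔽 → ℕ) a b → ∃ λ c → g a ≤ g c × g b ≤ g c
larger g a b with ≤-total (g a) (g b)
... | inj₁ a≤b = b , a≤b , ≤-refl
... | inj₂ b≤a = a , ≤-refl , b≤a

argmax : ∀ (g : 𝔽 → ℕ) → ∃ λ a → ∀ b → g b ≤ g a
argmax g = from₂ (larger g #0 #1)
  where
  from₄ : ∀ {r} → g #0 ≤ g r × g #1 ≤ g r × g #2 ≤ g r × g #3 ≤ g r → (∃ λ s → g r ≤ g s × g #4 ≤ g s) → ∃ λ a → ∀ b → g b ≤ g a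
  from₄ (r₀ , r₁ , r₂ , r₃) (s , r≤s , s₄) = s , λ
    { #0 → ≤-trans r₀ r≤s ; #1 → ≤-trans r₁ r≤s ; #2 → ≤-trans r₂ r≤s ; #3 → ≤-trans r₃ r≤s ; #4 → s₄ }
  from₃ : ∀ {q} → g #0 ≤ g q × g #1 ≤ g q × g #2 ≤ g q → (∃ λ r → g q ≤ g r × g #3 ≤ g r) → ∃ λ a → ∀ b → g b ≤ g a
  from₃ (q₀ , q₁ , q₂) (r , q≤r , r₃) = from₄ (≤-trans q₀ q≤r , ≤-trans q₁ q≤r , ≤-trans q₂ q≤r , r₃) (larger g r #4)
  from₂′ : ∀ {p} → g #0 ≤ g p × g #1 ≤ g p → (∃ λ q → g p ≤ g q × g #2 ≤ g q) → ∃ λ a → ∀ b → g b ≤ g a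
  from₂′ (p₀ , p₁) (q , p≤q , q₂) = from₃ (≤-trans p₀ p≤q , ≤-trans p₁ p≤q , q₂) (larger g q #3)
  from₂ : (∃ λ p → g #0 ≤ g p × g #1 ≤ g p) → ∃ λ a → ∀ b → g b ≤ g a
  from₂ (p , p₀ , p₁) = from₂′ (p₀ , p₁) (larger g p #2)

argmax₂ : ∀ (g : 𝔽 → 𝔽 → ℕ) → ∃ λ p → ∃ λ q → ∀ x y → g x y ≤ g p q
argmax₂ g = go (λ x → argmax (g x))
  where
  go : (∀ x → ∃ λ y → ∀ b → g x b ≤ g x y) → ∃ λ p → ∃ λ q → ∀ x y → g x y ≤ g p q
  go h = let (p , p-max) = argmax (λ x → g x (proj₁ (h x))) in p , proj₁ (h p) , λ x y → ≤-trans (proj₂ (h x) y) (p-max x)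

best : ∀ (f : 𝔽 → 𝔽 → ℕ) {P : 𝔽 → 𝔽 → Set} (P? : ∀ x y → Dec (P x y)) {x y} → P x y →
  ∃ λ p → ∃ λ q → P p q × (∀ x y → P x y → f x y ≤ f p q)
best f {P} P? {x₀} {y₀} P₀ = go (argmax₂ g)
  where
  g : 𝔽 → 𝔽 → ℕ
  -- The successor makes every admissible pair beat every inadmissible one, even when its value of
  -- `f` is zero.
  g x y = ⟦ P? x y ⟧ * suc (f x y)
  weight : ∀ {x y} → P x y → suc (f x y) ≡ g x y
  weight {x} {y} Pxy = sym (trans (cong (_* suc (f x y)) (⟦⟧-yes (P? x y) Pxy)) (*-identityˡ _))
  go : (∃ λ p → ∃ λ q → ∀ x y → g x y ≤ g p q) → ∃ λ p → ∃ λ q → P p q × (∀ x y → P x y → f x y ≤ f p q)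
  go (p , q , max) = p , q , holds (P? p q) , λ x y Pxy → ≤-pred (≤-trans (≤-reflexive (weight Pxy)) (≤-trans (max x y) (≤-reflexive (sym (weight (holds (P? p q)))))))
    where
    holds : Dec (P p q) → P p q
    holds (yes Ppq) = Ppq
    holds (no ¬Ppq) = ⊥-elim (<⇒≱ (≤-trans (s≤s z≤n) (≤-reflexive (weight P₀))) (≤-trans (max x₀ y₀) (≤-reflexive (cong (_* suc (f p q)) (⟦⟧-no (P? p q) ¬Ppq)))))

o e₁ e₂ : W 3
o = #0 ∷ #0 ∷ #0 ∷ []
e₁ = #0 ∷ #1 ∷ #0 ∷ []
e₂ = #0 ∷ #0 ∷ #1 ∷ []

-- The points o, e₁, e₂ are chosen greedily in the plane z = 0: o has the largest multiplicity m₁ there,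
-- e₁ the largest one among the other points, and e₂ the largest one off the line through o and e₁.
record Framed (L : List (W 3)) : Set where
  field
    zero-free : Good L
    m₁ m₂ m₃ : ℕ
    1≤m₃ : 1 ≤ m₃
    m₃≤m₂ : m₃ ≤ m₂
    m₂≤m₁ : m₂ ≤ m₁
    m₁≤4 : m₁ ≤ 4
    occ-o : occ o L ≡ m₁
    occ-e₁ : occ e₁ L ≡ m₂
    occ-e₂ : occ e₂ L ≡ m₃
    on-axis : ∀ x → x ≢ #0 → occ (#0 ∷ x ∷ #0 ∷ []) L ≤ m₂
    off-axis : ∀ x y → y ≢ #0 → occ (#0 ∷ x ∷ y ∷ []) L ≤ m₃

occ-≤4 : ∀ v L → Good L → occ v L ≤ 4
occ-≤4 v L good = ≤-pred (few {[]} {L} {𝟎} 0 5 v good ([] , [] , ↭refl , refl , refl) refl (trans (⊞-identityˡ _) (five-times v)))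

∈⇒occ : ∀ {d} {v : W d} {L} → v ∈ L → 0 < occ v L
∈⇒occ {v = v} {L = _ ∷ L} (here refl) = occ-self v L
∈⇒occ (there v∈) = ≤-trans (∈⇒occ v∈) (m≤n+m _ _)

-- Guarantees the third point of a frame: nine elements of the plane z = 0 cannot all lie on the
-- first axis, by the bound in dimension one.
line : ∀ L → Good L → (∀ x y → y ≢ #0 → occ (#0 ∷ x ∷ y ∷ []) L ≤ 0) → cls #0 L < 9
line L good none = ≰⇒> λ 9≤ → Bounds-≤ bounds₁ (map project K) (≤-trans 9≤ (≤-reflexive (sym (trans (length-map project K) (length-K L)))))
    (≤-Good {L = map project K} {M = K} small (n≤0⇒n≡0 (≤-trans (cnt-filter _⊞_ in? zero? 5 L 𝟎) (≤-reflexive good))))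
  where
  in? : ∀ v → Dec (#0 ≡ Vec.head v)
  in? v = #0 ≟ Vec.head v
  K = filter in? L
  project : W 3 → W 1
  project (z ∷ x ∷ y ∷ []) = x ∷ []
  On : W 3 → Set
  On v = v ≡ #0 ∷ Vec.head (project v) ∷ #0 ∷ []
  length-K : ∀ L → length (filter in? L) ≡ cls #0 L
  length-K [] = refl
  length-K (v ∷ L) with does (#0 ≟ Vec.head v)
  ... | true = cong suc (length-K L)
  ... | false = length-K L
  on : ∀ {v} → v ∈ K → On v
  on {z ∷ x ∷ y ∷ []} v∈ with ∈-filter⁻ in? {xs = L} v∈
  ... | v∈L , refl with y ≟ #0
  ...   | yes refl = refl
  ...   | no y≢0 = ⊥-elim (<⇒≱ (∈⇒occ {L = L} v∈L) (none x y y≢0))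
  small : zs (map project K) ≤ zs K
  small = cnt-map _⊞_ _⊞_ zero? zero? project (λ k b a → a ≡ #0 ∷ Vec.head b ∷ #0 ∷ []) On (All.tabulate on)
    (λ { {b = b ∷ []} {x = z ∷ x ∷ y ∷ []} refl refl → refl })
    (λ { {b ∷ []} refl → ⟦⟧-mono ((b ∷ []) ≟ᵂ 𝟎) ((#0 ∷ b ∷ #0 ∷ []) ≟ᵂ 𝟎) λ { refl → refl } }) 5 refl

inv : 𝔽 → 𝔽
inv #0 = #0
inv #1 = #1
inv #2 = #3
inv #3 = #2
inv #4 = #4

-- A linear map of the plane that takes (a , b) to (1 , 0), and its inverse
toAxis fromAxis : 𝔽 → 𝔽 → Coeffs × Coeffs
toAxis #0 b = (#0 , inv b , #0 , #0) , (#1 , #0 , #0 , #0)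
toAxis a b = (inv a , #0 , #0 , #0) , (neg (b · inv a) , #1 , #0 , #0)
fromAxis #0 b = (#0 , #1 , #0 , #0) , (b , #0 , #0 , #0)
fromAxis a b = (a , #0 , #0 , #0) , (b , #1 , #0 , #0)

translate-inverse : ∀ p q z x y →
  affine (#1 , #0 , #0 , p) (#0 , #1 , #0 , q) (affine (#1 , #0 , #0 , neg p) (#0 , #1 , #0 , neg q) (z ∷ x ∷ y ∷ [])) ≡ z ∷ x ∷ y ∷ []
translate-inverse p q z x y = cong₂ (λ x y → z ∷ x ∷ y ∷ []) (cancel p x) (cancel q y)
  where
  cancel : ∀ p x → x ⊹ #0 ⊹ neg p ⊹ #0 ⊹ p ≡ x
  cancel = from-yes (∀? λ p → ∀? λ x → x ⊹ #0 ⊹ neg p ⊹ #0 ⊹ p ≟ x)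

module Translate (p q : 𝔽) = Iso (#1 , #0 , #0 , neg p) (#0 , #1 , #0 , neg q) (#1 , #0 , #0 , p) (#0 , #1 , #0 , q) (translate-inverse p q)

shear-inverse : ∀ a b z x y →
  affine (#1 , #0 , neg a , #0) (#0 , #1 , neg b , #0) (affine (#1 , #0 , a , #0) (#0 , #1 , b , #0) (z ∷ x ∷ y ∷ [])) ≡ z ∷ x ∷ y ∷ []
shear-inverse a b z x y = cong₂ (λ x y → z ∷ x ∷ y ∷ []) (cancel a z x) (cancel b z y)
  where
  cancel : ∀ a z x → x ⊹ a · z ⊹ #0 ⊹ neg a · z ⊹ #0 ≡ x
  cancel = from-yes (∀? λ a → ∀? λ z → ∀? λ x → x ⊹ a · z ⊹ #0 ⊹ neg a · z ⊹ #0 ≟ x)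

module Shear (a b : 𝔽) = Iso (#1 , #0 , a , #0) (#0 , #1 , b , #0) (#1 , #0 , neg a , #0) (#0 , #1 , neg b , #0) (shear-inverse a b)

axis-inverse : ∀ a b → ¬ (a ≡ #0 × b ≡ #0) → ∀ z x y →
  affine (proj₁ (fromAxis a b)) (proj₂ (fromAxis a b)) (affine (proj₁ (toAxis a b)) (proj₂ (toAxis a b)) (z ∷ x ∷ y ∷ [])) ≡ z ∷ x ∷ y ∷ []
axis-inverse a b ab≢0 z x y = go a ab≢0
  where
  planar? : ∀ a b x y → Dec (Vec.tail (affine (proj₁ (fromAxis a b)) (proj₂ (fromAxis a b)) (affine (proj₁ (toAxis a b)) (proj₂ (toAxis a b)) (#0 ∷ x ∷ y ∷ []))) ≡ x ∷ y ∷ [])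
  planar? a b x y = _ ≟ᵂ _
  go : ∀ a → ¬ (a ≡ #0 × b ≡ #0) → affine (proj₁ (fromAxis a b)) (proj₂ (fromAxis a b)) (affine (proj₁ (toAxis a b)) (proj₂ (toAxis a b)) (z ∷ x ∷ y ∷ [])) ≡ z ∷ x ∷ y ∷ []
  go #0 ab≢0 = cong (z ∷_) (from-yes (∀? λ b → ¬? (b ≟ #0) →-dec (∀? λ x → ∀? λ y → planar? #0 b x y)) b (λ b≡0 → ab≢0 (refl , b≡0)) x y)
  go #1 _ = cong (z ∷_) (from-yes (∀? λ b → ∀? λ x → ∀? λ y → planar? #1 b x y) b x y)
  go #2 _ = cong (z ∷_) (from-yes (∀? λ b → ∀? λ x → ∀? λ y → planar? #2 b x y) b x y)
  go #3 _ = cong (z ∷_) (from-yes (∀? λ b → ∀? λ x → ∀? λ y → planar? #3 b x y) b x y)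
  go #4 _ = cong (z ∷_) (from-yes (∀? λ b → ∀? λ x → ∀? λ y → planar? #4 b x y) b x y)

module Axis (a b : 𝔽) (ab≢0 : ¬ (a ≡ #0 × b ≡ #0)) =
  Iso (proj₁ (toAxis a b)) (proj₂ (toAxis a b)) (proj₁ (fromAxis a b)) (proj₂ (fromAxis a b)) (axis-inverse a b ab≢0)

second-inverse : ∀ c e → e ≢ #0 → ∀ z x y →
  affine (#1 , c , #0 , #0) (#0 , e , #0 , #0) (affine (#1 , neg (c · inv e) , #0 , #0) (#0 , inv e , #0 , #0) (z ∷ x ∷ y ∷ [])) ≡ z ∷ x ∷ y ∷ []
second-inverse c e e≢0 z x y = cong (z ∷_) (planar e e≢0 c x y)
  where
  planar : ∀ e → e ≢ #0 → ∀ c x y →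
    Vec.tail (affine (#1 , c , #0 , #0) (#0 , e , #0 , #0) (affine (#1 , neg (c · inv e) , #0 , #0) (#0 , inv e , #0 , #0) (#0 ∷ x ∷ y ∷ []))) ≡ x ∷ y ∷ []
  planar = from-yes (∀? λ e → ¬? (e ≟ #0) →-dec (∀? λ c → ∀? λ x → ∀? λ y →
    Vec.tail (affine (#1 , c , #0 , #0) (#0 , e , #0 , #0) (affine (#1 , neg (c · inv e) , #0 , #0) (#0 , inv e , #0 , #0) (#0 ∷ x ∷ y ∷ []))) ≟ᵂ (x ∷ y ∷ [])))

module Second (c e : 𝔽) (e≢0 : e ≢ #0) =
  Iso (#1 , neg (c · inv e) , #0 , #0) (#0 , inv e , #0 , #0) (#1 , c , #0 , #0) (#0 , e , #0 , #0) (second-inverse c e e≢0)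

record Step (L M : List (W 3)) : Set where
  field
    good : Good M
    classes : ∀ i → cls i M ≡ cls i L

first-step : ∀ L → Good L → ∃ λ M → Step L M × (∀ x y → occ (#0 ∷ x ∷ y ∷ []) M ≤ occ o M)
first-step L good = go (best (λ x y → occ (#0 ∷ x ∷ y ∷ []) L) {λ _ _ → ⊤} (λ _ _ → yes tt) {#0} {#0} tt)
  where
  go : (∃ λ p → ∃ λ q → ⊤ × (∀ x y → ⊤ → occ (#0 ∷ x ∷ y ∷ []) L ≤ occ (#0 ∷ p ∷ q ∷ []) L)) →
    ∃ λ M → Step L M × (∀ x y → occ (#0 ∷ x ∷ y ∷ []) M ≤ occ o M)
  go (p , q , _ , max) = map I.φ L , record { good = I.φ-good L good ; classes = λ i → I.cls-φ i L } , λ x y →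
      I.occ-≤ (#0 ∷ x ∷ y ∷ []) L (occ o (map I.φ L)) λ { (z ∷ x′ ∷ y′ ∷ []) e → bound z x′ y′ (Vec.∷-injectiveˡ e) }
    where
    module I = Translate p q
    centre : I.φ (#0 ∷ p ∷ q ∷ []) ≡ o
    centre = cong₂ (λ x y → #0 ∷ x ∷ y ∷ []) (cancel p) (cancel q)
      where
      cancel : ∀ p → p ⊹ #0 ⊹ neg p ≡ #0
      cancel = from-yes (∀? λ p → p ⊹ #0 ⊹ neg p ≟ #0)
    bound : ∀ z x y → #0 ≡ z → occ (z ∷ x ∷ y ∷ []) L ≤ occ o (map I.φ L)
    bound .#0 x y refl = ≤-trans (max x y tt) (≤-reflexive (trans (sym (I.occ-φ (#0 ∷ p ∷ q ∷ []) L)) (cong (λ v → occ v (map I.φ L)) centre)))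

toAxis-o : ∀ a b → affine (proj₁ (toAxis a b)) (proj₂ (toAxis a b)) o ≡ o
toAxis-o = from-yes (∀? λ a → ∀? λ b → affine (proj₁ (toAxis a b)) (proj₂ (toAxis a b)) o ≟ᵂ o)

toAxis-e₁ : ∀ a b → ¬ (a ≡ #0 × b ≡ #0) → affine (proj₁ (toAxis a b)) (proj₂ (toAxis a b)) (#0 ∷ a ∷ b ∷ []) ≡ e₁
toAxis-e₁ = from-yes (∀? λ a → ∀? λ b → ¬? ((a ≟ #0) ×-dec (b ≟ #0)) →-dec (affine (proj₁ (toAxis a b)) (proj₂ (toAxis a b)) (#0 ∷ a ∷ b ∷ []) ≟ᵂ e₁))

second-step : ∀ L → Good L → (∀ x y → occ (#0 ∷ x ∷ y ∷ []) L ≤ occ o L) →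
  ∃ λ M → Step L M × occ e₁ M ≤ occ o M × (∀ x y → ¬ (x ≡ #0 × y ≡ #0) → occ (#0 ∷ x ∷ y ∷ []) M ≤ occ e₁ M)
second-step L good top = go (best (λ x y → occ (#0 ∷ x ∷ y ∷ []) L) {λ x y → ¬ (x ≡ #0 × y ≡ #0)} (λ x y → ¬? ((x ≟ #0) ×-dec (y ≟ #0))) {#1} {#0} (λ { (() , _) }))
  where
  go : (∃ λ a → ∃ λ b → ¬ (a ≡ #0 × b ≡ #0) × (∀ x y → ¬ (x ≡ #0 × y ≡ #0) → occ (#0 ∷ x ∷ y ∷ []) L ≤ occ (#0 ∷ a ∷ b ∷ []) L)) →
    ∃ λ M → Step L M × occ e₁ M ≤ occ o M × (∀ x y → ¬ (x ≡ #0 × y ≡ #0) → occ (#0 ∷ x ∷ y ∷ []) M ≤ occ e₁ M)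
  go (a , b , ab≢0 , max) = map I.φ L , record { good = I.φ-good L good ; classes = λ i → I.cls-φ i L } ,
      ≤-trans (≤-reflexive at-e₁) (≤-trans (top a b) (≤-reflexive (sym at-o))) ,
      λ x y xy≢0 → I.occ-≤ (#0 ∷ x ∷ y ∷ []) L (occ e₁ (map I.φ L)) λ { (z ∷ x′ ∷ y′ ∷ []) e → bound x y xy≢0 z x′ y′ (Vec.∷-injectiveˡ e) e }
    where
    module I = Axis a b ab≢0
    at-o : occ o (map I.φ L) ≡ occ o L
    at-o = trans (cong (λ v → occ v (map I.φ L)) (sym (toAxis-o a b))) (I.occ-φ o L)
    at-e₁ : occ e₁ (map I.φ L) ≡ occ (#0 ∷ a ∷ b ∷ []) L
    at-e₁ = trans (cong (λ v → occ v (map I.φ L)) (sym (toAxis-e₁ a b ab≢0))) (I.occ-φ (#0 ∷ a ∷ b ∷ []) L)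
    bound : ∀ x y → ¬ (x ≡ #0 × y ≡ #0) → ∀ z x′ y′ → #0 ≡ z → #0 ∷ x ∷ y ∷ [] ≡ I.φ (z ∷ x′ ∷ y′ ∷ []) → occ (z ∷ x′ ∷ y′ ∷ []) L ≤ occ e₁ (map I.φ L)
    bound x y xy≢0 .#0 x′ y′ refl e = ≤-trans (max x′ y′ λ { (refl , refl) → xy≢0 (coordinates (trans e (toAxis-o a b))) }) (≤-reflexive (sym at-e₁))
      where
      coordinates : ∀ {x y} → #0 ∷ x ∷ y ∷ [] ≡ o → x ≡ #0 × y ≡ #0
      coordinates refl = refl , refl

third-step : ∀ L → Good L → 9 ≤ cls #0 L → occ e₁ L ≤ occ o L → (∀ x y → ¬ (x ≡ #0 × y ≡ #0) → occ (#0 ∷ x ∷ y ∷ []) L ≤ occ e₁ L) →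
  ∃ λ M → Framed M × (∀ i → cls i M ≡ cls i L)
third-step L good 9≤ e₁≤o top = go (best (λ x y → occ (#0 ∷ x ∷ y ∷ []) L) {λ x y → y ≢ #0} (λ x y → ¬? (y ≟ #0)) {#0} {#1} (λ ()))
  where
  go : (∃ λ c → ∃ λ e → e ≢ #0 × (∀ x y → y ≢ #0 → occ (#0 ∷ x ∷ y ∷ []) L ≤ occ (#0 ∷ c ∷ e ∷ []) L)) → ∃ λ M → Framed M × (∀ i → cls i M ≡ cls i L)
  go (c , e , e≢0 , max) = map I.φ L , framed , λ i → I.cls-φ i L
    where
    module I = Second c e e≢0
    at-axis : ∀ x → I.φ (#0 ∷ x ∷ #0 ∷ []) ≡ #0 ∷ x ∷ #0 ∷ []
    at-axis x = from-yes (∀? λ c → ∀? λ e → ∀? λ x → affine (#1 , neg (c · inv e) , #0 , #0) (#0 , inv e , #0 , #0) (#0 ∷ x ∷ #0 ∷ []) ≟ᵂ (#0 ∷ x ∷ #0 ∷ [])) c e x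
    at-ce : I.φ (#0 ∷ c ∷ e ∷ []) ≡ e₂
    at-ce = from-yes (∀? λ c → ∀? λ e → ¬? (e ≟ #0) →-dec (affine (#1 , neg (c · inv e) , #0 , #0) (#0 , inv e , #0 , #0) (#0 ∷ c ∷ e ∷ []) ≟ᵂ e₂)) c e e≢0
    occ-axis : ∀ x → occ (#0 ∷ x ∷ #0 ∷ []) (map I.φ L) ≡ occ (#0 ∷ x ∷ #0 ∷ []) L
    occ-axis x = trans (cong (λ v → occ v (map I.φ L)) (sym (at-axis x))) (I.occ-φ (#0 ∷ x ∷ #0 ∷ []) L)
    bound : ∀ x y → y ≢ #0 → ∀ z x′ y′ → #0 ≡ z → #0 ∷ x ∷ y ∷ [] ≡ I.φ (z ∷ x′ ∷ y′ ∷ []) → occ (z ∷ x′ ∷ y′ ∷ []) L ≤ occ (#0 ∷ c ∷ e ∷ []) L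
    bound x y y≢0 .#0 x′ y′ refl eq = max x′ y′ λ { refl → y≢0 (last (trans eq (at-axis x′))) }
      where
      last : ∀ {x y x′ : 𝔽} → _≡_ {A = W 3} (#0 ∷ x ∷ y ∷ []) (#0 ∷ x′ ∷ #0 ∷ []) → y ≡ #0
      last refl = refl
    framed : Framed (map I.φ L)
    framed = record
      { zero-free = I.φ-good L good
      ; m₁ = occ o L
      ; m₂ = occ e₁ L
      ; m₃ = occ (#0 ∷ c ∷ e ∷ []) L
      ; 1≤m₃ = ≮⇒≥ λ lt → <⇒≱ (line L good λ x y y≢0 → ≤-trans (max x y y≢0) (≤-pred lt)) 9≤
      ; m₃≤m₂ = top c e λ { (_ , e≡0) → e≢0 e≡0 }
      ; m₂≤m₁ = e₁≤o
      ; m₁≤4 = occ-≤4 o L good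
      ; occ-o = occ-axis #0
      ; occ-e₁ = occ-axis #1
      ; occ-e₂ = trans (cong (λ v → occ v (map I.φ L)) (sym at-ce)) (I.occ-φ (#0 ∷ c ∷ e ∷ []) L)
      ; on-axis = λ x x≢0 → ≤-trans (≤-reflexive (occ-axis x)) (top x #0 λ { (x≡0 , _) → x≢0 x≡0 })
      ; off-axis = λ x y y≢0 → I.occ-≤ (#0 ∷ x ∷ y ∷ []) L (occ (#0 ∷ c ∷ e ∷ []) L) λ { (z ∷ x′ ∷ y′ ∷ []) eq → bound x y y≢0 z x′ y′ (Vec.∷-injectiveˡ eq) eq }
      }

frame : ∀ L → Good L → 9 ≤ cls #0 L → ∃ λ M → Framed M × (∀ i → cls i M ≡ cls i L)
frame L good 9≤ = go₁ (first-step L good)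
  where
  go₂ : ∀ {L₁} → Step L L₁ → (∃ λ M → Step L₁ M × occ e₁ M ≤ occ o M × (∀ x y → ¬ (x ≡ #0 × y ≡ #0) → occ (#0 ∷ x ∷ y ∷ []) M ≤ occ e₁ M)) →
    ∃ λ M → Framed M × (∀ i → cls i M ≡ cls i L)
  go₂ {L₁} s₁ (L₂ , s₂ , e₁≤o , top) = go₃ (third-step L₂ (Step.good s₂) (≤-trans 9≤ (≤-reflexive (sym (same #0)))) e₁≤o top)
    where
    same : ∀ i → cls i L₂ ≡ cls i L
    same i = trans (Step.classes s₂ i) (Step.classes s₁ i)
    go₃ : (∃ λ M → Framed M × (∀ i → cls i M ≡ cls i L₂)) → ∃ λ M → Framed M × (∀ i → cls i M ≡ cls i L)
    go₃ (L₃ , F , classes) = L₃ , F , λ i → trans (classes i) (same i)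
  go₁ : (∃ λ M → Step L M × (∀ x y → occ (#0 ∷ x ∷ y ∷ []) M ≤ occ o M)) → ∃ λ M → Framed M × (∀ i → cls i M ≡ cls i L)
  go₁ (L₁ , s₁ , top) = go₂ s₁ (second-step L₁ (Step.good s₁) top)

-- Starting the search from a frame

sumsOf : List (W 3) → Sums
sumsOf [] = sums ∅ ∅ ∅ ∅
sumsOf ((z ∷ x ∷ y ∷ []) ∷ L) = add z x y (sumsOf L)

sumsOf-sound : ∀ L → Sound (sumsOf L) L
sumsOf-sound [] = sound (∅-sound 1 []) (∅-sound 2 []) (∅-sound 3 []) (∅-sound 4 [])
sumsOf-sound ((z ∷ x ∷ y ∷ []) ∷ L) = add-sound z x y (sumsOf-sound L)

-- Bounds for what remains after the seeds: all copies of the three frame points have been taken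
-- out, the greedy choice bounds the rest of their plane, and five equal vectors would have sum
-- zero.
limit : ℕ → ℕ → 𝔽 → 𝔽 → 𝔽 → ℕ
limit m₂ m₃ #0 #0 #0 = 0
limit m₂ m₃ #0 #1 #0 = 0
limit m₂ m₃ #0 #0 #1 = 0
limit m₂ m₃ #0 x #0 = m₂
limit m₂ m₃ #0 x y = m₃
limit m₂ m₃ z x y = 4

pairs : (𝔽 → 𝔽 → ℕ) → List Cand
pairs f = row #0 (row #1 (row #2 (row #3 (row #4 []))))
  where
  row : 𝔽 → List Cand → List Cand
  row x cs = cand x #0 (f x #0) ∷ cand x #1 (f x #1) ∷ cand x #2 (f x #2) ∷ cand x #3 (f x #3) ∷ cand x #4 (f x #4) ∷ cs

seeds : List (W 3) → ℕ → ℕ → ℕ → List (W 3)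
seeds extra m₁ m₂ m₃ = replicate m₁ o ++ (replicate m₂ e₁ ++ (replicate m₃ e₂ ++ extra))

run : List (W 3) → List Profile → ℕ → ℕ → ℕ → Bool
-- 60 is the fuel; if any node exhausted it, the result could not be `true`.
run extra ps m₁ m₂ m₃ = resume 60 (sumsOf c) (tab λ i → cls i c) (refine5 (sumsOf c) (tab λ z → pairs (limit m₂ m₃ z))) ps
  where c = seeds extra m₁ m₂ m₃

pull : ∀ v L → L ↭ replicate (occ v L) v ++ without v L
pull v [] = ↭refl
pull v (u ∷ L) with v ≟ᵂ u
... | yes refl = prep v (pull v L)
... | no _ = ↭-trans (prep u (pull v L)) (↭-sym (shift u (replicate (occ v L) v) (without v L)))

pairs-∈ : ∀ f x y → cand x y (f x y) ∈ pairs f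
pairs-∈ f #0 #0 = here refl
pairs-∈ f #0 #1 = there (here refl)
pairs-∈ f #0 #2 = there (there (here refl))
pairs-∈ f #0 #3 = there (there (there (here refl)))
pairs-∈ f #0 #4 = there (there (there (there (here refl))))
pairs-∈ f #1 y = there (there (there (there (there (second y)))))
  where
  second : ∀ y → cand #1 y (f #1 y) ∈ _
  second #0 = here refl
  second #1 = there (here refl)
  second #2 = there (there (here refl))
  second #3 = there (there (there (here refl)))
  second #4 = there (there (there (there (here refl))))
pairs-∈ f #2 y = there (there (there (there (there (there (there (there (there (there (third y))))))))))
  where
  third : ∀ y → cand #2 y (f #2 y) ∈ _
  third #0 = here refl
  third #1 = there (here refl)
  third #2 = there (there (here refl))
  third #3 = there (there (there (here refl)))
  third #4 = there (there (there (there (here refl))))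
pairs-∈ f #3 y = there (there (there (there (there (there (there (there (there (there (there (there (there (there (there (fourth y)))))))))))))))
  where
  fourth : ∀ y → cand #3 y (f #3 y) ∈ _
  fourth #0 = here refl
  fourth #1 = there (here refl)
  fourth #2 = there (there (here refl))
  fourth #3 = there (there (there (here refl)))
  fourth #4 = there (there (there (there (here refl))))
pairs-∈ f #4 y = there (there (there (there (there (there (there (there (there (there (there (there (there (there (there (there (there (there (there (there (fifth y))))))))))))))))))))
  where
  fifth : ∀ y → cand #4 y (f #4 y) ∈ _
  fifth #0 = here refl
  fifth #1 = there (here refl)
  fifth #2 = there (there (here refl))
  fifth #3 = there (there (there (here refl)))
  fifth #4 = there (there (there (there (here refl))))

occ-≤-limit : ∀ {L} (F : Framed L) (r : List (W 3)) → (∀ v → occ v r ≤ occ v L) → occ o r ≡ 0 → occ e₁ r ≡ 0 → occ e₂ r ≡ 0 →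
  ∀ z x y → occ (z ∷ x ∷ y ∷ []) r ≤ limit (Framed.m₂ F) (Framed.m₃ F) z x y
occ-≤-limit {L} F r ≤L o0 e₁0 e₂0 = go
  where
  open Framed F
  axis : ∀ x → x ≢ #0 → occ (#0 ∷ x ∷ #0 ∷ []) r ≤ m₂
  axis x x≢0 = ≤-trans (≤L _) (on-axis x x≢0)
  off : ∀ x y → y ≢ #0 → occ (#0 ∷ x ∷ y ∷ []) r ≤ m₃
  off x y y≢0 = ≤-trans (≤L _) (off-axis x y y≢0)
  other : ∀ v → occ v r ≤ 4
  other v = ≤-trans (≤L v) (occ-≤4 v L zero-free)
  go : ∀ z x y → occ (z ∷ x ∷ y ∷ []) r ≤ limit m₂ m₃ z x y
  go #0 #0 #0 = ≤-reflexive o0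
  go #0 #1 #0 = ≤-reflexive e₁0
  go #0 #0 #1 = ≤-reflexive e₂0
  go #0 #2 #0 = axis #2 λ ()
  go #0 #3 #0 = axis #3 λ ()
  go #0 #4 #0 = axis #4 λ ()
  go #0 #0 #2 = off _ _ λ ()
  go #0 #0 #3 = off _ _ λ ()
  go #0 #0 #4 = off _ _ λ ()
  go #0 #1 #1 = off _ _ λ ()
  go #0 #1 #2 = off _ _ λ ()
  go #0 #1 #3 = off _ _ λ ()
  go #0 #1 #4 = off _ _ λ ()
  go #0 #2 #1 = off _ _ λ ()
  go #0 #2 #2 = off _ _ λ ()
  go #0 #2 #3 = off _ _ λ ()
  go #0 #2 #4 = off _ _ λ ()
  go #0 #3 #1 = off _ _ λ ()
  go #0 #3 #2 = off _ _ λ ()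
  go #0 #3 #3 = off _ _ λ ()
  go #0 #3 #4 = off _ _ λ ()
  go #0 #4 #1 = off _ _ λ ()
  go #0 #4 #2 = off _ _ λ ()
  go #0 #4 #3 = off _ _ λ ()
  go #0 #4 #4 = off _ _ λ ()
  go #1 x y = other _
  go #2 x y = other _
  go #3 x y = other _
  go #4 x y = other _

-- `extra` lists known elements off the frame: none in the planar case, the point `apex` in space.
-- `split` locates them once all copies of the frame points have been removed.
start : ∀ {L} (F : Framed L) extra → (∀ M → (∀ v → v ≢ o → v ≢ e₁ → v ≢ e₂ → occ v M ≡ occ v L) → ∃ λ r → M ↭ extra ++ r) →
  ∀ ps p → p ∈ ps → (∀ i → look p i ≡ cls i L) → run extra ps (Framed.m₁ F) (Framed.m₂ F) (Framed.m₃ F) ≢ true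
start {L} F extra split ps p p∈ p≡ ran = resume-sound 60 (sumsOf c) (tab λ i → cls i c) (refine5 (sumsOf c) (tab λ z → pairs (limit m₂ m₃ z))) ps ran {c} {r} record
    { good = zs-↭ L↭ zero-free
    ; snd = sumsOf-sound c
    ; sizes = look-tab (λ i → cls i c)
    ; bnd = refine5-bounded {sumsOf c} {c} {r} (tab λ z → pairs (limit m₂ m₃ z)) (sumsOf-sound c) (zs-↭ L↭ zero-free) λ z →
        subst (λ cs → Bounded z cs r) (sym (look-tab (λ z → pairs (limit m₂ m₃ z)) z)) λ x y _ → limit m₂ m₃ z x y , pairs-∈ (limit m₂ m₃ z) x y , occ-≤-limit F r r≤L r-o r-e₁ r-e₂ z x y
    ; profile = p
    ; profile∈ = p∈
    ; profile≡ = λ i → trans (p≡ i) (trans (cls-↭ i L↭) (cls-++ i c r))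
    }
  where
  open Framed F
  c = seeds extra m₁ m₂ m₃
  M₁ = without o L
  M₂ = without e₁ M₁
  M₃ = without e₂ M₂
  M₃≡ : ∀ v → v ≢ o → v ≢ e₁ → v ≢ e₂ → occ v M₃ ≡ occ v L
  M₃≡ v v≢o v≢e₁ v≢e₂ = trans (occ-without e₂ v M₂ v≢e₂) (trans (occ-without e₁ v M₁ v≢e₁) (occ-without o v L v≢o))
  r = proj₁ (split M₃ M₃≡)
  M₃↭ = proj₂ (split M₃ M₃≡)
  without-≤ : ∀ v u K → occ u (without v K) ≤ occ u K
  without-≤ v u K with u ≟ᵂ v
  ... | yes refl = ≤-trans (≤-reflexive (occ-without-≡ v K)) z≤n
  ... | no u≢v = ≤-reflexive (occ-without v u K u≢v)
  r≤M₃ : ∀ v → occ v r ≤ occ v M₃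
  r≤M₃ v = ≤-trans (m≤n+m _ (occ v extra)) (≤-reflexive (sym (trans (occ-↭ v M₃↭) (occ-++ v extra r))))
  r≤L : ∀ v → occ v r ≤ occ v L
  r≤L v = ≤-trans (r≤M₃ v) (≤-trans (without-≤ e₂ v M₂) (≤-trans (without-≤ e₁ v M₁) (without-≤ o v L)))
  r-o : occ o r ≡ 0
  r-o = n≤0⇒n≡0 (≤-trans (r≤M₃ o) (≤-trans (without-≤ e₂ o M₂) (≤-trans (without-≤ e₁ o M₁) (≤-reflexive (occ-without-≡ o L)))))
  r-e₁ : occ e₁ r ≡ 0
  r-e₁ = n≤0⇒n≡0 (≤-trans (r≤M₃ e₁) (≤-trans (without-≤ e₂ e₁ M₂) (≤-reflexive (occ-without-≡ e₁ M₁))))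
  r-e₂ : occ e₂ r ≡ 0
  r-e₂ = n≤0⇒n≡0 (≤-trans (r≤M₃ e₂) (≤-reflexive (occ-without-≡ e₂ M₂)))
  L↭ : L ↭ c ++ r
  L↭ = ↭-trans (pull o L) (↭-trans (↭-reflexive (cong (λ k → replicate k o ++ M₁) occ-o))
    (↭-trans (++⁺ˡ (replicate m₁ o) (↭-trans (pull e₁ M₁) (↭-trans (↭-reflexive (cong (λ k → replicate k e₁ ++ M₂) (trans (occ-without o e₁ L λ ()) occ-e₁)))
      (++⁺ˡ (replicate m₂ e₁) (↭-trans (pull e₂ M₂) (↭-trans (↭-reflexive (cong (λ k → replicate k e₂ ++ M₃) (trans (occ-without e₁ e₂ M₁ λ ()) (trans (occ-without o e₂ L λ ()) occ-e₂))))
        (++⁺ˡ (replicate m₃ e₂) M₃↭)))))))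
    (↭-reflexive (sym (trans (++-assoc (replicate m₁ o) (replicate m₂ e₁ ++ (replicate m₃ e₂ ++ extra)) r)
      (cong (replicate m₁ o ++_) (trans (++-assoc (replicate m₂ e₁) (replicate m₃ e₂ ++ extra) r)
        (cong (replicate m₂ e₁ ++_) (++-assoc (replicate m₃ e₂) extra r)))))))))
  cls-++ : ∀ i K M → cls i (K ++ M) ≡ cls i K + cls i M
  cls-++ i [] M = refl
  cls-++ i (v ∷ K) M = trans (cong (⟦ i ≟ Vec.head v ⟧ +_) (cls-++ i K M)) (sym (+-assoc ⟦ i ≟ Vec.head v ⟧ _ _))

upTo : ℕ → (ℕ → Bool) → Bool
upTo zero p = true
upTo (suc n) p = p (suc n) ∧ upTo n p

upTo-sound : ∀ n p → upTo n p ≡ true → ∀ k → 1 ≤ k → k ≤ n → p k ≡ true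
upTo-sound (suc n) p e k 1≤k k≤ with k ℕ.≟ suc n
... | yes refl = proj₁ (∧-both e)
... | no k≢ = upTo-sound n p (proj₂ (∧-both e)) k 1≤k (≤-pred (≤∧≢⇒< k≤ k≢))
upTo-sound zero p e zero () k≤

runs : List (W 3) → List Profile → Bool
runs extra ps = upTo 4 λ m₁ → upTo m₁ λ m₂ → upTo m₂ λ m₃ → run extra ps m₁ m₂ m₃

runs-sound : ∀ extra ps → runs extra ps ≡ true → ∀ {L} (F : Framed L) → run extra ps (Framed.m₁ F) (Framed.m₂ F) (Framed.m₃ F) ≡ true
runs-sound extra ps e F = upTo-sound m₂ (λ m₃ → run extra ps m₁ m₂ m₃) (upTo-sound m₁ (λ m₂ → upTo m₂ λ m₃ → run extra ps m₁ m₂ m₃)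
  (upTo-sound 4 (λ m₁ → upTo m₁ λ m₂ → upTo m₂ λ m₃ → run extra ps m₁ m₂ m₃) e m₁ (≤-trans 1≤m₃ (≤-trans m₃≤m₂ m₂≤m₁)) m₁≤4) m₂ (≤-trans 1≤m₃ m₃≤m₂) m₂≤m₁) m₃ 1≤m₃ m₃≤m₂
  where open Framed F

-- The plane is embedded as the class z = 0 of the space, so the only profile has all elements in
-- that class.
bounds₂ : Bounds 2 17
bounds₂ L len good = no-frame (frame M good-M (≤-trans (s≤s (s≤s (s≤s (s≤s (s≤s (s≤s (s≤s (s≤s (s≤s z≤n))))))))) (≤-reflexive (sym (trans (cls-M #0 L) (trans (*-identityʳ _) len))))))
  where
  M = map (#0 ∷_) L
  good-M : Good M
  good-M = ≤-Good {L = M} {M = L} (cnt-map _⊞_ _⊞_ zero? zero? (#0 ∷_) (λ k b a → b ≡ #0 ∷ a) (λ _ → ℕ) (All.universal (λ _ → 0) L)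
    (λ { _ refl → refl }) (λ { {a = a} refl → ⟦⟧-mono ((#0 ∷ a) ≟ᵂ 𝟎) (a ≟ᵂ 𝟎) Vec.∷-injectiveʳ }) 5 refl) good
  cls-M : ∀ i (L : List (W 2)) → cls i (map (#0 ∷_) L) ≡ length L * ⟦ i ≟ #0 ⟧
  cls-M i [] = refl
  cls-M i (v ∷ L) = cong (⟦ i ≟ #0 ⟧ +_) (cls-M i L)
  p : Profile
  p = five 17 0 0 0 0
  p≡ : ∀ i → look p i ≡ 17 * ⟦ i ≟ #0 ⟧
  p≡ = from-yes (∀? λ i → look p i ℕ.≟ 17 * ⟦ i ≟ #0 ⟧)
  no-frame : ¬ (∃ λ K → Framed K × (∀ i → cls i K ≡ cls i M))
  no-frame (K , F , same) = start F [] (λ N _ → N , ↭refl) (p ∷ []) p (here refl)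
    (λ i → trans (p≡ i) (sym (trans (same i) (trans (cls-M i L) (cong (_* ⟦ i ≟ #0 ⟧) len))))) (runs-sound [] (p ∷ []) refl F)

-- Up to affine substitutions of the classes, all profiles of size 37 with parts at most 16 for which
-- 31 N 5 #0 ≤ 6 (37 C 5), normalised so that the first class is large and the last one is not empty.
critical : List Profile
critical =
  five 12 12 6 0 7 ∷ five 13 11 6 0 7 ∷ five 13 11 7 0 6 ∷ five 13 11 8 0 5 ∷ five 13 12 5 0 7 ∷ five 13 12 5 1 6 ∷
  five 13 12 6 0 6 ∷ five 13 12 6 1 5 ∷ five 13 12 7 0 5 ∷ five 13 13 5 1 5 ∷ five 13 13 4 2 5 ∷ five 13 13 5 0 6 ∷
  five 13 13 4 1 6 ∷ five 13 13 4 0 7 ∷ five 14 10 7 0 6 ∷ five 14 10 8 0 5 ∷ five 14 11 6 0 6 ∷ five 14 11 6 1 5 ∷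
  five 14 11 7 0 5 ∷ five 14 11 7 1 4 ∷ five 14 11 8 0 4 ∷ five 14 12 4 0 7 ∷ five 14 12 4 1 6 ∷ five 14 12 5 0 6 ∷
  five 14 12 5 1 5 ∷ five 14 12 5 2 4 ∷ five 14 12 6 0 5 ∷ five 14 12 6 1 4 ∷ five 14 12 6 2 3 ∷ five 14 12 7 0 4 ∷
  five 14 12 7 1 3 ∷ five 14 12 8 0 3 ∷ five 14 13 3 0 7 ∷ five 14 13 3 1 6 ∷ five 14 13 3 2 5 ∷ five 14 13 3 3 4 ∷
  five 14 13 4 0 6 ∷ five 14 13 4 1 5 ∷ five 14 13 4 2 4 ∷ five 14 13 4 3 3 ∷ five 14 13 5 0 5 ∷ five 14 13 5 1 4 ∷
  five 14 13 5 2 3 ∷ five 14 13 6 0 4 ∷ five 14 13 6 1 3 ∷ five 14 13 7 0 3 ∷ five 14 14 3 3 3 ∷ five 14 14 4 1 4 ∷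
  five 14 14 3 2 4 ∷ five 14 14 2 3 4 ∷ five 14 14 4 0 5 ∷ five 14 14 3 1 5 ∷ five 14 14 2 2 5 ∷ five 14 14 3 0 6 ∷
  five 14 14 2 1 6 ∷ five 14 14 2 0 7 ∷ five 15 9 8 0 5 ∷ five 15 10 6 0 6 ∷ five 15 10 6 1 5 ∷ five 15 10 7 0 5 ∷
  five 15 10 7 1 4 ∷ five 15 10 8 0 4 ∷ five 15 11 5 0 6 ∷ five 15 11 5 1 5 ∷ five 15 11 5 2 4 ∷ five 15 11 6 0 5 ∷
  five 15 11 6 1 4 ∷ five 15 11 6 2 3 ∷ five 15 11 7 0 4 ∷ five 15 11 7 1 3 ∷ five 15 11 8 0 3 ∷ five 15 12 4 0 6 ∷
  five 15 12 4 1 5 ∷ five 15 12 4 2 4 ∷ five 15 12 4 3 3 ∷ five 15 12 5 0 5 ∷ five 15 12 5 1 4 ∷ five 15 12 5 2 3 ∷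
  five 15 12 5 3 2 ∷ five 15 12 6 0 4 ∷ five 15 12 6 1 3 ∷ five 15 12 6 2 2 ∷ five 15 12 7 0 3 ∷ five 15 12 7 1 2 ∷
  five 15 12 8 0 2 ∷ five 15 13 2 2 5 ∷ five 15 13 3 0 6 ∷ five 15 13 3 1 5 ∷ five 15 13 3 2 4 ∷ five 15 13 3 3 3 ∷
  five 15 13 3 4 2 ∷ five 15 13 4 0 5 ∷ five 15 13 4 1 4 ∷ five 15 13 4 2 3 ∷ five 15 13 4 3 2 ∷ five 15 13 5 0 4 ∷
  five 15 13 5 1 3 ∷ five 15 13 5 2 2 ∷ five 15 13 5 3 1 ∷ five 15 13 6 0 3 ∷ five 15 13 6 1 2 ∷ five 15 13 6 2 1 ∷
  five 15 13 7 0 2 ∷ five 15 14 1 2 5 ∷ five 15 14 1 3 4 ∷ five 15 14 2 0 6 ∷ five 15 14 2 1 5 ∷ five 15 14 2 2 4 ∷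
  five 15 14 2 3 3 ∷ five 15 14 2 4 2 ∷ five 15 14 3 0 5 ∷ five 15 14 3 1 4 ∷ five 15 14 3 2 3 ∷ five 15 14 3 3 2 ∷
  five 15 14 3 4 1 ∷ five 15 14 4 0 4 ∷ five 15 14 4 1 3 ∷ five 15 14 4 2 2 ∷ five 15 14 4 3 1 ∷ five 15 14 5 0 3 ∷
  five 15 14 5 1 2 ∷ five 15 14 5 2 1 ∷ five 15 14 6 0 2 ∷ five 15 14 6 1 1 ∷ five 15 14 7 0 1 ∷ five 15 15 2 3 2 ∷
  five 15 15 1 4 2 ∷ five 15 15 3 1 3 ∷ five 15 15 2 2 3 ∷ five 15 15 1 3 3 ∷ five 15 15 0 4 3 ∷ five 15 15 3 0 4 ∷
  five 15 15 2 1 4 ∷ five 15 15 1 2 4 ∷ five 15 15 0 3 4 ∷ five 15 15 2 0 5 ∷ five 15 15 1 1 5 ∷ five 15 15 0 2 5 ∷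
  five 15 15 1 0 6 ∷ five 16 8 8 0 5 ∷ five 16 8 9 0 4 ∷ five 16 9 7 0 5 ∷ five 16 9 7 1 4 ∷ five 16 9 8 0 4 ∷ five 16 9 8 1 3 ∷
  five 16 9 9 0 3 ∷ five 16 10 5 0 6 ∷ five 16 10 5 1 5 ∷ five 16 10 5 2 4 ∷ five 16 10 6 0 5 ∷ five 16 10 6 1 4 ∷
  five 16 10 6 2 3 ∷ five 16 10 7 0 4 ∷ five 16 10 7 1 3 ∷ five 16 10 7 2 2 ∷ five 16 10 8 0 3 ∷ five 16 10 8 1 2 ∷
  five 16 10 9 0 2 ∷ five 16 11 4 0 6 ∷ five 16 11 4 1 5 ∷ five 16 11 4 2 4 ∷ five 16 11 4 3 3 ∷ five 16 11 5 0 5 ∷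
  five 16 11 5 1 4 ∷ five 16 11 5 2 3 ∷ five 16 11 5 3 2 ∷ five 16 11 6 0 4 ∷ five 16 11 6 1 3 ∷ five 16 11 6 2 2 ∷
  five 16 11 6 3 1 ∷ five 16 11 7 0 3 ∷ five 16 11 7 1 2 ∷ five 16 11 8 0 2 ∷ five 16 12 3 0 6 ∷ five 16 12 3 1 5 ∷
  five 16 12 3 2 4 ∷ five 16 12 3 3 3 ∷ five 16 12 3 4 2 ∷ five 16 12 4 0 5 ∷ five 16 12 4 1 4 ∷ five 16 12 4 2 3 ∷
  five 16 12 4 3 2 ∷ five 16 12 4 4 1 ∷ five 16 12 5 0 4 ∷ five 16 12 5 1 3 ∷ five 16 12 5 2 2 ∷ five 16 12 5 3 1 ∷
  five 12 16 0 4 5 ∷ five 16 12 6 0 3 ∷ five 16 12 6 1 2 ∷ five 16 12 6 2 1 ∷ five 16 12 7 0 2 ∷ five 16 12 7 1 1 ∷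
  five 16 12 8 0 1 ∷ five 16 13 2 0 6 ∷ five 16 13 2 1 5 ∷ five 16 13 2 2 4 ∷ five 16 13 2 3 3 ∷ five 16 13 2 4 2 ∷
  five 16 13 3 0 5 ∷ five 16 13 3 1 4 ∷ five 16 13 3 2 3 ∷ five 16 13 3 3 2 ∷ five 16 13 3 4 1 ∷ five 13 16 0 5 3 ∷
  five 16 13 4 0 4 ∷ five 16 13 4 1 3 ∷ five 16 13 4 2 2 ∷ five 16 13 4 3 1 ∷ five 13 16 0 4 4 ∷ five 16 13 5 0 3 ∷
  five 16 13 5 1 2 ∷ five 16 13 5 2 1 ∷ five 13 16 0 3 5 ∷ five 16 13 6 0 2 ∷ five 16 13 6 1 1 ∷ five 13 16 0 2 6 ∷
  five 16 13 7 0 1 ∷ five 13 16 0 1 7 ∷ five 16 14 1 0 6 ∷ five 16 14 1 1 5 ∷ five 16 14 1 2 4 ∷ five 16 14 1 3 3 ∷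
  five 16 14 1 4 2 ∷ five 16 14 2 0 5 ∷ five 16 14 2 1 4 ∷ five 16 14 2 2 3 ∷ five 16 14 2 3 2 ∷ five 16 14 2 4 1 ∷
  five 14 16 0 5 2 ∷ five 16 14 3 0 4 ∷ five 16 14 3 1 3 ∷ five 16 14 3 2 2 ∷ five 16 14 3 3 1 ∷ five 14 16 0 4 3 ∷
  five 16 14 4 0 3 ∷ five 16 14 4 1 2 ∷ five 16 14 4 2 1 ∷ five 14 16 0 3 4 ∷ five 16 14 5 0 2 ∷ five 16 14 5 1 1 ∷
  five 14 16 0 2 5 ∷ five 16 14 6 0 1 ∷ five 14 16 0 1 6 ∷ five 14 16 0 0 7 ∷ five 16 15 0 0 6 ∷ five 16 15 0 1 5 ∷
  five 16 15 0 2 4 ∷ five 16 15 0 3 3 ∷ five 16 15 0 4 2 ∷ five 16 15 1 0 5 ∷ five 16 15 1 1 4 ∷ five 16 15 1 2 3 ∷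
  five 16 15 1 3 2 ∷ five 16 15 1 4 1 ∷ five 15 16 0 5 1 ∷ five 16 15 2 0 4 ∷ five 16 15 2 1 3 ∷ five 16 15 2 2 2 ∷
  five 16 15 2 3 1 ∷ five 15 16 0 4 2 ∷ five 16 15 3 0 3 ∷ five 16 15 3 1 2 ∷ five 16 15 3 2 1 ∷ five 15 16 0 3 3 ∷
  five 16 15 4 0 2 ∷ five 16 15 4 1 1 ∷ five 15 16 0 2 4 ∷ five 16 15 5 0 1 ∷ five 15 16 0 1 5 ∷ five 15 16 0 0 6 ∷
  five 16 0 0 16 5 ∷ five 16 16 1 3 1 ∷ five 16 16 0 4 1 ∷ five 16 16 2 1 2 ∷ five 16 16 1 2 2 ∷ five 16 16 0 3 2 ∷
  five 16 16 2 0 3 ∷ five 16 16 1 1 3 ∷ five 16 16 0 2 3 ∷ five 16 16 1 0 4 ∷ five 16 16 0 1 4 ∷ five 16 16 0 0 5 ∷ []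

-- Normalisation of profiles

equal : Profile → Profile → Bool
equal (five a b c d e) (five a′ b′ c′ d′ e′) = (a ≡ᵇ a′) ∧ ((b ≡ᵇ b′) ∧ ((c ≡ᵇ c′) ∧ ((d ≡ᵇ d′) ∧ (e ≡ᵇ e′))))

equal-sound : ∀ p q → equal p q ≡ true → p ≡ q
equal-sound (five a b c d e) (five a′ b′ c′ d′ e′) h with ∧-both h
... | h₀ , h with ∧-both h
...   | h₁ , h with ∧-both h
...     | h₂ , h with ∧-both h
...       | h₃ , h₄ = cong₅ (eq a a′ h₀) (eq b b′ h₁) (eq c c′ h₂) (eq d d′ h₃) (eq e e′ h₄)
  where
  eq : ∀ m n → (m ≡ᵇ n) ≡ true → m ≡ n
  eq m n h = ≡ᵇ⇒≡ m n (subst T (sym h) tt)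
  cong₅ : ∀ {a b c d e a′ b′ c′ d′ e′} → a ≡ a′ → b ≡ b′ → c ≡ c′ → d ≡ d′ → e ≡ e′ → five a b c d e ≡ five a′ b′ c′ d′ e′
  cong₅ refl refl refl refl refl = refl

member : Profile → List Profile → Bool
member p [] = false
member p (q ∷ qs) = if equal p q then true else member p qs

member-sound : ∀ p qs → member p qs ≡ true → p ∈ qs
member-sound p (q ∷ qs) h with equal p q in eq
... | true = here (equal-sound p q eq)
... | false = there (member-sound p qs h)

-- The profile after the substitution x ↦ c x + d
image : 𝔽 → 𝔽 → Profile → Profile
image c d p = tab λ j → look p (inv c · (j ⊹ neg d))

some𝔽 : (𝔽 → Bool) → Bool
some𝔽 p = if p #0 then true else if p #1 then true else if p #2 then true else if p #3 then true else p #4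

some𝔽-sound : ∀ p → some𝔽 p ≡ true → ∃ λ a → p a ≡ true
some𝔽-sound p e with p #0 in e₀
... | true = #0 , e₀
... | false with p #1 in e₁
...   | true = #1 , e₁
...   | false with p #2 in e₂
...     | true = #2 , e₂
...     | false with p #3 in e₃
...       | true = #3 , e₃
...       | false = #4 , e

-- The two comparisons only save time.
quick : Profile → Bool
quick p@(five a _ _ _ e) = if a <ᵇ 12 then false else if e ≡ᵇ 0 then false else member p critical

isUnit : 𝔽 → Bool
isUnit #0 = false
isUnit _ = true

-- Rescaling the functional and translating the list change the class labels by x ↦ c x + d with c ≠
-- 0; one critical image is enough.
normalisable : Profile → Bool
normalisable p = some𝔽 λ d → some𝔽 λ c → isUnit c ∧ quick (image c d p)

if-true : ∀ b {x} → (if b then false else x) ≡ true → x ≡ true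
if-true false h = h

quick-sound : ∀ p → quick p ≡ true → p ∈ critical
quick-sound p@(five a _ _ _ e) h = member-sound p critical (if-true (e ≡ᵇ 0) (if-true (a <ᵇ 12) h))

normalisable-sound : ∀ p → normalisable p ≡ true → ∃ λ c → ∃ λ d → c ≢ #0 × image c d p ∈ critical
normalisable-sound p h = outer (some𝔽-sound (λ d → some𝔽 λ c → isUnit c ∧ quick (image c d p)) h)
  where
  unit : ∀ c → isUnit c ≡ true → c ≢ #0
  unit .#0 () refl
  inner : ∀ d → (∃ λ c → isUnit c ∧ quick (image c d p) ≡ true) → ∃ λ c → ∃ λ d → c ≢ #0 × image c d p ∈ critical
  inner d (c , h) = c , d , unit c (proj₁ (∧-both {isUnit c} h)) , quick-sound (image c d p) (proj₂ (∧-both {isUnit c} h))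
  outer : (∃ λ d → some𝔽 (λ c → isUnit c ∧ quick (image c d p)) ≡ true) → ∃ λ c → ∃ λ d → c ≢ #0 × image c d p ∈ critical
  outer (d , h) = inner d (some𝔽-sound (λ c → isUnit c ∧ quick (image c d p)) h)

-- Used with t = 6 (37 C 5).
unbalanced : ℕ → Profile → ℕ → Bool
unbalanced t p z = if t <ᵇ 31 * z then true else normalisable p

-- A translation of labels makes class 0 the largest, so the other sizes only run up to a₀; the
-- planar bound gives the limit 16. The threshold comes from (5^3 - 1) Z ≤ (5^2 - 1) C(37, 5),
-- divided by four.
scan₃ : scan 16 (λ a → a) 37 (unbalanced 2615382) ≡ true
scan₃ = refl

-- Nine elements in class 0 are needed for a frame, one in class 4 for `apex`.
critical-large : All (λ p → 9 ≤ look p #0 × 1 ≤ look p #4) critical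
critical-large = from-yes (All.all? (λ p → (9 ≤? look p #0) ×-dec (1 ≤? look p #4)) critical)

-- The linear part makes the functional w the first coordinate.
module Adapted (w : W 3) (w≢𝟎 : w ≢ 𝟎) (c d m : 𝔽) (c≢0 : c ≢ #0) where

  A : W 3 → W 3
  A v = c · dot w v ∷ forget w v

  b : W 3
  b = c · m ⊹ d ∷ 𝟎

  adapt : W 3 → W 3
  adapt v = A v ⊞ b

  adapt-good : ∀ L → Good L → Good (map adapt L)
  adapt-good = affine-good A b
    (λ u v → cong₂ _∷_ (trans (cong (c ·_) (dot-⊞ w u v)) (·-distribˡ c (dot w u) (dot w v))) (forget-⊞ w u v))
    (cong₂ _∷_ (trans (cong (c ·_) (dot-𝟎ʳ w)) (·-zeroʳ c)) (forget-𝟎 w))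
    (λ v e → forget-kernel w v w≢𝟎 (Vec.∷-injectiveʳ e) (cancel c (dot w v) c≢0 (Vec.∷-injectiveˡ e)))
    where
    cancel : ∀ c x → c ≢ #0 → c · x ≡ #0 → x ≡ #0
    cancel = from-yes (∀? λ c → ∀? λ x → ¬? (c ≟ #0) →-dec ((c · x ≟ #0) →-dec (x ≟ #0)))

  adapt-profile : ∀ L i → look (image c d (counts (map (_⊹ m) (map (dot w) L)))) i ≡ cls i (map adapt L)
  adapt-profile L i = trans (look-tab (λ j → look (counts (map (_⊹ m) (map (dot w) L))) (inv c · (j ⊹ neg d))) i)
      (trans (look-tab (λ j → occ𝔽 j (map (_⊹ m) (map (dot w) L))) (inv c · (i ⊹ neg d))) (go L))
    where
    solve : ∀ c → c ≢ #0 → ∀ d i x → ⟦ inv c · (i ⊹ neg d) ≟ x ⟧ ≡ ⟦ i ≟ c · x ⊹ d ⟧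
    solve = from-yes (∀? λ c → ¬? (c ≟ #0) →-dec (∀? λ d → ∀? λ i → ∀? λ x → ⟦ inv c · (i ⊹ neg d) ≟ x ⟧ ℕ.≟ ⟦ i ≟ c · x ⊹ d ⟧))
    distribute : ∀ x → c · (x ⊹ m) ⊹ d ≡ c · x ⊹ (c · m ⊹ d)
    distribute x = trans (cong (_⊹ d) (·-distribˡ c x m)) (⊹-assoc (c · x) (c · m) d)
    go : ∀ L → occ𝔽 (inv c · (i ⊹ neg d)) (map (_⊹ m) (map (dot w) L)) ≡ cls i (map adapt L)
    go [] = refl
    go (v ∷ L) = cong₂ _+_ (trans (solve c c≢0 d i (dot w v ⊹ m)) (cong (λ q → ⟦ i ≟ q ⟧) (distribute (dot w v)))) (go L)

-- Each sum of five elements changes by 5s = 0.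
N-shift : ∀ s xs → N 5 #0 (map (_⊹ s) xs) ≤ N 5 #0 xs
N-shift s xs = ≤-trans (≤-reflexive (N-cnt 5 (map (_⊹ s) xs) #0)) (≤-trans
    (cnt-map _⊹_ _⊹_ null null (_⊹ s) (λ k b a → b ⊹ times k s ≡ a) (λ _ → ℕ) (All.universal (λ _ → 0) xs)
      (λ { {k} {b} {x = x} _ refl → exchange b x s (times k s) })
      (λ { {b} refl → ⟦⟧-mono (b ≟ #0) (b ⊹ #0 ≟ #0) λ { refl → refl } }) 5 (from-yes (∀? λ s → times 5 s ≟ #0) s))
    (≤-reflexive (sym (N-cnt 5 xs #0))))
  where
  exchange : ∀ b x s q → (b ⊹ (x ⊹ s)) ⊹ q ≡ (b ⊹ (s ⊹ q)) ⊹ x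
  exchange = from-yes (∀? λ b → ∀? λ x → ∀? λ s → ∀? λ q → (b ⊹ (x ⊹ s)) ⊹ q ≟ (b ⊹ (s ⊹ q)) ⊹ x)

occ-shift : ∀ s i xs → occ𝔽 i (map (_⊹ s) xs) ≡ occ𝔽 (i ⊹ neg s) xs
occ-shift s i [] = refl
occ-shift s i (x ∷ xs) = cong₂ _+_ (from-yes (∀? λ s → ∀? λ i → ∀? λ x → ⟦ i ≟ x ⊹ s ⟧ ℕ.≟ ⟦ i ⊹ neg s ≟ x ⟧) s i x) (occ-shift s i xs)

class-member : ∀ z L → 0 < cls z L → ∃ λ x → ∃ λ y → 0 < occ (z ∷ x ∷ y ∷ []) L
class-member z ((z′ ∷ x ∷ y ∷ []) ∷ L) pos = decide (z ≟ z′)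
  where
  later : (∃ λ x → ∃ λ y → 0 < occ (z ∷ x ∷ y ∷ []) L) → ∃ λ x′ → ∃ λ y′ → 0 < occ (z ∷ x′ ∷ y′ ∷ []) ((z′ ∷ x ∷ y ∷ []) ∷ L)
  later (x′ , y′ , pos′) = x′ , y′ , ≤-trans pos′ (m≤n+m _ _)
  decide : Dec (z ≡ z′) → ∃ λ x′ → ∃ λ y′ → 0 < occ (z ∷ x′ ∷ y′ ∷ []) ((z′ ∷ x ∷ y ∷ []) ∷ L)
  decide (yes refl) = x , y , occ-self (z ∷ x ∷ y ∷ []) L
  decide (no z≢z′) = later (class-member z L (≤-trans pos (≤-reflexive (cong (_+ cls z L) (⟦⟧-no (z ≟ z′) z≢z′)))))

apex : W 3
apex = #4 ∷ #0 ∷ #0 ∷ []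

-- A shear along z fixes the plane of the frame pointwise. As 4 = -1, the one with parameters a, b
-- takes (4, a, b) to `apex`, so a point of class 4 is normalised without disturbing the frame.
shear-framed : ∀ a b {L} → Framed L → Framed (map (Shear.φ a b) L)
shear-framed a b {L} F = record
    { zero-free = S.φ-good L zero-free ; m₁ = m₁ ; m₂ = m₂ ; m₃ = m₃ ; 1≤m₃ = 1≤m₃ ; m₃≤m₂ = m₃≤m₂ ; m₂≤m₁ = m₂≤m₁ ; m₁≤4 = m₁≤4
    ; occ-o = trans (same #0 #0) occ-o ; occ-e₁ = trans (same #1 #0) occ-e₁ ; occ-e₂ = trans (same #0 #1) occ-e₂
    ; on-axis = λ x x≢0 → ≤-trans (≤-reflexive (same x #0)) (on-axis x x≢0)
    ; off-axis = λ x y y≢0 → ≤-trans (≤-reflexive (same x y)) (off-axis x y y≢0) }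
  where
  open Framed F
  module S = Shear a b
  fixed : ∀ x y → S.φ (#0 ∷ x ∷ y ∷ []) ≡ #0 ∷ x ∷ y ∷ []
  fixed = from-yes (∀? λ a → ∀? λ b → ∀? λ x → ∀? λ y → affine (#1 , #0 , a , #0) (#0 , #1 , b , #0) (#0 ∷ x ∷ y ∷ []) ≟ᵂ (#0 ∷ x ∷ y ∷ [])) a b
  same : ∀ x y → occ (#0 ∷ x ∷ y ∷ []) (map S.φ L) ≡ occ (#0 ∷ x ∷ y ∷ []) L
  same x y = trans (cong (λ v → occ v (map S.φ L)) (sym (fixed x y))) (S.occ-φ (#0 ∷ x ∷ y ∷ []) L)

not-critical : runs (apex ∷ []) critical ≡ true → ∀ L → Good L → ∀ p → p ∈ critical → (∀ i → look p i ≡ cls i L) → ⊥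
not-critical ran L good p p∈ p≡ = go (frame L good (≤-trans (proj₁ large) (≤-reflexive (p≡ #0))))
  where
  large = All.lookup critical-large p∈
  go : ¬ (∃ λ M → Framed M × (∀ i → cls i M ≡ cls i L))
  go (M , F , same) with class-member #4 M (≤-trans (proj₂ large) (≤-reflexive (trans (p≡ #4) (sym (same #4)))))
  ... | a , b , pos = start (shear-framed a b F) (apex ∷ []) split critical p p∈
          (λ i → trans (p≡ i) (trans (sym (same i)) (sym (S.cls-φ i M)))) (runs-sound (apex ∷ []) critical ran (shear-framed a b F))
    where
    module S = Shear a b
    moved : S.φ (#4 ∷ a ∷ b ∷ []) ≡ apex
    moved = from-yes (∀? λ a → ∀? λ b → affine (#1 , #0 , a , #0) (#0 , #1 , b , #0) (#4 ∷ a ∷ b ∷ []) ≟ᵂ apex) a b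
    present : 0 < occ apex (map S.φ M)
    present = ≤-trans pos (≤-reflexive (trans (sym (S.occ-φ (#4 ∷ a ∷ b ∷ []) M)) (cong (λ v → occ v (map S.φ M)) moved)))
    split : ∀ K → (∀ v → v ≢ o → v ≢ e₁ → v ≢ e₂ → occ v K ≡ occ v (map S.φ M)) → ∃ λ r → K ↭ (apex ∷ []) ++ r
    split K same′ = find apex K (≤-trans present (≤-reflexive (sym (same′ apex (λ ()) (λ ()) (λ ())))))

if-false : ∀ {b x} → b ≡ false → (if b then true else x) ≡ true → x ≡ true
if-false refl h = h

unbalanced-elim : ∀ t p z → 31 * z ≤ t → unbalanced t p z ≡ true → normalisable p ≡ true
unbalanced-elim t p z le h = if-false (≤⇒≮ᵇ le) h

-- The threshold and the two evaluations are parameters, so that the argument treats them as opaque.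
module Direction (t : ℕ) (scanned : scan 16 (λ a → a) 37 (unbalanced t) ≡ true) (ran : runs (apex ∷ []) critical ≡ true) where

  no-critical-direction : ∀ L → length L ≡ 37 → Good L → ∀ w → w ≢ 𝟎 → t < 31 * Z w L
  no-critical-direction L len good w w≢𝟎 = ≰⇒> λ le → go le (argmax (λ i → occ𝔽 i (map (dot w) L)))
    where
    xs = map (dot w) L
    go : 31 * Z w L ≤ t → ¬ (∃ λ m → ∀ i → occ𝔽 i xs ≤ occ𝔽 m xs)
    go le (m , max) = finish (normalisable-sound (counts ys) (unbalanced-elim t (counts ys) (N 5 #0 ys) (≤-trans (*-monoʳ-≤ 31 (N-shift (neg m) xs)) le)
        (scan-sound 16 (λ a → a) 37 (unbalanced t) scanned ys (trans (length-map (_⊹ neg m) xs) (trans (length-map (dot w) L) len))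
          (≤-trans (≤-reflexive top) (hyperplane bounds₂ w w≢𝟎 L good m))
          λ i → ≤-trans (≤-reflexive (occ-shift (neg m) i xs)) (≤-trans (max (i ⊹ neg (neg m))) (≤-reflexive (sym top))))))
      where
      ys = map (_⊹ neg m) xs
      top : occ𝔽 #0 ys ≡ occ𝔽 m xs
      top = trans (occ-shift (neg m) #0 xs) (cong (λ j → occ𝔽 j xs) (from-yes (∀? λ m → neg (neg m) ≟ m) m))
      finish : ¬ (∃ λ c → ∃ λ d → c ≢ #0 × image c d (counts ys) ∈ critical)
      finish (c , d , c≢0 , p∈) = not-critical ran (map A.adapt L) (A.adapt-good L good) (image c d (counts ys)) p∈ (A.adapt-profile L)
        where module A = Adapted w w≢𝟎 c d (neg m) c≢0

  conclusion : ∀ e → suc t + e ≤ 31 * (37 C 5) + 0 → 31 * (25 * (37 C 5)) + 125 * 0 < 125 * suc t + e → Bounds 3 37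
  conclusion e at𝟎 numbers L len good = <⇒≱ numbers (subst (λ n → 125 * suc t + e ≤ 31 * (25 * (n C 5)) + 125 * 0) len
    (averaging L good 31 0 (suc t) e (λ w w≢𝟎 → ≤-trans (no-critical-direction L len good w w≢𝟎) (m≤m+n _ 0)) (subst (λ n → suc t + e ≤ 31 * (n C 5) + 0) (sym len) at𝟎)))

bounds₃-from : runs (apex ∷ []) critical ≡ true → Bounds 3 37
-- 10897424 = 31 C(37, 5) - (t + 1) is the surplus of the zero functional. The averaged inequality
-- would then put 125 (t + 1) + 10897424 = 337820299 below 775 C(37, 5) = 337820175.
bounds₃-from ran = Direction.conclusion 2615382 scan₃ ran 10897424 (≤ᵇ⇒≤ 13512807 13512807 tt) (<ᵇ⇒< 337820175 337820299 tt)

-- Dimensions four to six, and the lower bound in dimension three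

bounds₄ : Bounds 3 37 → Bounds 4 157
bounds₄ bound = ascend bound (≤ᵇ⇒≤ 157 180 tt) (<ᵇ⇒< (625 * multi 23 5) (157 C 5) tt)

bounds₅ : Bounds 4 157 → Bounds 5 690
bounds₅ bound = ascend bound (≤ᵇ⇒≤ 690 780 tt) (<ᵇ⇒< (3125 * multi 90 5) (690 C 5) tt)

bounds₆ : Bounds 5 690 → Bounds 6 3091
bounds₆ bound = ascend bound (≤ᵇ⇒≤ 3091 3445 tt) (<ᵇ⇒< (15625 * multi 354 5) (3091 C 5) tt)

-- Nine points, each repeated four times, the shape of Elsholtz's lower bound 9 (n - 1) + 1 for odd
-- n. Being free of zero sums is a matter of evaluation.
extremal : Fin 36 → Z5^ 3
extremal i = Vec.lookup points (Fin.quotient {9} 4 i)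
  where
  n0 n1 n2 : Fin 5
  n0 = fzero
  n1 = fsuc fzero
  n2 = fsuc (fsuc fzero)
  points : Vec (Z5^ 3) 9
  points = (n0 ∷ n0 ∷ n0 ∷ []) ∷ (n1 ∷ n0 ∷ n0 ∷ []) ∷ (n0 ∷ n1 ∷ n0 ∷ []) ∷ (n0 ∷ n0 ∷ n1 ∷ []) ∷ (n0 ∷ n1 ∷ n1 ∷ []) ∷
    (n1 ∷ n0 ∷ n1 ∷ []) ∷ (n1 ∷ n1 ∷ n2 ∷ []) ∷ (n1 ∷ n2 ∷ n2 ∷ []) ∷ (n2 ∷ n1 ∷ n2 ∷ []) ∷ []

extremal-good : Good (seq extremal)
extremal-good = refl

lower₃ : ∀ k → Forces 3 5 k → 37 ≤ k
-- A shorter sequence is an initial segment of `extremal`, and `inject≤` carries a zero-sum choice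
-- over to the whole.
lower₃ k forces = ≰⇒> λ k≤36 → let (ι , inc , e) = forces (λ i → extremal (Fin.inject≤ i k≤36)) in
  zeroSum⇒¬Good extremal ((λ i → Fin.inject≤ (ι i) k≤36) , (λ i j lt → subst₂ _<_ (sym (Fin.toℕ-inject≤ (ι i) k≤36)) (sym (Fin.toℕ-inject≤ (ι j) k≤36)) (inc i j lt)) , e) extremal-good

-- The least m with Forces d 5 m exists because Forces is decidable.

Searchable : Set → Set₁
Searchable A = ∀ {P : A → Set} → (∀ a → Dec (P a)) → Dec (∀ a → P a)

search-Vec : ∀ {A : Set} → Searchable A → ∀ n → Searchable (Vec A n)
search-Vec all? zero P? = map′ (λ { p [] → p }) (λ f → f []) (P? [])
search-Vec all? (suc n) P? = map′ (λ { f (a ∷ v) → f a v }) (λ f a v → f (a ∷ v)) (all? λ a → search-Vec all? n λ v → P? (a ∷ v))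

zeroSum? : ∀ {d k} (g : Fin k → Z5^ d) → Dec (HasZeroSumSubseq 5 g)
zeroSum? g with zs (seq g) ℕ.≟ 0
... | yes good = no λ h → zeroSum⇒¬Good g h good
... | no ¬good = yes (¬Good⇒zeroSum g ¬good)

-- Sequences are enumerated as vectors. A function agrees with the lookup in its tabulation only
-- pointwise, which `transfer` accounts for.
forces? : ∀ d k → Dec (Forces d 5 k)
forces? d k = map′ (λ h g → transfer g (h (Vec.tabulate g))) (λ h v → h (Vec.lookup v)) (search-Vec (search-Vec Fin.all? d) k (λ v → zeroSum? (Vec.lookup v)))
  where
  transfer : ∀ g → HasZeroSumSubseq 5 (Vec.lookup (Vec.tabulate g)) → HasZeroSumSubseq 5 g
  transfer g (ι , inc , e) = ι , inc , trans (Σᴳ-cong 5 λ i → sym (Vec.lookup∘tabulate g (ι i))) e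

least-witness : ∀ {P : ℕ → Set} → (∀ n → Dec (P n)) → ∀ n → P n → ∃ λ m → (P m × (∀ k → P k → m ≤ k)) × m ≤ n
least-witness {P} P? n Pn = conclude (below (suc n))
  where
  below : ∀ n → (∃ λ m → (P m × (∀ k → P k → m ≤ k)) × m < n) ⊎ (∀ k → k < n → ¬ P k)
  below zero = inj₂ λ k ()
  below (suc n) with below n
  ... | inj₁ (m , h , m<n) = inj₁ (m , h , m<n⇒m<1+n m<n)
  ... | inj₂ none with P? n
  ...   | yes p = inj₁ (n , (p , λ k pk → ≮⇒≥ λ k<n → none k k<n pk) , ≤-refl)
  ...   | no ¬p = inj₂ λ k k< pk → [ (λ k<n → none k k<n pk) , (λ { refl → ¬p pk }) ]′ (m<1+n⇒m<n∨m≡n k<)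
  conclude : (∃ λ m → (P m × (∀ k → P k → m ≤ k)) × m < suc n) ⊎ (∀ k → k < suc n → ¬ P k) → ∃ λ m → (P m × (∀ k → P k → m ≤ k)) × m ≤ n
  conclude (inj₁ (m , h , m<)) = m , h , ≤-pred m<
  conclude (inj₂ none) = ⊥-elim (none n ≤-refl Pn)

least-s : ∀ {d n} → Bounds d n → ∃ λ m → Is-s d m × m ≤ n
least-s {d} {n} bound = least-witness (forces? d) n (Bounds⇒Forces bound)

-- The evaluation of the whole search, over the twenty triples 1 ≤ m₃ ≤ m₂ ≤ m₁ ≤ 4.
search-succeeds : runs (apex ∷ []) critical ≡ true
search-succeeds = refl

bounds₃ : Bounds 3 37
bounds₃ = bounds₃-from search-succeeds

theorem1p2 : Is-s 3 37
    × (∃[ m ] (Is-s 4 m × m ≤ 157))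
    × (∃[ m ] (Is-s 5 m × m ≤ 690))
    × (∃[ m ] (Is-s 6 m × m ≤ 3091))
theorem1p2 = (Bounds⇒Forces bounds₃ , lower₃) , least-s b₄ , least-s b₅ , least-s (bounds₆ b₅)
  where
  b₄ = bounds₄ bounds₃
  b₅ = bounds₅ b₄
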